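{- For every integer $d\geq 2$ and every integer $n\geq (30d)^{2d^2}$, $$1<\frac{\log p_d(n)}{n^{1-\frac{1}{d}}}<7200.$$
   Context: Let $\mathbb{Z}_+=\{0,1,2,\dots\}$. A set $S\subset\mathbb{Z}_+^d$ is a lower set (downward closed set) if whenever $\mathbf{x}=(x_1,\dots,x_d)\in S$ and $\mathbf{x}'\in\mathbb{Z}_+^d$ satisfies $x'_i\leq x_i$ for all $1\leq i\leq d$, then $\mathbf{x}'\in S$. For positive integers $d,n$, $p_d(n)$ denotes the number of lower sets in $\mathbb{Z}_+^d$ with exactly $n$ points (equivalently, the number of $(d-1)$-dimensional integer partitions of $n$). $\log$ is the natural logarithm. -}

module Defs where

open import Algebra.Bundles using (CommutativeRing)
open import Data.Empty using (⊥-elim)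
open import Data.Fin using (Fin; zero; suc)
import Data.Fin.Properties as Fin
open import Data.Integer as ℤ using (+_)
import Data.Integer.Properties as ℤ
open import Data.List as List using (List; []; _∷_; length; upTo; cartesianProductWith; concatMap; deduplicate)
open import Data.List.Membership.Propositional using (_∈_)
open import Data.List.Membership.Propositional.Properties using (∈-cartesianProductWith⁺; ∈-cartesianProductWith⁻; ∈-upTo⁺; ∈-upTo⁻; ∈-lookup; ∈-map⁻)
open import Data.List.Properties using (length-map; length-upTo)
open import Data.List.Relation.Unary.All as All using (All; []; _∷_)
open import Data.List.Relation.Unary.AllPairs as AllPairs using (AllPairs; []; _∷_)
open import Data.List.Relation.Unary.Any as Any using (Any; here; there)
import Data.List.Relation.Unary.Any.Properties as Any
open import Data.List.Relation.Unary.Enumerates.Setoid using (IsEnumeration)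
import Data.List.Relation.Unary.Enumerates.Setoid.Properties as Enumerates
import Data.List.Relation.Unary.Unique.DecSetoid.Properties as UniqueDec
open import Data.List.Relation.Unary.Unique.Propositional using (Unique)
import Data.List.Relation.Unary.Unique.Propositional.Properties as Unique
open import Data.Nat as ℕ using (ℕ; zero; suc)
import Data.Nat.Properties as ℕ
open import Data.Product using (∃; _×_; _,_; proj₁; proj₂)
open import Data.Rational as ℚ using (ℚ; 0ℚ; 1ℚ; ½; mkℚ; _<_; _≤_; _+_; _*_; _-_; -_; _/_; ∣_∣; toℚᵘ)
open import Data.Rational.Properties
open import Data.Rational.Solver using (module +-*-Solver)
import Data.Rational.Unnormalised as ℚᵘ
import Data.Rational.Unnormalised.Properties as ℚᵘ
open import Data.Sum using (_⊎_; inj₁; inj₂)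
open import Data.Vec as Vec using (Vec; []; _∷_; _[_]≔_)
import Data.Vec.Properties as Vec
open import Function.Bundles using (_⇔_; mk⇔; module Equivalence; Bijection)
open import Level using (0ℓ) renaming (suc to lsuc)
open import Relation.Binary.Bundles using (Setoid; DecSetoid)
open import Relation.Binary.Core using (Rel)
open import Relation.Binary.Definitions using (Symmetric; tri<; tri≈; tri>)
open import Relation.Binary.PropositionalEquality as ≡ using (_≡_; refl; sym; trans; cong; cong₂; subst; subst₂)
open import Relation.Nullary using (¬_; Dec; yes; no; contradiction)
open import Relation.Nullary.Decidable using (_×-dec_; ¬?; map′)
open import Relation.Unary using (Pred; Satisfiable; _≐_)
open import Relation.Unary.Properties using (≐-refl; ≐-sym; ≐-trans)
open import Algebra.Properties.Semiring.Exp (CommutativeRing.semiring +-*-commutativeRing) using (_^_)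

-- Dedekind reals: L is the set of rationals below the number, U the set above.
record ℝ : Set₁ where
  field
    L U         : Pred ℚ 0ℓ
    L-inhabited : Satisfiable L
    U-inhabited : Satisfiable U
    L-rounded   : ∀ q → L q ⇔ (∃ λ r → q < r × L r)
    U-rounded   : ∀ r → U r ⇔ (∃ λ q → q < r × U q)
    disjoint    : ∀ q → ¬ (L q × U q)
    located     : ∀ {q r} → q < r → L q ⊎ U r

open ℝ

infix 4 _<ʳ_

_<ʳ_ : ℝ → ℝ → Set
x <ʳ y = ∃ λ q → U x q × L y q

p<p+1 : ∀ p → p < p + 1ℚ
p<p+1 p = subst (_< p + 1ℚ) (+-identityʳ p) (+-monoʳ-< p (positive⁻¹ 1ℚ))

p-1<p : ∀ p → p - 1ℚ < p
p-1<p p = subst (p - 1ℚ <_) (+-identityʳ p) (+-monoʳ-< p (negative⁻¹ (- 1ℚ)))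

-- The unique real that is ≥ every element of A and ≤ every element of B.
cut : (A B : Pred ℚ 0ℓ) → Satisfiable A → Satisfiable B →
      (∀ {a b} → A a → B b → a ≤ b) →
      (∀ {q r} → q < r → (∃ λ a → q < a × A a) ⊎ (∃ λ b → b < r × B b)) → ℝ
cut A B (a₀ , A-a₀) (b₀ , B-b₀) A≤B loc = record
  { L           = λ q → ∃ λ a → q < a × A a
  ; U           = λ r → ∃ λ b → b < r × B b
  ; L-inhabited = a₀ - 1ℚ , a₀ , p-1<p a₀ , A-a₀
  ; U-inhabited = b₀ + 1ℚ , b₀ , p<p+1 b₀ , B-b₀
  ; L-rounded   = λ q → mk⇔
      (λ (a , q<a , Aa) → let (r , q<r , r<a) = <-dense q<a in r , q<r , a , r<a , Aa)
      (λ (r , q<r , a , r<a , Aa) → a , <-trans q<r r<a , Aa)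
  ; U-rounded   = λ r → mk⇔
      (λ (b , b<r , Bb) → let (q , b<q , q<r) = <-dense b<r in q , q<r , b , b<q , Bb)
      (λ (q , q<r , b , b<q , Bb) → b , <-trans b<q q<r , Bb)
  ; disjoint    = λ q ((a , q<a , Aa) , (b , b<q , Bb)) →
      <-irrefl refl (<-≤-trans (<-trans b<q q<a) (A≤B Aa Bb))
  ; located     = loc
  }

fromℚ : ℚ → ℝ
fromℚ c = cut (_≡ c) (_≡ c) (c , refl) (c , refl) (λ { refl refl → ≤-refl }) loc
  where
  loc : ∀ {q r} → q < r → (∃ λ a → q < a × a ≡ c) ⊎ (∃ λ b → b < r × b ≡ c)
  loc {q} q<r with q <? c
  ... | yes q<c = inj₁ (c , q<c , refl)
  ... | no  q≮c = inj₂ (c , ≤-<-trans (≮⇒≥ q≮c) q<r , refl)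

ℕ→ℚ : ℕ → ℚ
ℕ→ℚ n = + n / 1

fromℕ : ℕ → ℝ
fromℕ n = fromℚ (ℕ→ℚ n)

fracᵘ : ∀ a k → toℚᵘ (+ a / suc k) ℚᵘ.≃ ℚᵘ.mkℚᵘ (+ a) k
fracᵘ a k = toℚᵘ-fromℚᵘ (ℚᵘ.mkℚᵘ (+ a) k)

frac-mono-≤ : ∀ {a k b l} → a ℕ.* suc l ℕ.≤ b ℕ.* suc k → + a / suc k ≤ + b / suc l
frac-mono-≤ {a} {k} {b} {l} h = toℚᵘ-cancel-≤
  (ℚᵘ.≤-trans (ℚᵘ.≤-reflexive (fracᵘ a k))
  (ℚᵘ.≤-trans (ℚᵘ.*≤* (subst₂ ℤ._≤_ (ℤ.pos-* a (suc l)) (ℤ.pos-* b (suc k)) (ℤ.+≤+ h)))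
              (ℚᵘ.≤-reflexive (ℚᵘ.≃-sym (fracᵘ b l)))))

frac-mono-< : ∀ {a k b l} → a ℕ.* suc l ℕ.< b ℕ.* suc k → + a / suc k < + b / suc l
frac-mono-< {a} {k} {b} {l} h = toℚᵘ-cancel-<
  (ℚᵘ.≤-<-trans (ℚᵘ.≤-reflexive (fracᵘ a k))
  (ℚᵘ.<-≤-trans (ℚᵘ.*<* (subst₂ ℤ._<_ (ℤ.pos-* a (suc l)) (ℤ.pos-* b (suc k)) (ℤ.+<+ h)))
              (ℚᵘ.≤-reflexive (ℚᵘ.≃-sym (fracᵘ b l)))))

0≤ℕ→ℚ : ∀ n → 0ℚ ≤ ℕ→ℚ n
0≤ℕ→ℚ n = frac-mono-≤ {0} {0} {n} {0} ℕ.z≤n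

ℕ→ℚ-suc : ∀ n → ℕ→ℚ (suc n) ≡ 1ℚ + ℕ→ℚ n
ℕ→ℚ-suc n = toℚᵘ-injective (begin
  toℚᵘ (+ suc n / 1)            ≈⟨ fracᵘ (suc n) 0 ⟩
  ℚᵘ.mkℚᵘ (+ suc n) 0           ≈⟨ ℚᵘ.*≡* (cong (ℤ._* + 1) (cong (λ x → + suc x) (sym (ℕ.*-identityʳ n))) ) ⟩
  ℚᵘ.mkℚᵘ (+ suc (n ℕ.* 1)) 0   ≈⟨ ℚᵘ.*≡* (cong (λ x → (+ 1 ℤ.+ x) ℤ.* + 1) (ℤ.pos-* n 1)) ⟩
  ℚᵘ.1ℚᵘ ℚᵘ.+ ℚᵘ.mkℚᵘ (+ n) 0   ≈⟨ ℚᵘ.+-congʳ ℚᵘ.1ℚᵘ (ℚᵘ.≃-sym (fracᵘ n 0)) ⟩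
  toℚᵘ 1ℚ ℚᵘ.+ toℚᵘ (+ n / 1)   ≈⟨ ℚᵘ.≃-sym (toℚᵘ-homo-+ 1ℚ (ℕ→ℚ n)) ⟩
  toℚᵘ (1ℚ + ℕ→ℚ n) ∎)
  where open ℚᵘ.≃-Reasoning

1/1+ : ℕ → ℚ
1/1+ k = + 1 / suc k

ℕ*1/1+ : ∀ a k → ℕ→ℚ a * 1/1+ k ≡ + a / suc k
ℕ*1/1+ a k = toℚᵘ-injective (begin
  toℚᵘ (ℕ→ℚ a * 1/1+ k)            ≈⟨ toℚᵘ-homo-* (ℕ→ℚ a) (1/1+ k) ⟩
  toℚᵘ (ℕ→ℚ a) ℚᵘ.* toℚᵘ (1/1+ k)   ≈⟨ ℚᵘ.*-cong (fracᵘ a 0) (fracᵘ 1 k) ⟩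
  ℚᵘ.mkℚᵘ (+ a) 0 ℚᵘ.* ℚᵘ.mkℚᵘ (+ 1) k ≈⟨ ℚᵘ.*≡* (cong₂ (λ x y → x ℤ.* + suc y) (ℤ.*-identityʳ (+ a)) (sym (ℕ.+-identityʳ k))) ⟩
  ℚᵘ.mkℚᵘ (+ a) k                  ≈⟨ ℚᵘ.≃-sym (fracᵘ a k) ⟩
  toℚᵘ (+ a / suc k) ∎)
  where open ℚᵘ.≃-Reasoning

p<q⇒0<q-p : ∀ {p q} → p < q → 0ℚ < q - p
p<q⇒0<q-p {p} {q} p<q = subst (_< q - p) (+-inverseʳ p) (+-monoˡ-< (- p) p<q)

archimedean : ∀ {ε} → 0ℚ < ε → ∃ λ k → 1/1+ k < ε
archimedean {mkℚ (+ zero) d c}  (ℚ.*<* (ℤ.+<+ ()))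
archimedean {ε@(mkℚ (+ suc n) d c)} 0<ε = suc d , subst (1/1+ (suc d) <_) (↥p/↧p≡p ε)
  (frac-mono-< {1} {suc d} {suc n} {d} (ℕ.<-≤-trans
    (subst (ℕ._< suc (suc d)) (sym (ℕ.*-identityˡ (suc d))) (ℕ.n<1+n (suc d))) (ℕ.m≤m+n (suc (suc d)) (n ℕ.* suc (suc d)))))
archimedean {mkℚ (ℤ.-[1+ n ]) d c} (ℚ.*<* ())

-- ∑1/ k l = ∑_{i<l} 1/(k+1+i)
∑1/ : ℕ → ℕ → ℚ
∑1/ k zero    = 0ℚ
∑1/ k (suc l) = 1/1+ k + ∑1/ (suc k) l

-- Riemann sums of 1/t over [1,m] with mesh 1/N, N = k+1:
--   lower = ∑_{i<(m-1)N} (1/N)·1/(1+(i+1)/N) = ∑_{i<(m-1)N} 1/(N+i+1),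
--   upper = ∑_{i<(m-1)N} (1/N)·1/(1+i/N)     = ∑_{i<(m-1)N} 1/(N+i).
lowerSum upperSum : ℕ → ℕ → ℚ
lowerSum m k = ∑1/ (suc k) ((m ℕ.∸ 1) ℕ.* suc k)
upperSum m k = ∑1/ k ((m ℕ.∸ 1) ℕ.* suc k)

1/1+-anti : ∀ {k l} → k ℕ.≤ l → 1/1+ l ≤ 1/1+ k
1/1+-anti {k} {l} k≤l = frac-mono-≤ {1} {l} {1} {k} (ℕ.*-monoʳ-≤ 1 (ℕ.s≤s k≤l))

0≤1/1+ : ∀ k → 0ℚ ≤ 1/1+ k
0≤1/1+ k = frac-mono-≤ {0} {0} {1} {k} ℕ.z≤n

∑-telescope : ∀ k l → ∑1/ k l + 1/1+ (k ℕ.+ l) ≡ 1/1+ k + ∑1/ (suc k) l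
∑-telescope k zero rewrite ℕ.+-identityʳ k = +-comm 0ℚ (1/1+ k)
∑-telescope k (suc l) rewrite ℕ.+-suc k l =
  trans (+-assoc (1/1+ k) (∑1/ (suc k) l) (1/1+ (suc (k ℕ.+ l)))) (cong (λ v → 1/1+ k + v) (∑-telescope (suc k) l))

∑-split : ∀ k a b → ∑1/ k (a ℕ.+ b) ≡ ∑1/ k a + ∑1/ (k ℕ.+ a) b
∑-split k zero b rewrite ℕ.+-identityʳ k = sym (+-identityˡ (∑1/ k b))
∑-split k (suc a) b rewrite ℕ.+-suc k a =
  trans (cong (λ v → 1/1+ k + v) (∑-split (suc k) a b)) (sym (+-assoc (1/1+ k) (∑1/ (suc k) a) _))

suc*p : ∀ l p → ℕ→ℚ (suc l) * p ≡ p + ℕ→ℚ l * p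
suc*p l p = trans (cong (λ v → v * p) (ℕ→ℚ-suc l))
  (trans (*-distribʳ-+ p 1ℚ (ℕ→ℚ l)) (cong (λ v → v + ℕ→ℚ l * p) (*-identityˡ p)))

∑-upper : ∀ k l j → j ℕ.≤ k → ∑1/ k l ≤ ℕ→ℚ l * 1/1+ j
∑-upper k zero j j≤k = ≤-reflexive (sym (*-zeroˡ (1/1+ j)))
∑-upper k (suc l) j j≤k = subst (∑1/ k (suc l) ≤_) (sym (suc*p l (1/1+ j)))
  (+-mono-≤ (1/1+-anti j≤k) (∑-upper (suc k) l j (ℕ.m≤n⇒m≤1+n j≤k)))

∑-lower : ∀ k l j → k ℕ.+ l ℕ.≤ suc j → ℕ→ℚ l * 1/1+ j ≤ ∑1/ k l
∑-lower k zero j h = ≤-reflexive (*-zeroˡ (1/1+ j))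
∑-lower k (suc l) j h = subst (_≤ ∑1/ k (suc l)) (sym (suc*p l (1/1+ j)))
  (+-mono-≤ (1/1+-anti (ℕ.≤-trans (ℕ.m≤m+n k l) (ℕ.≤-pred h'))) (∑-lower (suc k) l j h'))
  where h' = subst (ℕ._≤ suc j) (ℕ.+-suc k l) h

-- (m+1)/((k+1)(m+1)) = 1/(k+1)
suc*1/1+ : ∀ m k → ℕ→ℚ (suc m) * 1/1+ (m ℕ.+ k ℕ.* suc m) ≡ 1/1+ k
suc*1/1+ m k = trans (ℕ*1/1+ (suc m) (m ℕ.+ k ℕ.* suc m)) (≤-antisym
  (frac-mono-≤ {suc m} {m ℕ.+ k ℕ.* suc m} {1} {k} (ℕ.≤-reflexive e))
  (frac-mono-≤ {1} {k} {suc m} {m ℕ.+ k ℕ.* suc m} (ℕ.≤-reflexive (sym e))))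
  where
  e : suc m ℕ.* suc k ≡ 1 ℕ.* (suc k ℕ.* suc m)
  e = trans (ℕ.*-comm (suc m) (suc k)) (sym (ℕ.*-identityˡ _))

refine-lower : ∀ n m l → ∑1/ n l ≤ ∑1/ (n ℕ.* suc m) (l ℕ.* suc m)
refine-lower n m zero = ≤-refl
refine-lower n m (suc l) = subst (∑1/ n (suc l) ≤_) (sym (∑-split (n ℕ.* suc m) (suc m) (l ℕ.* suc m)))
  (+-mono-≤
    (subst (_≤ ∑1/ (n ℕ.* suc m) (suc m)) (suc*1/1+ m n)
      (∑-lower (n ℕ.* suc m) (suc m) (m ℕ.+ n ℕ.* suc m) (ℕ.≤-reflexive (ℕ.+-comm (n ℕ.* suc m) (suc m)))))
    (subst (λ v → ∑1/ (suc n) l ≤ ∑1/ v (l ℕ.* suc m)) (ℕ.+-comm (suc m) (n ℕ.* suc m)) (refine-lower (suc n) m l)))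

refine-upper : ∀ k m l → ∑1/ (m ℕ.+ k ℕ.* suc m) (l ℕ.* suc m) ≤ ∑1/ k l
refine-upper k m zero = ≤-refl
refine-upper k m (suc l) = subst (_≤ ∑1/ k (suc l)) (sym (∑-split (m ℕ.+ k ℕ.* suc m) (suc m) (l ℕ.* suc m)))
  (+-mono-≤
    (subst (∑1/ (m ℕ.+ k ℕ.* suc m) (suc m) ≤_) (suc*1/1+ m k)
      (∑-upper (m ℕ.+ k ℕ.* suc m) (suc m) (m ℕ.+ k ℕ.* suc m) ℕ.≤-refl))
    (subst (λ v → ∑1/ v (l ℕ.* suc m) ≤ ∑1/ (suc k) l) e (refine-upper (suc k) m l)))
  where
  e : m ℕ.+ (suc m ℕ.+ k ℕ.* suc m) ≡ (m ℕ.+ k ℕ.* suc m) ℕ.+ suc m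
  e = trans (cong (m ℕ.+_) (ℕ.+-comm (suc m) _)) (sym (ℕ.+-assoc m _ (suc m)))

∑-shift : ∀ k l → ∑1/ (suc k) l ≤ ∑1/ k l
∑-shift k zero = ≤-refl
∑-shift k (suc l) = +-mono-≤ (1/1+-anti (ℕ.n≤1+n k)) (∑-shift (suc k) l)

lower≤upper : ∀ m i j → lowerSum m i ≤ upperSum m j
lower≤upper m i j = begin
  ∑1/ (suc i) (c ℕ.* suc i)                          ≤⟨ refine-lower (suc i) j (c ℕ.* suc i) ⟩
  ∑1/ (suc i ℕ.* suc j) (c ℕ.* suc i ℕ.* suc j)       ≤⟨ ∑-shift (j ℕ.+ i ℕ.* suc j) (c ℕ.* suc i ℕ.* suc j) ⟩
  ∑1/ (j ℕ.+ i ℕ.* suc j) (c ℕ.* suc i ℕ.* suc j)     ≡⟨ cong₂ ∑1/ (ℕ.suc-injective (ℕ.*-comm (suc i) (suc j))) e ⟩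
  ∑1/ (i ℕ.+ j ℕ.* suc i) (c ℕ.* suc j ℕ.* suc i)     ≤⟨ refine-upper j i (c ℕ.* suc j) ⟩
  ∑1/ j (c ℕ.* suc j) ∎
  where
  open ≤-Reasoning
  c = m ℕ.∸ 1
  e : c ℕ.* suc i ℕ.* suc j ≡ c ℕ.* suc j ℕ.* suc i
  e = trans (ℕ.*-assoc c _ _) (trans (cong (c ℕ.*_) (ℕ.*-comm (suc i) (suc j))) (sym (ℕ.*-assoc c _ _)))

upper≤lower+ : ∀ m k → upperSum m k ≤ 1/1+ k + lowerSum m k
upper≤lower+ m k = begin
  ∑1/ k l                    ≡⟨ sym (+-identityʳ _) ⟩
  ∑1/ k l + 0ℚ               ≤⟨ +-monoʳ-≤ (∑1/ k l) (0≤1/1+ (k ℕ.+ l)) ⟩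
  ∑1/ k l + 1/1+ (k ℕ.+ l)   ≡⟨ ∑-telescope k l ⟩
  1/1+ k + ∑1/ (suc k) l ∎
  where
  open ≤-Reasoning
  l = (m ℕ.∸ 1) ℕ.* suc k

-- Natural logarithm: log m = ∫₁ᵐ dt/t for m ≥ 1; the value log 0 = 0 is a
-- placeholder.
log : ℕ → ℝ
log m = cut (λ s → ∃ λ k → s ≡ lowerSum m k) (λ s → ∃ λ k → s ≡ upperSum m k)
  (lowerSum m 0 , 0 , refl) (upperSum m 0 , 0 , refl)
  (λ { (i , refl) (j , refl) → lower≤upper m i j }) loc
  where
  loc : ∀ {q r} → q < r → (∃ λ s → q < s × ∃ λ k → s ≡ lowerSum m k) ⊎
                          (∃ λ s → s < r × ∃ λ k → s ≡ upperSum m k)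
  loc {q} {r} q<r with archimedean (p<q⇒0<q-p q<r)
  ... | k , 1/k<r-q with q <? lowerSum m k
  ...   | yes q<s = inj₁ (_ , q<s , k , refl)
  ...   | no  q≮s = inj₂ (_ , (begin-strict
            upperSum m k           ≤⟨ upper≤lower+ m k ⟩
            1/1+ k + lowerSum m k  ≤⟨ +-monoʳ-≤ (1/1+ k) (≮⇒≥ q≮s) ⟩
            1/1+ k + q             <⟨ +-monoˡ-< q 1/k<r-q ⟩
            (r - q) + q            ≡⟨ solve 2 (λ r q → (r :- q) :+ q := r) refl r q ⟩
            r                      ∎) , k , refl)
    where open ≤-Reasoning
          open +-*-Solver

0≤^ : ∀ {s} b → 0ℚ ≤ s → 0ℚ ≤ s ^ b
0≤^ zero 0≤s = <⇒≤ (positive⁻¹ 1ℚ)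
0≤^ {s} (suc b) 0≤s = subst (_≤ s * s ^ b) (*-zeroˡ (s ^ b)) (*-monoʳ-≤-nonNeg (s ^ b) {{ℚ.nonNegative (0≤^ b 0≤s)}} 0≤s)
^-mono-< : ∀ {s t} b .{{_ : ℕ.NonZero b}} → 0ℚ ≤ s → s < t → s ^ b < t ^ b
^-mono-< {s} {t} (suc zero) 0≤s s<t = subst₂ _<_ (sym (*-identityʳ s)) (sym (*-identityʳ t)) s<t
^-mono-< {s} {t} (suc b@(suc _)) 0≤s s<t = let ih = ^-mono-< b 0≤s s<t in ≤-<-trans
  (*-monoˡ-≤-nonNeg s {{ℚ.nonNegative 0≤s}} (<⇒≤ ih))
  (*-monoˡ-<-pos (t ^ b) {{ℚ.positive (≤-<-trans (0≤^ b 0≤s) ih)}} s<t)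

p≤p^b : ∀ {p} b .{{_ : ℕ.NonZero b}} → 1ℚ ≤ p → p ≤ p ^ b
p≤p^b {p} (suc zero) 1≤p = ≤-reflexive (sym (*-identityʳ p))
p≤p^b {p} (suc b@(suc _)) 1≤p = ≤-trans (p≤p^b b 1≤p)
  (subst (_≤ p * p ^ b) (*-identityˡ (p ^ b)) (*-monoʳ-≤-nonNeg (p ^ b) {{ℚ.nonNegative (0≤^ b (≤-trans (<⇒≤ (positive⁻¹ 1ℚ)) 1≤p))}} 1≤p))

0^b≡0 : ∀ b .{{_ : ℕ.NonZero b}} → 0ℚ ^ b ≡ 0ℚ
0^b≡0 (suc b) = *-zeroˡ (0ℚ ^ b)

-- n ^[ a / b ] is the real power n^(a/b): the nonnegative real whose b-th power
-- is n^a.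
_^[_/_] : (n a b : ℕ) .{{_ : ℕ.NonZero b}} → ℝ
n ^[ a / b ] = cut A B
  (0ℚ , ≤-refl , subst (_≤ N) (sym (0^b≡0 b)) (0≤ℕ→ℚ (n ℕ.^ a)))
  (1ℚ + N , ≤-trans (<⇒≤ (positive⁻¹ 1ℚ)) 1≤1+N , ≤-trans N≤1+N (p≤p^b b 1≤1+N))
  A≤B loc
  where
  N = ℕ→ℚ (n ℕ.^ a)
  A B : Pred ℚ 0ℓ
  A s = 0ℚ ≤ s × s ^ b ≤ N
  B s = 0ℚ ≤ s × N ≤ s ^ b
  1≤1+N : 1ℚ ≤ 1ℚ + N
  1≤1+N = subst (_≤ 1ℚ + N) (+-identityʳ 1ℚ) (+-monoʳ-≤ 1ℚ (0≤ℕ→ℚ (n ℕ.^ a)))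
  N≤1+N : N ≤ 1ℚ + N
  N≤1+N = subst (_≤ 1ℚ + N) (+-identityˡ N) (+-monoˡ-≤ N (<⇒≤ (positive⁻¹ 1ℚ)))
  A≤B : ∀ {s t} → A s → B t → s ≤ t
  A≤B {s} {t} (0≤s , sᵇ≤N) (0≤t , N≤tᵇ) = ≮⇒≥ λ t<s →
    <-irrefl refl (<-≤-trans (^-mono-< b 0≤t t<s) (≤-trans sᵇ≤N N≤tᵇ))
  loc : ∀ {q r} → q < r → (∃ λ s → q < s × A s) ⊎ (∃ λ s → s < r × B s)
  loc q<r with <-dense q<r
  ... | s , q<s , s<r with 0ℚ ≤? s
  ...   | no 0≰s = inj₁ (0ℚ , <-trans q<s (≰⇒> 0≰s) , ≤-refl , subst (_≤ N) (sym (0^b≡0 b)) (0≤ℕ→ℚ (n ℕ.^ a)))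
  ...   | yes 0≤s with ≤-total (s ^ b) N
  ...     | inj₁ sᵇ≤N = inj₁ (s , q<s , 0≤s , sᵇ≤N)
  ...     | inj₂ N≤sᵇ = inj₂ (s , s<r , 0≤s , N≤sᵇ)

1^b≡1 : ∀ b → 1ℚ ^ b ≡ 1ℚ
1^b≡1 zero = refl
1^b≡1 (suc b) = trans (*-identityˡ (1ℚ ^ b)) (1^b≡1 b)

^[/]-positive : ∀ n a b .{{_ : ℕ.NonZero n}} .{{_ : ℕ.NonZero b}} → fromℕ 0 <ʳ n ^[ a / b ]
^[/]-positive n a b = ½ , (0ℚ , positive⁻¹ ½ , refl) ,
  1ℚ , ½<1 , <⇒≤ (positive⁻¹ 1ℚ) , subst (_≤ ℕ→ℚ (n ℕ.^ a)) (sym (1^b≡1 b))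
    (frac-mono-≤ {1} {0} {n ℕ.^ a} {0} (ℕ.*-monoˡ-≤ 1 (ℕ.m^n>0 n a)))
  where
  ½<1 : ½ < 1ℚ
  ½<1 = ℚ.*<* (ℤ.+<+ (ℕ.s≤s (ℕ.s≤s ℕ.z≤n)))

L<U : ∀ x {a b} → L x a → U x b → a < b
L<U x {a} {b} La Ub with a <? b
... | yes a<b = a<b
... | no a≮b with <-cmp b a
...   | tri< b<a _ _ = ⊥-elim (disjoint x b (Equivalence.from (L-rounded x b) (a , b<a , La) , Ub))
...   | tri≈ _ refl _ = ⊥-elim (disjoint x b (La , Ub))
...   | tri> _ _ a<b = a<b

p≡q+[p-q] : ∀ p q → p ≡ q + (p - q)
p≡q+[p-q] = solve 2 (λ p q → p := q :+ (p :- q)) refl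
  where open +-*-Solver

p≤∣p∣ : ∀ p → p ≤ ∣ p ∣
p≤∣p∣ p with 0ℚ ≤? p
... | yes 0≤p = ≤-reflexive (sym (0≤p⇒∣p∣≡p 0≤p))
... | no 0≰p = ≤-trans (<⇒≤ (≰⇒> 0≰p)) (0≤∣p∣ p)

-∣p∣≤p : ∀ p → - ∣ p ∣ ≤ p
-∣p∣≤p p = subst (- ∣ p ∣ ≤_) (neg-involutive p)
  (neg-antimono-≤ (subst (- p ≤_) (∣-p∣≡∣p∣ p) (p≤∣p∣ (- p))))
  where open import Algebra.Properties.Group +-0-group renaming (⁻¹-involutive to neg-involutive)

bounded : ∀ p → ∃ λ k → p ≤ ℕ→ℚ k
bounded p@(mkℚ (+ n) d c) = n , subst (_≤ ℕ→ℚ n) (↥p/↧p≡p p)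
  (frac-mono-≤ {n} {d} {n} {0} (ℕ.*-monoʳ-≤ n (ℕ.s≤s ℕ.z≤n)))
bounded p@(mkℚ ℤ.-[1+ n ] d c) = 0 , ℚ.*≤* ℤ.-≤+

bounded-by-multiple : ∀ p {ε} → 0ℚ < ε → ∃ λ k → p ≤ ℕ→ℚ k * ε
bounded-by-multiple p {ε} 0<ε = k , subst (_≤ ℕ→ℚ k * ε) e (*-monoʳ-≤-nonNeg ε {{pos⇒nonNeg ε}} (proj₂ (bounded (p * 1/ε))))
  where
  instance _ = ℚ.positive 0<ε
           _ = pos⇒nonZero ε
  1/ε = ℚ.1/ ε
  k = proj₁ (bounded (p * 1/ε))
  e : p * 1/ε * ε ≡ p
  e = trans (*-assoc p 1/ε ε) (trans (cong (p *_) (*-inverseˡ ε)) (*-identityʳ p))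

approximate : ∀ x {ε a₀} → 0ℚ < ε → L x a₀ →
              ∃ λ a → ∃ λ b → a₀ ≤ a × L x a × U x b × b ≤ a + (ε + ε)
approximate x {ε} {a₀} 0<ε La₀ = go (proj₁ bound) a₀ ≤-refl La₀ (begin
    b₀                        ≡⟨ p≡q+[p-q] b₀ a₀ ⟩
    a₀ + (b₀ - a₀)            ≤⟨ +-monoʳ-≤ a₀ (proj₂ bound) ⟩
    a₀ + ℕ→ℚ (proj₁ bound) * ε ∎)
  where
  open ≤-Reasoning
  b₀ = proj₁ (U-inhabited x)
  bound = bounded-by-multiple (b₀ - a₀) 0<ε
  0≤ε+ε : 0ℚ ≤ ε + ε
  0≤ε+ε = +-mono-≤ (<⇒≤ 0<ε) (<⇒≤ 0<ε)
  grow : ∀ p {e} → 0ℚ < e → p < p + e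
  grow p {e} 0<e = subst (_< p + e) (+-identityʳ p) (+-monoʳ-< p 0<e)
  go : ∀ k a → a₀ ≤ a → L x a → b₀ ≤ a + ℕ→ℚ k * ε →
       ∃ λ a → ∃ λ b → a₀ ≤ a × L x a × U x b × b ≤ a + (ε + ε)
  go zero a a₀≤a La b₀≤ = a , b₀ , a₀≤a , La , proj₂ (U-inhabited x) , (begin
    b₀                ≤⟨ b₀≤ ⟩
    a + 0ℚ * ε        ≡⟨ cong (λ v → a + v) (*-zeroˡ ε) ⟩
    a + 0ℚ            ≤⟨ +-monoʳ-≤ a 0≤ε+ε ⟩
    a + (ε + ε) ∎)
  go (suc k) a a₀≤a La b₀≤ with located x (subst (a + ε <_) (+-assoc a ε ε) (grow (a + ε) 0<ε))
  ... | inj₁ La+ε = go k (a + ε) (≤-trans a₀≤a (<⇒≤ (grow a 0<ε))) La+ε (begin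
    b₀                       ≤⟨ b₀≤ ⟩
    a + ℕ→ℚ (suc k) * ε      ≡⟨ cong (λ v → a + v) (suc*p k ε) ⟩
    a + (ε + ℕ→ℚ k * ε)      ≡⟨ sym (+-assoc a ε _) ⟩
    (a + ε) + ℕ→ℚ k * ε      ∎)
  ... | inj₂ Ua+2ε = a , a + (ε + ε) , a₀≤a , La , Ua+2ε , ≤-refl

-- x / y for y > 0.  A collects the rationals s with s ≤ a/e for some a < x and
-- every e in some interval [c , d] around y with 0 < c (s may be negative, so
-- both endpoints are needed); B is the mirror image.
module Division (x y : ℝ) (0<y : fromℕ 0 <ʳ y) where

  A B : Pred ℚ 0ℓ
  A s = ∃ λ a → ∃ λ c → ∃ λ d → L x a × L y c × U y d × 0ℚ < c × s * c ≤ a × s * d ≤ a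
  B s = ∃ λ b → ∃ λ c → ∃ λ d → U x b × L y c × U y d × 0ℚ < c × b ≤ s * c × b ≤ s * d

  c₀ = proj₁ 0<y

  0<c₀ : 0ℚ < c₀
  0<c₀ = let (_ , 0<c , 0≡) = proj₁ (proj₂ 0<y) in subst (_< c₀) 0≡ 0<c

  Lc₀ : L y c₀
  Lc₀ = proj₂ (proj₂ 0<y)

  convex-≤ : ∀ s {a c e d} → c ≤ e → e ≤ d → s * c ≤ a → s * d ≤ a → s * e ≤ a
  convex-≤ s c≤e e≤d sc≤a sd≤a with ≤-total 0ℚ s
  ... | inj₁ 0≤s = ≤-trans (*-monoˡ-≤-nonNeg s {{ℚ.nonNegative 0≤s}} e≤d) sd≤a
  ... | inj₂ s≤0 = ≤-trans (*-monoˡ-≤-nonPos s {{ℚ.nonPositive s≤0}} c≤e) sc≤a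

  convex-≥ : ∀ s {a c e d} → c ≤ e → e ≤ d → a ≤ s * c → a ≤ s * d → a ≤ s * e
  convex-≥ s c≤e e≤d a≤sc a≤sd with ≤-total 0ℚ s
  ... | inj₁ 0≤s = ≤-trans a≤sc (*-monoˡ-≤-nonNeg s {{ℚ.nonNegative 0≤s}} c≤e)
  ... | inj₂ s≤0 = ≤-trans a≤sd (*-monoˡ-≤-nonPos s {{ℚ.nonPositive s≤0}} e≤d)

  A≤B : ∀ {s t} → A s → B t → s ≤ t
  A≤B {s} {t} (a , c , d , La , Lc , Ud , 0<c , sc≤a , sd≤a)
              (b , c′ , d′ , Ub , Lc′ , Ud′ , 0<c′ , b≤tc′ , b≤td′) with ≤-total c c′
  ... | inj₁ c≤c′ = *-cancelʳ-≤-pos c′ {{ℚ.positive 0<c′}}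
        (≤-trans (convex-≤ s c≤c′ (<⇒≤ (L<U y Lc′ Ud)) sc≤a sd≤a) (≤-trans (<⇒≤ (L<U x La Ub)) b≤tc′))
  ... | inj₂ c′≤c = *-cancelʳ-≤-pos c {{ℚ.positive 0<c}}
        (≤-trans sc≤a (≤-trans (<⇒≤ (L<U x La Ub)) (convex-≥ t c′≤c (<⇒≤ (L<U y Lc Ud′)) b≤tc′ b≤td′)))

  A-inhabited : Satisfiable A
  A-inhabited = s , a , c₀ , d , La , Lc₀ , Ud , 0<c₀ , sc₀≤a , ≤-trans (*-monoˡ-≤-nonPos s {{ℚ.nonPositive s≤0}} (<⇒≤ (L<U y Lc₀ Ud))) sc₀≤a
    where
    instance _ = ℚ.positive 0<c₀
             _ = pos⇒nonZero c₀
    a = proj₁ (L-inhabited x)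
    La = proj₂ (L-inhabited x)
    d = proj₁ (U-inhabited y)
    Ud = proj₂ (U-inhabited y)
    s = - ∣ a ∣ * ℚ.1/ c₀
    sc₀≤a : s * c₀ ≤ a
    sc₀≤a = subst (_≤ a) (sym (trans (*-assoc (- ∣ a ∣) _ c₀) (trans (cong (λ v → - ∣ a ∣ * v) (*-inverseˡ c₀)) (*-identityʳ _)))) (-∣p∣≤p a)
    s≤0 : s ≤ 0ℚ
    s≤0 = subst (s ≤_) (*-zeroˡ (ℚ.1/ c₀)) (*-monoʳ-≤-nonNeg (ℚ.1/ c₀) {{pos⇒nonNeg (ℚ.1/ c₀) {{1/pos⇒pos c₀}}}} (neg-antimono-≤ (0≤∣p∣ a)))

  B-inhabited : Satisfiable B
  B-inhabited = s , b , c₀ , d , Ub , Lc₀ , Ud , 0<c₀ , b≤sc₀ , ≤-trans b≤sc₀ (*-monoˡ-≤-nonNeg s {{ℚ.nonNegative 0≤s}} (<⇒≤ (L<U y Lc₀ Ud)))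
    where
    instance _ = ℚ.positive 0<c₀
             _ = pos⇒nonZero c₀
    b = proj₁ (U-inhabited x)
    Ub = proj₂ (U-inhabited x)
    d = proj₁ (U-inhabited y)
    Ud = proj₂ (U-inhabited y)
    s = ∣ b ∣ * ℚ.1/ c₀
    b≤sc₀ : b ≤ s * c₀
    b≤sc₀ = subst (b ≤_) (sym (trans (*-assoc ∣ b ∣ _ c₀) (trans (cong (λ v → ∣ b ∣ * v) (*-inverseˡ c₀)) (*-identityʳ _)))) (p≤∣p∣ b)
    0≤s : 0ℚ ≤ s
    0≤s = subst (_≤ s) (*-zeroˡ (ℚ.1/ c₀)) (*-monoʳ-≤-nonNeg (ℚ.1/ c₀) {{pos⇒nonNeg (ℚ.1/ c₀) {{1/pos⇒pos c₀}}}} (0≤∣p∣ b))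

  gap : ∀ {s t η e e′} → s < t → c₀ ≤ e′ → ∣ e - e′ ∣ ≤ η → η * (1ℚ + ∣ s ∣) ≡ (t - s) * c₀ → s * e + η ≤ t * e′
  gap {s} {t} {η} {e} {e′} s<t c₀≤e′ e-e′ ηδ = begin
    s * e + η                       ≡⟨ solve 4 (λ s e e′ η → s :* e :+ η := s :* e′ :+ (s :* (e :- e′) :+ η)) refl s e e′ η ⟩
    s * e′ + (s * (e - e′) + η)     ≤⟨ +-monoʳ-≤ (s * e′) (+-monoˡ-≤ η (p≤∣p∣ (s * (e - e′)))) ⟩
    s * e′ + (∣ s * (e - e′) ∣ + η) ≡⟨ cong (λ v → s * e′ + (v + η)) (∣p*q∣≡∣p∣*∣q∣ s (e - e′)) ⟩
    s * e′ + (∣ s ∣ * ∣ e - e′ ∣ + η) ≤⟨ +-monoʳ-≤ (s * e′) (+-monoˡ-≤ η (*-monoˡ-≤-nonNeg ∣ s ∣ {{∣-∣-nonNeg s}} e-e′)) ⟩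
    s * e′ + (∣ s ∣ * η + η)        ≡⟨ cong (λ v → s * e′ + v) (solve 2 (λ m η → m :* η :+ η := η :* (con 1ℚ :+ m)) refl ∣ s ∣ η) ⟩
    s * e′ + η * (1ℚ + ∣ s ∣)       ≡⟨ cong (λ v → s * e′ + v) ηδ ⟩
    s * e′ + (t - s) * c₀           ≤⟨ +-monoʳ-≤ (s * e′) (*-monoˡ-≤-nonNeg (t - s) {{ℚ.nonNegative (<⇒≤ (p<q⇒0<q-p s<t))}} c₀≤e′) ⟩
    s * e′ + (t - s) * e′           ≡⟨ solve 3 (λ s t e′ → s :* e′ :+ (t :- s) :* e′ := t :* e′) refl s t e′ ⟩
    t * e′                          ∎
    where open ≤-Reasoning
          open +-*-Solver

  loc : ∀ {q r} → q < r → (∃ λ s → q < s × A s) ⊎ (∃ λ s → s < r × B s)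
  loc {q} {r} q<r with <-dense q<r
  ... | s , q<s , s<r with <-dense s<r
  ... | t , s<t , t<r = decide (approximate x 0<ε (proj₂ (L-inhabited x))) (approximate y 0<ε Lc₀)
    where
    M = 1ℚ + ∣ s ∣
    δ = (t - s) * c₀
    0<M : 0ℚ < M
    0<M = <-≤-trans (positive⁻¹ 1ℚ) (subst (_≤ M) (+-identityʳ 1ℚ) (+-monoʳ-≤ 1ℚ (0≤∣p∣ s)))
    instance _ = ℚ.positive 0<M
             _ = pos⇒nonZero M
             _ = 1/pos⇒pos M
             _ = ℚ.positive 0<c₀
             _ = ℚ.positive (p<q⇒0<q-p s<t)
             _ = pos*pos⇒pos (t - s) c₀
             _ = pos*pos⇒pos δ ½
    ε = δ * ½ * ℚ.1/ M
    η = ε + ε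
    0<ε : 0ℚ < ε
    0<ε = positive⁻¹ ε {{pos*pos⇒pos (δ * ½) (ℚ.1/ M)}}
    ηM≡δ : η * M ≡ δ
    ηM≡δ = trans (solve 4 (λ d h u m → (d :* h :* u :+ d :* h :* u) :* m := d :* (h :+ h) :* (u :* m)) refl δ ½ (ℚ.1/ M) M)
      (trans (cong (λ v → δ * 1ℚ * v) (*-inverseˡ M)) (trans (*-identityʳ (δ * 1ℚ)) (*-identityʳ δ)))
      where open +-*-Solver
    decide : (∃ λ a → ∃ λ b → _ ≤ a × L x a × U x b × b ≤ a + η) →
             (∃ λ c → ∃ λ d → c₀ ≤ c × L y c × U y d × d ≤ c + η) →
             (∃ λ s → q < s × A s) ⊎ (∃ λ s → s < r × B s)
    decide (a , b , _ , La , Ub , b≤a+η) (c , d , c₀≤c , Lc , Ud , d≤c+η) = result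
      where
      open ≤-Reasoning
      c≤d = <⇒≤ (L<U y Lc Ud)
      0≤η : 0ℚ ≤ η
      0≤η = +-mono-≤ (<⇒≤ 0<ε) (<⇒≤ 0<ε)
      diag : ∀ e → ∣ e - e ∣ ≤ η
      diag e = subst (λ v → ∣ v ∣ ≤ η) (sym (+-inverseʳ e)) 0≤η
      d-c : ∣ d - c ∣ ≤ η
      d-c = begin
        ∣ d - c ∣   ≡⟨ 0≤p⇒∣p∣≡p (subst (_≤ d - c) (+-inverseʳ c) (+-monoˡ-≤ (- c) c≤d)) ⟩
        d - c       ≤⟨ +-monoˡ-≤ (- c) d≤c+η ⟩
        c + η - c   ≡⟨ solve 2 (λ c η → c :+ η :- c := η) refl c η ⟩
        η           ∎
        where open +-*-Solver
      c-d : ∣ c - d ∣ ≤ η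
      c-d = subst (_≤ η) (trans (sym (∣-p∣≡∣p∣ (d - c))) (cong ∣_∣ (solve 2 (λ c d → :- (d :- c) := c :- d) refl c d))) d-c
        where open +-*-Solver
      above : ∀ {e} → a < s * e → ∣ e - c ∣ ≤ η → ∣ e - d ∣ ≤ η → ∃ λ s → s < r × B s
      above {e} a<se e-c e-d = t , t<r , b , c , d , Ub , Lc , Ud , <-≤-trans 0<c₀ c₀≤c ,
        ≤-trans b≤se+η (gap s<t c₀≤c e-c ηM≡δ) , ≤-trans b≤se+η (gap s<t (≤-trans c₀≤c c≤d) e-d ηM≡δ)
        where
        b≤se+η : b ≤ s * e + η
        b≤se+η = ≤-trans b≤a+η (+-monoˡ-≤ η (<⇒≤ a<se))
      result : (∃ λ s → q < s × A s) ⊎ (∃ λ s → s < r × B s)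
      result with s * c ≤? a | s * d ≤? a
      ... | yes sc≤a | yes sd≤a = inj₁ (s , q<s , a , c , d , La , Lc , Ud , <-≤-trans 0<c₀ c₀≤c , sc≤a , sd≤a)
      ... | no sc≰a  | _        = inj₂ (above (≰⇒> sc≰a) (diag c) c-d)
      ... | yes _    | no sd≰a  = inj₂ (above (≰⇒> sd≰a) d-c (diag d))

_÷_⟨_⟩ : (x y : ℝ) → fromℕ 0 <ʳ y → ℝ
x ÷ y ⟨ 0<y ⟩ = cut A B A-inhabited B-inhabited A≤B loc
  where open Division x y 0<y

IsLowerSet : ∀ {d} → Pred (Vec ℕ d) 0ℓ → Set
IsLowerSet {d} S = ∀ {x x′} → S x → (∀ (i : Fin d) → Vec.lookup x′ i ℕ.≤ Vec.lookup x i) → S x′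

HasSize : ∀ {A : Set} → Pred A 0ℓ → ℕ → Set
HasSize S n = ∃ λ xs → Unique xs × length xs ≡ n × (∀ x → S x ⇔ x ∈ xs)

record LowerSet (d n : ℕ) : Set₁ where
  field
    points  : Pred (Vec ℕ d) 0ℓ
    isLower : IsLowerSet points
    size    : HasSize points n

open LowerSet

lowerSets : ℕ → ℕ → Setoid (lsuc 0ℓ) 0ℓ
lowerSets d n = record
  { Carrier       = LowerSet d n
  ; _≈_           = λ S T → points S ≐ points T
  ; isEquivalence = record { refl = ≐-refl ; sym = ≐-sym ; trans = ≐-trans }
  }

module _ {d : ℕ} where
  open import Data.List.Membership.DecPropositional (Vec.≡-dec {n = d} ℕ._≟_) public using (_∈?_)

elements : ∀ {d n} → LowerSet d n → List (Vec ℕ d)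
elements S = proj₁ (size S)

module _ {d n} (S : LowerSet d n) where
  points⇒elements : ∀ {x} → points S x → x ∈ elements S
  points⇒elements {x} = Equivalence.to (proj₂ (proj₂ (proj₂ (size S))) x)
  elements⇒points : ∀ {x} → x ∈ elements S → points S x
  elements⇒points {x} = Equivalence.from (proj₂ (proj₂ (proj₂ (size S))) x)

_≟ᴸ_ : ∀ {d n} (S T : LowerSet d n) → Dec (points S ≐ points T)
S ≟ᴸ T = map′
  (λ (S⊆T , T⊆S) → (λ x∈S → elements⇒points T (All.lookup S⊆T (points⇒elements S x∈S)))
                 , (λ x∈T → elements⇒points S (All.lookup T⊆S (points⇒elements T x∈T))))
  (λ (S⊆T , T⊆S) → All.tabulate (λ x∈S → points⇒elements T (S⊆T (elements⇒points S x∈S)))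
                 , All.tabulate (λ x∈T → points⇒elements S (T⊆S (elements⇒points T x∈T))))
  (All.all? (_∈? elements T) (elements S) ×-dec All.all? (_∈? elements S) (elements T))

lowerSets? : ℕ → ℕ → DecSetoid (lsuc 0ℓ) 0ℓ
lowerSets? d n = record
  { isDecEquivalence = record { isEquivalence = Setoid.isEquivalence (lowerSets d n) ; _≟_ = _≟ᴸ_ } }

-- A lower set with n points lies in {0,…,n-1}^d, so it is found among the
-- n-element lists over that box.
box : ∀ d → ℕ → List (Vec ℕ d)
box zero    n = [] ∷ []
box (suc d) n = cartesianProductWith _∷_ (upTo n) (box d n)

∈-box : ∀ {d n} (x : Vec ℕ d) → (∀ i → Vec.lookup x i ℕ.< n) → x ∈ box d n
∈-box []      _   = here refl
∈-box (a ∷ x) x<n = ∈-cartesianProductWith⁺ _∷_ (∈-upTo⁺ (x<n zero)) (∈-box x (λ i → x<n (suc i)))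

below : ∀ {d} → Vec ℕ d → List (Vec ℕ d)
below []      = [] ∷ []
below (a ∷ x) = cartesianProductWith _∷_ (upTo (suc a)) (below x)

∈-below⁺ : ∀ {d} (x y : Vec ℕ d) → (∀ i → Vec.lookup y i ℕ.≤ Vec.lookup x i) → y ∈ below x
∈-below⁺ []      []      _   = here refl
∈-below⁺ (a ∷ x) (b ∷ y) y≤x =
  ∈-cartesianProductWith⁺ _∷_ (∈-upTo⁺ (ℕ.s≤s (y≤x zero))) (∈-below⁺ x y (λ i → y≤x (suc i)))

∈-below⁻ : ∀ {d} (x y : Vec ℕ d) → y ∈ below x → ∀ i → Vec.lookup y i ℕ.≤ Vec.lookup x i
∈-below⁻ (a ∷ x) _ y∈ i with ∈-cartesianProductWith⁻ _∷_ (upTo (suc a)) (below x) y∈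
∈-below⁻ (a ∷ x) _ y∈ zero    | b , y , b∈ , _  , refl = ℕ.≤-pred (∈-upTo⁻ b∈)
∈-below⁻ (a ∷ x) _ y∈ (suc i) | b , y , _  , y∈′ , refl = ∈-below⁻ x y y∈′ i

lists : ∀ {A : Set} → List A → ℕ → List (List A)
lists xs zero    = [] ∷ []
lists xs (suc n) = cartesianProductWith _∷_ xs (lists xs n)

∈-lists : ∀ {A : Set} {xs : List A} {ys} → All (_∈ xs) ys → ys ∈ lists xs (length ys)
∈-lists []         = here refl
∈-lists (y∈ ∷ ys∈) = ∈-cartesianProductWith⁺ _∷_ y∈ (∈-lists ys∈)

IsCandidate : ∀ {d} → ℕ → List (Vec ℕ d) → Set
IsCandidate n xs = Unique xs × length xs ≡ n × All (λ x → All (_∈ xs) (below x)) xs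

isCandidate? : ∀ {d} n (xs : List (Vec ℕ d)) → Dec (IsCandidate n xs)
isCandidate? n xs = AllPairs.allPairs? (λ x y → ¬? (Vec.≡-dec ℕ._≟_ x y)) xs
  ×-dec (length xs ℕ.≟ n)
  ×-dec All.all? (λ x → All.all? (_∈? xs) (below x)) xs

fromCandidate : ∀ {d n} (xs : List (Vec ℕ d)) → IsCandidate n xs → LowerSet d n
fromCandidate xs (xs! , len , low) = record
  { points  = _∈ xs
  ; isLower = λ {x} {x′} x∈xs x′≤x → All.lookup (All.lookup low x∈xs) (∈-below⁺ x x′ x′≤x)
  ; size    = xs , xs! , len , λ x → mk⇔ (λ z → z) (λ z → z)
  }

elements-isCandidate : ∀ {d n} (S : LowerSet d n) → IsCandidate n (elements S)
elements-isCandidate S = let (xs , xs! , len , _) = size S in xs! , len ,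
  All.tabulate λ {x} x∈ → All.tabulate λ {y} y∈ →
    points⇒elements S (isLower S (elements⇒points S x∈) (∈-below⁻ x y y∈))

lookup-injective : ∀ {a r} {A : Set a} {R : Rel A r} → Symmetric R → ∀ {xs} → AllPairs (λ x y → ¬ R x y) xs →
                   ∀ {i j} → R (List.lookup xs i) (List.lookup xs j) → i ≡ j
lookup-injective sy (x∉ ∷ xs!) {zero}  {zero}  r = refl
lookup-injective sy (x∉ ∷ xs!) {zero}  {suc j} r = contradiction r (All.lookup x∉ (∈-lookup j))
lookup-injective sy (x∉ ∷ xs!) {suc i} {zero}  r = contradiction (sy r) (All.lookup x∉ (∈-lookup i))
lookup-injective sy (x∉ ∷ xs!) {suc i} {suc j} r = cong suc (lookup-injective sy xs! r)

unique-⊆⇒length-≤ : ∀ {A : Set} {xs ys : List A} → Unique xs → (∀ {x} → x ∈ xs → x ∈ ys) → length xs ℕ.≤ length ys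
unique-⊆⇒length-≤ {xs = xs} {ys} xs! xs⊆ys = Fin.injective⇒≤ {f = f} λ {i} {j} eq →
  lookup-injective sym xs! (trans (Any.lookup-index (mem i)) (trans (cong (List.lookup ys) eq) (sym (Any.lookup-index (mem j)))))
  where
  mem : ∀ i → List.lookup xs i ∈ ys
  mem i = xs⊆ys (∈-lookup i)
  f : Fin (length xs) → Fin (length ys)
  f i = Any.index (mem i)

coordinate<size : ∀ {d n} (S : LowerSet d n) {x} → points S x → ∀ i → Vec.lookup x i ℕ.< n
coordinate<size {d} {n} S {x} x∈S i = ≡.subst₂ ℕ._≤_
  (trans (length-map (x [ i ]≔_) (upTo (suc v))) (length-upTo (suc v)))
  (proj₁ (proj₂ (proj₂ (size S))))
  (unique-⊆⇒length-≤ (Unique.map⁺ injective (Unique.upTo⁺ (suc v))) ⊆elements)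
  where
  v = Vec.lookup x i
  injective : ∀ {a b} → x [ i ]≔ a ≡ x [ i ]≔ b → a ≡ b
  injective {a} {b} eq = trans (sym (Vec.lookup∘update i x a)) (trans (cong (λ y → Vec.lookup y i) eq) (Vec.lookup∘update i x b))
  ≤x : ∀ {a} → a ℕ.≤ v → ∀ j → Vec.lookup (x [ i ]≔ a) j ℕ.≤ Vec.lookup x j
  ≤x {a} a≤v j with j Fin.≟ i
  ... | yes refl = subst (ℕ._≤ v) (sym (Vec.lookup∘update i x a)) a≤v
  ... | no j≢i   = ℕ.≤-reflexive (Vec.lookup∘update′ j≢i x a)
  ⊆elements : ∀ {y} → y ∈ List.map (x [ i ]≔_) (upTo (suc v)) → y ∈ elements S
  ⊆elements y∈ with ∈-map⁻ (x [ i ]≔_) y∈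
  ... | a , a∈ , refl = points⇒elements S (isLower S x∈S (≤x (ℕ.≤-pred (∈-upTo⁻ a∈))))

fromList : ∀ {d n} → List (Vec ℕ d) → List (LowerSet d n)
fromList {n = n} xs with isCandidate? n xs
... | yes c = fromCandidate xs c ∷ []
... | no  _ = []

allLowerSets : ∀ d n → List (LowerSet d n)
allLowerSets d n = deduplicate _≟ᴸ_ (concatMap fromList (lists (box d n) n))

allLowerSets-enumerates : ∀ d n → IsEnumeration (lowerSets d n) (allLowerSets d n)
allLowerSets-enumerates d n = Enumerates.deduplicate⁺ (lowerSets? d n) λ S →
  Any.concatMap⁺ fromList (Any.map (λ { refl → found S }) (elements∈lists S))
  where
  elements∈lists : ∀ S → elements S ∈ lists (box d n) n
  elements∈lists S = subst (λ k → elements S ∈ lists (box d n) k) (proj₁ (proj₂ (proj₂ (size S))))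
    (∈-lists (All.tabulate λ {x} x∈ → ∈-box x (coordinate<size S (elements⇒points S x∈))))
  found : ∀ S → Any (λ T → points S ≐ points T) (fromList {n = n} (elements S))
  found S with isCandidate? n (elements S)
  ... | yes _ = here (points⇒elements S , elements⇒points S)
  ... | no ¬c = contradiction (elements-isCandidate S) ¬c

-- p d n is the number of lower sets in ℤ₊^d with exactly n points, as certified
-- by p-counts.
p : ℕ → ℕ → ℕ
p d n = length (allLowerSets d n)

p-counts : ∀ d n → Bijection (≡.setoid (Fin (p d n))) (lowerSets d n)
p-counts d n = record
  { to        = List.lookup (allLowerSets d n)
  ; cong      = λ { refl → ≐-refl }
  ; bijective = lookup-injective ≐-sym (UniqueDec.deduplicate-! (lowerSets? d n) (concatMap fromList (lists (box d n) n)))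
              , Enumerates.lookup-surjective (lowerSets d n) (allLowerSets-enumerates d n)
  }

{-# OPTIONS --safe #-}

-- Upper bound.  A lower set in dimension d + 1 is a decreasing chain A₁ ⊇ A₂ ⊇ … of lower sets in
-- dimension d.  Put Z_d(N) = ∑ 2^(-|A|/N), summed over the lower sets A of dimension d in a box; then
-- Z_d(N) ≤ 2^((C(N+G))^(d-1)) with an absolute constant C and G of order d² log n, and the claim
-- follows with N of order n^(1/d).  The induction on d compares Z_{d+1}(N) with Z_{d+1}(N(1-1/q)),
-- where q ≈ 4d.  The first J ≈ 2N layers are summed independently, at a cost of J log Z_d(N(1+1/q)).
-- Among the remaining layers those with index ≡ r mod q are deleted.  A deleted layer lies between
-- its neighbours A ⊇ C, so it costs |A| - |C| bits; for a suitable r these costs add up to at most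
-- 2|A_J|/q, which is paid for by the part of the weight held back on the first J layers.  The weight
-- of a deleted layer is distributed over the next q - 1 layers, which allows N to decrease.  Since q
-- is proportional to d, the factor (1+1/q)^d lost in each dimension is bounded.
--
-- Lower bound.  Over the simplex |y| ≤ m in dimension d - 1 the column heights 2(m - |y|) + c(y)
-- with arbitrary c(y) ∈ {0, 1, 2} are decreasing, which gives 3^(number of columns) lower sets.

module Submission where

open import Algebra.Bundles using (CommutativeMonoid; CommutativeRing; CommutativeSemiring)
import Algebra.Properties.CommutativeSemigroup as CommutativeSemigroup
open import Algebra.Structures using (IsCommutativeSemiring)
open import Data.Bool using (Bool; true; false; if_then_else_; _∧_)
open import Data.Bool.Properties using (T-≡)
open import Data.Fin as Fin using (Fin; toℕ; finToFun; funToFin; combine)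
import Data.Fin.Properties as Fin
open import Data.List as List using (List; []; _∷_; length; map; _++_; concatMap; filter; downFrom; upTo)
open import Data.List.Membership.Propositional using (_∈_; _∉_)
open import Data.List.Membership.Propositional.Properties using (∈-map⁺; ∈-map⁻; ∈-++⁺ˡ; ∈-++⁺ʳ; ∈-++⁻; ∈-concatMap⁺; ∈-filter⁺; ∈-lookup; ∈-downFrom⁺; ∈-downFrom⁻; ∈-upTo⁺; ∈-upTo⁻)
open import Data.List.Properties using (length-map; length-++; length-upTo; length-downFrom; map-∘; map-cong; map-cong-local; map-++)
open import Data.List.Relation.Unary.All as All using ([]; _∷_)
open import Data.List.Relation.Unary.AllPairs as AllPairs using ([]; _∷_)
import Data.List.Relation.Unary.AllPairs.Properties as AllPairs
open import Data.List.Relation.Unary.Any as Any using (here; there)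
import Data.List.Relation.Unary.Any.Properties as Any
import Data.List.Relation.Unary.Unique.DecSetoid.Properties as UniqueDec
open import Data.List.Relation.Unary.Unique.Propositional using (Unique)
import Data.List.Relation.Unary.Unique.Propositional.Properties as Unique
open import Data.Nat using (ℕ; zero; suc; pred; _+_; _*_; _∸_; _^_; _/_; _%_; _⊓_; _!; ⌊_/2⌋; ⌈_/2⌉; _≤_; _<_; _≥_; z≤n; s≤s; _≤ᵇ_; _<ᵇ_; _≟_; _≤?_; NonZero; >-nonZero)
open import Data.Nat.DivMod using (m≡m%n+[m/n]*n; m%n<n; m/n*n≤m; m<n⇒m/n≡0; m*n/n≡m; +-distrib-/-∣ˡ)
open import Data.Nat.Divisibility using (divides; ∣-trans; m∣m*n; n∣m*n; m≤n⇒m!∣n!)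
open import Data.Nat.ListAction using (sum)
open import Data.Nat.ListAction.Properties using (sum-++)
import Data.Nat.Properties as ℕ
open import Data.Nat.Properties using (≤-refl; ≤-trans; ≤-reflexive; +-mono-≤; +-monoˡ-≤; +-monoʳ-≤; *-mono-≤; *-monoˡ-≤; *-monoʳ-≤; m≤m+n; m≤n+m; ^-monoˡ-≤; ^-monoʳ-≤)
open import Data.Nat.Tactic.RingSolver using (solve-∀)
open import Data.Product using (∃; _×_; _,_; proj₁; proj₂)
open import Data.Rational as ℚ using (ℚ; 0ℚ; 1ℚ)
import Data.Rational.Properties as ℚ
open import Data.Sum using (inj₁; inj₂)
open import Data.Vec as Vec using (Vec; []; _∷_; replicate)
import Data.Vec.Properties as Vec
open import Function.Bundles using (mk⇔; Bijection; Equivalence)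
open import Relation.Binary.PropositionalEquality using (_≡_; _≢_; refl; sym; trans; cong; cong₂; subst; subst₂; isEquivalence; module ≡-Reasoning)
open import Relation.Nullary using (¬_; Dec; yes; no; does; contradiction)
open import Relation.Nullary.Decidable using (dec-true; recompute; toWitness)
open import Relation.Unary using (_≐_)
open import Relation.Unary.Properties using (≐-sym; ≐-trans)

open import Defs using (p; LowerSet; lowerSets?; allLowerSets; p-counts; fromList; lists; box; elements; points⇒elements; elements⇒points; coordinate<size; unique-⊆⇒length-≤; lookup-injective; _∈?_)

-- Elementary inequalities

-- A constant independent of d is possible although `C` is raised to the power d - 1: with N about
-- n^(1/d) / (2 C) the factor C^(d-1) is absorbed by N, while undoing the weight of a set with n
-- points costs about n / N bits, which is only linear in `C`. The obstacle is the number of layers,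
-- which can be as large as n. Summing all of them independently would pay log Z_d for each; the
-- deletions exploit that the chain decreases. A round keeps about the fraction 1 - 1/q of the
-- layers, so about q log n rounds are needed, and each has a fixed cost of order q (C (N +
-- G))^(d-1), even when N is too small to decrease any further. G is chosen so large that all these
-- fixed costs together are absorbed by one more factor N + G. The induction starts in dimension 2,
-- with partitions: in dimension 1, Z(N) is about N, too large for a bound 2^((C (N + G))^0). The
-- weights are rational. Powers of L / (L + 1) replace those of 2^(-1/N), and L is a factorial, so
-- that every N in question divides it.

^-distrib-* : ∀ a b n → (a * b) ^ n ≡ a ^ n * b ^ n
^-distrib-* a b zero    = refl
^-distrib-* a b (suc n) = trans (cong (a * b *_) (^-distrib-* a b n)) (ring a b (a ^ n) (b ^ n))
  where
  ring : ∀ a b x y → a * b * (x * y) ≡ a * x * (b * y)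
  ring = solve-∀

-- (1 - c/(x+c))ᵉ ≥ 1 - ce/(x+c), multiplied out.
bernoulli-upper : ∀ x c e → (x + c) ^ suc e ≤ x ^ e * (x + c) + c * e * (x + c) ^ e
bernoulli-upper x c zero    = ≤-reflexive (e x c)
  where
  e : ∀ x c → (x + c) * 1 ≡ 1 * (x + c) + c * 0 * 1
  e = solve-∀
bernoulli-upper x c (suc e) = begin
  a * a ^ suc e                                    ≤⟨ *-monoʳ-≤ a (bernoulli-upper x c e) ⟩
  a * (x ^ e * a + c * e * a ^ e)                  ≡⟨ ring₁ x c e (x ^ e) (a ^ e) ⟩
  x * x ^ e * a + (c * (x ^ e * a) + c * e * (a * a ^ e)) ≤⟨ +-monoʳ-≤ (x * x ^ e * a) (+-monoˡ-≤ _ (*-monoʳ-≤ c (*-monoˡ-≤ a (^-monoˡ-≤ e (m≤m+n x c))))) ⟩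
  x * x ^ e * a + (c * (a ^ e * a) + c * e * (a * a ^ e)) ≡⟨ ring₂ x c e (x ^ e) (a ^ e) ⟩
  x * x ^ e * a + c * suc e * (a * a ^ e) ∎
  where
  open ℕ.≤-Reasoning
  a = x + c
  ring₁ : ∀ x c e p r → (x + c) * (p * (x + c) + c * e * r) ≡ x * p * (x + c) + (c * (p * (x + c)) + c * e * ((x + c) * r))
  ring₁ = solve-∀
  ring₂ : ∀ x c e p r → x * p * (x + c) + (c * (r * (x + c)) + c * e * ((x + c) * r)) ≡ x * p * (x + c) + c * suc e * ((x + c) * r)
  ring₂ = solve-∀

-- By Bernoulli (x / (x + c))^e is at least 1 - ce/(x + c), and the hypothesis makes this at least
-- s/(s + 1). The instances are s = 1, a loss of a factor 2, and s = 99, a loss of 1%.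
bernoulli-ratio : ∀ s x c e → 0 < x + c → suc s * (c * e) ≤ x + c → s * (x + c) ^ e ≤ suc s * x ^ e
bernoulli-ratio s x c e 0<a h = ℕ.*-cancelʳ-≤ _ _ (x + c) {{>-nonZero 0<a}} (ℕ.+-cancelʳ-≤ (a * a ^ e) _ _ (begin
  s * a ^ e * a + a * a ^ e              ≡⟨ ring₁ s a (a ^ e) ⟩
  suc s * (a * a ^ e)                    ≤⟨ *-monoʳ-≤ (suc s) (bernoulli-upper x c e) ⟩
  suc s * (x ^ e * a + c * e * a ^ e)    ≡⟨ ring₂ s a (x ^ e) (c * e) (a ^ e) ⟩
  suc s * x ^ e * a + suc s * (c * e) * a ^ e ≤⟨ +-monoʳ-≤ _ (*-monoˡ-≤ (a ^ e) h) ⟩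
  suc s * x ^ e * a + a * a ^ e ∎))
  where
  open ℕ.≤-Reasoning
  a = x + c
  ring₁ : ∀ s a p → s * p * a + a * p ≡ suc s * (a * p)
  ring₁ = solve-∀
  ring₂ : ∀ s a p k r → suc s * (p * a + k * r) ≡ suc s * p * a + suc s * k * r
  ring₂ = solve-∀

bernoulli-2 : ∀ x c e → 0 < x + c → 2 * (c * e) ≤ x + c → (x + c) ^ e ≤ 2 * x ^ e
bernoulli-2 x c e 0<a h = ≤-trans (≤-reflexive (sym (ℕ.*-identityˡ _))) (bernoulli-ratio 1 x c e 0<a h)

bernoulli-lower : ∀ x t e → x ^ suc e + suc e * (t * x ^ e) ≤ (x + t) ^ suc e
bernoulli-lower x t zero    = ≤-reflexive (e x t)
  where
  e : ∀ x t → x * 1 + 1 * (t * 1) ≡ (x + t) * 1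
  e = solve-∀
bernoulli-lower x t (suc e) = begin
  x * (x * P) + suc (suc e) * (t * (x * P))  ≤⟨ m≤m+n _ _ ⟩
  x * (x * P) + suc (suc e) * (t * (x * P)) + t * (suc e * (t * P)) ≡⟨ ring x t e P ⟩
  (x + t) * (x * P + suc e * (t * P))        ≤⟨ *-monoʳ-≤ (x + t) (bernoulli-lower x t e) ⟩
  (x + t) * (x + t) ^ suc e ∎
  where
  open ℕ.≤-Reasoning
  P = x ^ e
  ring : ∀ x t e p → x * (x * p) + suc (suc e) * (t * (x * p)) + t * (suc e * (t * p)) ≡ (x + t) * (x * p + suc e * (t * p))
  ring = solve-∀

-- With Y = x + t, the difference Y^(e+1) - x^(e+1) is at least (e + 1) t x^e, and x^e is at least
-- half of Y^e. So costs proportional to t Y^e telescope when Y drops by t.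
power-gap : ∀ x t e → 0 < x + t → 2 * (t * e) ≤ x + t → suc e * (t * (x + t) ^ e) + 2 * x ^ suc e ≤ 2 * (x + t) ^ suc e
power-gap x t e 0<y h = begin
  suc e * (t * (x + t) ^ e) + 2 * x ^ suc e  ≤⟨ +-monoˡ-≤ _ (*-monoʳ-≤ (suc e) (*-monoʳ-≤ t (bernoulli-2 x t e 0<y h))) ⟩
  suc e * (t * (2 * x ^ e)) + 2 * x ^ suc e  ≡⟨ ring e t (x ^ e) (x ^ suc e) ⟩
  2 * (x ^ suc e + suc e * (t * x ^ e))      ≤⟨ *-monoʳ-≤ 2 (bernoulli-lower x t e) ⟩
  2 * (x + t) ^ suc e ∎
  where
  open ℕ.≤-Reasoning
  ring : ∀ e t p r → suc e * (t * (2 * p)) + 2 * r ≡ 2 * (r + suc e * (t * p))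
  ring = solve-∀

n≤2^n : ∀ n → n ≤ 2 ^ n
n≤2^n zero    = z≤n
n≤2^n (suc n) = ≤-trans (+-mono-≤ (ℕ.m^n>0 2 n) (n≤2^n n)) (≤-reflexive (cong (2 ^ n +_) (sym (ℕ.+-identityʳ (2 ^ n)))))

-- `bernoulli-2` controls (1 + 1/L)^e only for e up to about L/2, so the exponent is split into two
-- halves, each contributing a factor 2.
suc^≤4 : ∀ L → 1 ≤ L → suc L ^ L ≤ 4 * L ^ L
suc^≤4 L 1≤L = begin
  suc L ^ L                       ≡⟨ split (suc L) ⟩
  suc L ^ h * suc L ^ h′          ≡⟨ cong (λ x → x ^ h * x ^ h′) (sym (ℕ.+-comm L 1)) ⟩
  (L + 1) ^ h * (L + 1) ^ h′      ≤⟨ *-mono-≤ (bernoulli-2 L 1 h 0< (small h (≤-trans (ℕ.⌊n/2⌋-mono (ℕ.n≤1+n L)) ≤-refl))) (bernoulli-2 L 1 h′ 0< (small h′ ≤-refl)) ⟩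
  2 * L ^ h * (2 * L ^ h′)        ≡⟨ ring (L ^ h) (L ^ h′) ⟩
  4 * (L ^ h * L ^ h′)            ≡⟨ cong (4 *_) (sym (split L)) ⟩
  4 * L ^ L ∎
  where
  open ℕ.≤-Reasoning
  h = ⌊ L /2⌋
  h′ = ⌈ L /2⌉
  0< : 0 < L + 1
  0< = ≤-trans 1≤L (m≤m+n L 1)
  split : ∀ x → x ^ L ≡ x ^ h * x ^ h′
  split x = trans (cong (x ^_) (sym (ℕ.⌊n/2⌋+⌈n/2⌉≡n L))) (ℕ.^-distribˡ-+-* x h h′)
  small : ∀ k → k ≤ h′ → 2 * (1 * k) ≤ L + 1
  small k k≤ = ≤-trans (*-monoʳ-≤ 2 (≤-trans (≤-reflexive (ℕ.+-identityʳ k)) k≤))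
    (≤-trans (≤-reflexive (cong (h′ +_) (ℕ.+-identityʳ h′)))
    (≤-trans (+-monoʳ-≤ h′ (ℕ.⌊n/2⌋≤⌈n/2⌉ (suc L))) (≤-trans (≤-reflexive (ℕ.⌊n/2⌋+⌈n/2⌉≡n (suc L))) (≤-reflexive (ℕ.+-comm 1 L)))))
  ring : ∀ a b → 2 * a * (2 * b) ≡ 4 * (a * b)
  ring = solve-∀

2p^q≤q^q : ∀ p → 2 * p ^ suc p ≤ suc p ^ suc p
2p^q≤q^q p = begin
  2 * p ^ suc p                              ≡⟨ ring p (p ^ p) ⟩
  p ^ suc p + p * (1 * p ^ p)                ≤⟨ +-monoʳ-≤ (p ^ suc p) (m≤n+m _ _) ⟩
  p ^ suc p + suc p * (1 * p ^ p)            ≤⟨ bernoulli-lower p 1 p ⟩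
  (p + 1) ^ suc p                            ≡⟨ cong (_^ suc p) (ℕ.+-comm p 1) ⟩
  suc p ^ suc p ∎
  where
  open ℕ.≤-Reasoning
  ring : ∀ p x → 2 * (p * x) ≡ p * x + p * (1 * x)
  ring = solve-∀

-- A round keeps about the fraction p/q of the layers, q = p + 1. Since (q/p)^q ≥ 2, a number of q ℓ
-- rounds reduces 2^ℓ layers to at most q.
enough-fuel : ∀ p ℓ {M} → M ≤ 2 ^ ℓ → M * p ^ (suc p * ℓ) ≤ suc p ^ suc (suc p * ℓ)
enough-fuel p ℓ {M} M≤ = begin
  M * p ^ (q * ℓ)               ≤⟨ *-monoˡ-≤ _ M≤ ⟩
  2 ^ ℓ * p ^ (q * ℓ)           ≡⟨ cong (2 ^ ℓ *_) (sym (ℕ.^-*-assoc p q ℓ)) ⟩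
  2 ^ ℓ * (p ^ q) ^ ℓ           ≡⟨ sym (^-distrib-* 2 (p ^ q) ℓ) ⟩
  (2 * p ^ q) ^ ℓ               ≤⟨ ^-monoˡ-≤ ℓ (2p^q≤q^q p) ⟩
  (q ^ q) ^ ℓ                   ≡⟨ ℕ.^-*-assoc q q ℓ ⟩
  q ^ (q * ℓ)                   ≤⟨ m≤m+n _ _ ⟩
  q ^ suc (q * ℓ) ∎
  where
  open ℕ.≤-Reasoning
  q = suc p

-- Averaging, integer roots and logarithms

sumTo : ℕ → (ℕ → ℕ) → ℕ
sumTo zero    f = 0
sumTo (suc n) f = f 0 + sumTo n (λ i → f (suc i))

sumTo-last : ∀ n f → sumTo (suc n) f ≡ sumTo n f + f n
sumTo-last zero    f = ℕ.+-identityʳ (f 0)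
sumTo-last (suc n) f = trans (cong (f 0 +_) (sumTo-last n (λ i → f (suc i)))) (sym (ℕ.+-assoc (f 0) _ _))

sumTo-0 : ∀ n → sumTo n (λ _ → 0) ≡ 0
sumTo-0 zero    = refl
sumTo-0 (suc n) = sumTo-0 n

pigeonhole : ∀ n .{{_ : NonZero n}} f {s} → sumTo n f ≤ s → ∃ λ i → i < n × n * f i ≤ s
pigeonhole n f {s} h = go n f h′
  where
  h′ : n * sumTo n f ≤ n * s
  h′ = ℕ.*-monoʳ-≤ n h
  -- Invariant: the m remaining terms have average at most s/n. If the first exceeds s/n, the rest
  -- keep the invariant.
  go : ∀ m f → n * sumTo m f ≤ m * s → .{{NonZero m}} → ∃ λ i → i < m × n * f i ≤ s
  go (suc m) f b with n * f 0 ≤? s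
  ... | yes p = 0 , s≤s z≤n , p
  ... | no ¬p with m
  ...   | zero = contradiction (subst₂ _≤_ (cong (n *_) (ℕ.+-identityʳ (f 0))) (ℕ.+-identityʳ s) b) ¬p
  ...   | suc m′ = let (i , i<m , q) = go (suc m′) (λ i → f (suc i)) rest in suc i , s≤s i<m , q
    where
    rest : n * sumTo (suc m′) (λ i → f (suc i)) ≤ suc m′ * s
    rest = ℕ.+-cancelˡ-≤ s _ _ (ℕ.≤-trans (ℕ.+-monoˡ-≤ _ (ℕ.<⇒≤ (ℕ.≰⇒> ¬p)))
             (subst (_≤ s + suc m′ * s) (ℕ.*-distribˡ-+ n (f 0) _) b))

bracket : ∀ (f : ℕ → ℕ) {n} → f 0 ≤ n → ∀ b → n < f b → ∃ λ r → f r ≤ n × n < f (suc r)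
bracket f f0≤n zero    n<fb = contradiction f0≤n (ℕ.<⇒≱ n<fb)
bracket f {n} f0≤n (suc b) n<fb with f b ≤? n
... | yes fb≤n = b , fb≤n , n<fb
... | no  fb≰n = bracket f f0≤n b (ℕ.≰⇒> fb≰n)

^-cancelˡ-< : ∀ d {a b} → a ^ d < b ^ d → a < b
^-cancelˡ-< d {a} {b} h = ℕ.≰⇒> λ b≤a → ℕ.<⇒≱ h (^-monoˡ-≤ d b≤a)

floor-root : ∀ d n .{{_ : NonZero d}} → ∃ λ r → r ^ d ≤ n × n < suc r ^ d
floor-root (suc d) n = bracket (_^ suc d) z≤n (suc n) (ℕ.m≤m*n (suc n) (suc n ^ d) {{ℕ.m^n≢0 (suc n) d}})

root-large : ∀ {d n r} → (30 * d) ^ (2 * d ^ 2) ≤ n → n < suc r ^ d → (30 * d) ^ (2 * d) ≤ r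
root-large {d} {n} {r} h n< = ℕ.≤-pred (^-cancelˡ-< d (≤-trans (s≤s (≤-trans (≤-reflexive e) h)) n<))
  where
  e : ((30 * d) ^ (2 * d)) ^ d ≡ (30 * d) ^ (2 * d ^ 2)
  e = trans (ℕ.^-*-assoc (30 * d) (2 * d) d) (cong ((30 * d) ^_) (ring d))
    where
    ring : ∀ d → 2 * d * d ≡ 2 * (d * (d * 1))
    ring = solve-∀

fourth-power : ∀ {d r} → 2 ≤ d → (30 * d) ^ (2 * d) ≤ r → (30 * d) ^ 4 ≤ r
fourth-power {d} 2≤d h = ≤-trans (^-monoʳ-≤ (30 * d) {{>-nonZero (≤-trans (s≤s z≤n) (*-mono-≤ (s≤s (z≤n {29})) 2≤d))}} (*-monoʳ-≤ 2 2≤d)) h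

60⁴≤ : ∀ {d} → 2 ≤ d → 12960000 ≤ (30 * d) ^ 4
60⁴≤ {d} 2≤d = ^-monoˡ-≤ 4 (*-monoʳ-≤ 30 2≤d)

2[1+s]≤2^s : ∀ s → 3 ≤ s → 2 * suc s ≤ 2 ^ s
2[1+s]≤2^s (suc (suc (suc zero))) h = ≤-refl
2[1+s]≤2^s (suc s@(suc (suc (suc _)))) h = begin
  2 * suc (suc s)      ≤⟨ m≤m+n _ (2 * s) ⟩
  2 * suc (suc s) + 2 * s  ≡⟨ ring s ⟩
  2 * (2 * suc s)      ≤⟨ *-monoʳ-≤ 2 (2[1+s]≤2^s s (s≤s (s≤s (s≤s z≤n)))) ⟩
  2 ^ suc s ∎
  where
  open ℕ.≤-Reasoning
  ring : ∀ s → 2 * suc (suc s) + 2 * s ≡ 2 * (2 * suc s)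
  ring = solve-∀
2[1+s]≤2^s (suc zero) (s≤s ())
2[1+s]≤2^s (suc (suc zero)) (s≤s (s≤s ()))

-- `s` is the logarithm of r to base 16, rounded down, so that 2^s is at most the fourth root of r.
-- So is 30 d, whence (30 d)^3 2^s ≤ r. As 2^s ≥ 2 (s + 1), the constant is 54000 = 2 * 30^3.
log-bound : ∀ {d r} → 2 ≤ d → (30 * d) ^ (2 * d) ≤ r → ∃ λ s → suc r ≤ 2 ^ (4 * suc s) × 54000 * (d ^ 3 * suc s) ≤ r
log-bound {d} {r} 2≤d h = s , ≤-trans r<16^ (≤-reflexive (ℕ.^-*-assoc 2 4 (suc s))) , (begin
  54000 * (d ^ 3 * suc s)          ≡⟨ ring₁ 27000 (d ^ 3) (suc s) ⟩
  27000 * d ^ 3 * (2 * suc s)      ≤⟨ *-monoʳ-≤ (27000 * d ^ 3) (2[1+s]≤2^s s 3≤s) ⟩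
  27000 * d ^ 3 * 2 ^ s            ≡⟨ cong (_* 2 ^ s) (sym (^-distrib-* 30 d 3)) ⟩
  x ^ 3 * 2 ^ s                    ≤⟨ mixed ⟩
  r ∎)
  where
  open ℕ.≤-Reasoning
  x = 30 * d
  x⁴≤r : x ^ 4 ≤ r
  x⁴≤r = fourth-power {d} 2≤d h
  1≤r : 1 ≤ r
  1≤r = ≤-trans (s≤s z≤n) (≤-trans (60⁴≤ 2≤d) x⁴≤r)
  br = bracket (16 ^_) 1≤r r (≤-trans (s≤s (n≤2^n r)) (2^<16^ r 1≤r))
    where
    2^<16^ : ∀ r → 1 ≤ r → 2 ^ r < 16 ^ r
    2^<16^ (suc r) _ = ≤-trans (s≤s (*-monoʳ-≤ 2 (^-monoˡ-≤ r (s≤s (s≤s (z≤n {14})))))) (≤-trans (+-monoˡ-≤ _ (≤-trans (ℕ.m^n>0 16 r) (m≤m+n _ (13 * 16 ^ r)))) (≤-reflexive (ring (16 ^ r))))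
      where
      ring : ∀ y → y + 13 * y + 2 * y ≡ 16 * y
      ring = solve-∀
  s = proj₁ br
  r<16^ : r < 16 ^ suc s
  r<16^ = proj₂ (proj₂ br)
  3≤s : 3 ≤ s
  3≤s = ℕ.≮⇒≥ λ s<3 → ℕ.<⇒≱ r<16^ (≤-trans (^-monoʳ-≤ 16 s<3) (≤-trans (toWitness {a? = 4096 ≤? 12960000} _) (≤-trans (60⁴≤ 2≤d) x⁴≤r)))
  t⁴≤r : (2 ^ s) ^ 4 ≤ r
  t⁴≤r = ≤-trans (≤-reflexive (trans (ℕ.^-*-assoc 2 s 4) (trans (cong (2 ^_) (ℕ.*-comm s 4)) (sym (ℕ.^-*-assoc 2 4 s))))) (proj₁ (proj₂ br))
  mixed : x ^ 3 * 2 ^ s ≤ r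
  mixed with ℕ.≤-total (2 ^ s) x
  ... | inj₁ t≤x = ≤-trans (*-monoʳ-≤ (x ^ 3) t≤x) (≤-trans (≤-reflexive (ℕ.*-comm (x ^ 3) x)) x⁴≤r)
  ... | inj₂ x≤t = ≤-trans (*-monoˡ-≤ (2 ^ s) (^-monoˡ-≤ 3 x≤t)) (≤-trans (≤-reflexive (ℕ.*-comm ((2 ^ s) ^ 3) (2 ^ s))) t⁴≤r)
  ring₁ : ∀ c a b → c * 2 * (a * b) ≡ c * a * (2 * b)
  ring₁ = solve-∀

-- Binomial coefficients

-- pascal a b is the binomial coefficient (a + b choose b).
pascal : ℕ → ℕ → ℕ
pascal zero    b       = 1
pascal (suc a) zero    = 1
pascal (suc a) (suc b) = pascal a (suc b) + pascal (suc a) b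

pascal-0 : ∀ a → pascal a 0 ≡ 1
pascal-0 zero    = refl
pascal-0 (suc a) = refl

-- The two absorption identities need a common induction: after Pascal's rule, each rewrites a
-- summand by means of the other.
pascal-sucˡ : ∀ a b → suc a * pascal (suc a) b ≡ (suc a + b) * pascal a b
pascal-sucʳ : ∀ a b → suc b * pascal a (suc b) ≡ (suc a + b) * pascal a b

pascal-sucˡ a zero rewrite pascal-0 a = cong (_* 1) (sym (ℕ.+-identityʳ (suc a)))
pascal-sucˡ a (suc b) = begin
  suc a * (pascal a (suc b) + pascal (suc a) b)                ≡⟨ ℕ.*-distribˡ-+ (suc a) (pascal a (suc b)) (pascal (suc a) b) ⟩
  suc a * pascal a (suc b) + suc a * pascal (suc a) b          ≡⟨ cong (suc a * pascal a (suc b) +_) (trans (pascal-sucˡ a b) (sym (pascal-sucʳ a b))) ⟩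
  suc a * pascal a (suc b) + suc b * pascal a (suc b)          ≡⟨ sym (ℕ.*-distribʳ-+ (pascal a (suc b)) (suc a) (suc b)) ⟩
  (suc a + suc b) * pascal a (suc b) ∎
  where open ≡-Reasoning

pascal-sucʳ zero b = refl
pascal-sucʳ (suc a) b = begin
  suc b * (pascal a (suc b) + pascal (suc a) b)                ≡⟨ ℕ.*-distribˡ-+ (suc b) (pascal a (suc b)) (pascal (suc a) b) ⟩
  suc b * pascal a (suc b) + suc b * pascal (suc a) b          ≡⟨ cong (_+ suc b * pascal (suc a) b) (trans (pascal-sucʳ a b) (sym (pascal-sucˡ a b))) ⟩
  suc a * pascal (suc a) b + suc b * pascal (suc a) b          ≡⟨ ring (suc a) b (pascal (suc a) b) ⟩
  (suc (suc a) + b) * pascal (suc a) b ∎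
  where
  open ≡-Reasoning
  ring : ∀ a b x → a * x + suc b * x ≡ (suc a + b) * x
  ring = solve-∀

pascal≤2^ : ∀ a b → pascal a b ≤ 2 ^ (a + b)
pascal≤2^ zero    b       = ℕ.m^n>0 2 b
pascal≤2^ (suc a) zero    = ℕ.m^n>0 2 (suc a + 0)
pascal≤2^ (suc a) (suc b) = ℕ.≤-trans (ℕ.+-mono-≤ (pascal≤2^ a (suc b)) (pascal≤2^ (suc a) b))
  (ℕ.≤-reflexive (trans (cong (λ n → 2 ^ (a + suc b) + 2 ^ n) (sym (ℕ.+-suc a b))) (cong (2 ^ (a + suc b) +_) (sym (ℕ.+-identityʳ _)))))

pascal>0 : ∀ a b → 1 ≤ pascal a b
pascal>0 zero    b       = ≤-refl
pascal>0 (suc a) zero    = ≤-refl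
pascal>0 (suc a) (suc b) = ≤-trans (pascal>0 a (suc b)) (m≤m+n _ _)

suc≤pascal : ∀ a b → suc a ≤ pascal a (suc b)
suc≤pascal zero    b = ≤-refl
suc≤pascal (suc a) b = ≤-trans (≤-reflexive (ℕ.+-comm 1 (suc a))) (+-mono-≤ (suc≤pascal a b) (pascal>0 (suc a) b))

pascal-! : ∀ a b → suc b ! * pascal a (suc b) ≡ (suc a + b) * (b ! * pascal a b)
pascal-! a b = trans (ring₁ (suc b) (b !) (pascal a (suc b))) (trans (cong (b ! *_) (pascal-sucʳ a b)) (ring₂ (b !) (suc a + b) (pascal a b)))
  where
  ring₁ : ∀ s f x → s * f * x ≡ f * (s * x)
  ring₁ = solve-∀
  ring₂ : ∀ f s x → f * (s * x) ≡ s * (f * x)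
  ring₂ = solve-∀

pascal-≤ : ∀ a b → b ! * pascal a b ≤ (a + b) ^ b
pascal-≤ a zero    = ≤-reflexive (trans (ℕ.+-identityʳ _) (pascal-0 a))
pascal-≤ a (suc b) = begin
  suc b ! * pascal a (suc b)         ≡⟨ pascal-! a b ⟩
  (suc a + b) * (b ! * pascal a b)   ≤⟨ *-mono-≤ (≤-reflexive (sym (ℕ.+-suc a b))) (≤-trans (pascal-≤ a b) (^-monoˡ-≤ b (+-monoʳ-≤ a (ℕ.n≤1+n b)))) ⟩
  (a + suc b) ^ suc b ∎
  where open ℕ.≤-Reasoning

pascal-≥ : ∀ a b → suc a ^ b ≤ b ! * pascal a b
pascal-≥ a zero    = ≤-reflexive (sym (trans (ℕ.+-identityʳ _) (pascal-0 a)))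
pascal-≥ a (suc b) = ≤-trans (*-mono-≤ (m≤m+n (suc a) b) (pascal-≥ a b)) (≤-reflexive (sym (pascal-! a b)))

-- The budget of one coarsening step: N = tq + ρ, X = N - t + G.
module Budget (C e t ρ G : ℕ) (1≤C : 1 ≤ C) where
  open ℕ.≤-Reasoning

  q N X Y N′ J : ℕ
  q  = 4 + 4 * e
  N  = ρ + t * q
  X  = ρ + t * (3 + 4 * e) + G
  Y  = X + t
  -- The successor keeps N′ above N even if N < q and t = 0; otherwise the first layers could hold
  -- nothing back.
  N′ = N + suc t
  -- Together with N ≤ q (t + 1) this gives q J (t + 1) ≥ 2 N N′ + q N′, the amount that `reserve`
  -- asks for.
  J  = suc (2 * N′ + q)

  Y≡ : Y ≡ N + G
  Y≡ = ring ρ t e G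
    where
    ring : ∀ ρ t e G → ρ + t * (3 + 4 * e) + G + t ≡ ρ + t * ((4 + 4 * e)) + G
    ring = solve-∀

  module _ (ρ<q : ρ < q) (q≤G : q ≤ G) where
    private
      q≤Y : q ≤ Y
      q≤Y = ≤-trans q≤G (≤-trans (m≤n+m G _) (m≤m+n X t))
      0<Y : 0 < Y
      0<Y = ≤-trans (s≤s z≤n) q≤Y
      tq≤Y : t * q ≤ Y
      tq≤Y = ≤-trans (≤-trans (m≤n+m (t * q) ρ) (m≤m+n N G)) (≤-reflexive (sym Y≡))

      -- N′ + G exceeds Y by at most the fraction 2/q, and q ≥ 4 e keeps the e-th power of 1 + 2/q
      -- below 2. This is why q has to grow with the dimension.
      two : (C * (N′ + G)) ^ e ≤ 2 * (C ^ e * Y ^ e)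
      two = ≤-trans (≤-reflexive (^-distrib-* C (N′ + G) e)) (≤-trans (*-monoʳ-≤ (C ^ e) root) (≤-reflexive (swap (C ^ e) (Y ^ e))))
        where
        swap : ∀ a b → a * (2 * b) ≡ 2 * (a * b)
        swap = solve-∀
        base : q * (N′ + G) ≤ (q + 2) * Y
        base = begin
          q * (N + suc t + G)         ≡⟨ ring₁ q N t G ⟩
          q * (N + G) + t * q + q     ≡⟨ cong (λ y → q * y + t * q + q) (sym Y≡) ⟩
          q * Y + t * q + q           ≤⟨ +-mono-≤ (+-monoʳ-≤ (q * Y) tq≤Y) q≤Y ⟩
          q * Y + Y + Y               ≡⟨ ring₂ q Y ⟩
          (q + 2) * Y ∎
          where
          ring₁ : ∀ q N t G → q * (N + suc t + G) ≡ q * (N + G) + t * q + q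
          ring₁ = solve-∀
          ring₂ : ∀ q Y → q * Y + Y + Y ≡ (q + 2) * Y
          ring₂ = solve-∀
        root : (N′ + G) ^ e ≤ 2 * Y ^ e
        root = ℕ.*-cancelˡ-≤ (q ^ e) {{ℕ.m^n≢0 q e}} (begin
          q ^ e * (N′ + G) ^ e       ≡⟨ sym (^-distrib-* q (N′ + G) e) ⟩
          (q * (N′ + G)) ^ e         ≤⟨ ^-monoˡ-≤ e base ⟩
          ((q + 2) * Y) ^ e          ≡⟨ ^-distrib-* (q + 2) Y e ⟩
          (q + 2) ^ e * Y ^ e        ≤⟨ *-monoˡ-≤ (Y ^ e) (bernoulli-2 q 2 e (m≤m+n 1 _) (≤-trans (m≤m+n (2 * (2 * e)) 6) (≤-reflexive (ring e)))) ⟩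
          2 * q ^ e * Y ^ e          ≡⟨ ring₂ (q ^ e) (Y ^ e) ⟩
          q ^ e * (2 * Y ^ e) ∎)
          where
          ring : ∀ e → 2 * (2 * e) + 6 ≡ (4 + 4 * e) + 2
          ring = solve-∀
          ring₂ : ∀ a b → 2 * a * b ≡ a * (2 * b)
          ring₂ = solve-∀

      J≤ : J ≤ 2 * ((q + 1) * t) + (3 * q + 1)
      J≤ = begin
        suc (2 * (ρ + t * q + suc t) + q)    ≡⟨ ring₁ ρ t q ⟩
        2 * suc ρ + (2 * ((q + 1) * t) + suc q) ≤⟨ +-monoˡ-≤ _ (*-monoʳ-≤ 2 ρ<q) ⟩
        2 * q + (2 * ((q + 1) * t) + suc q) ≡⟨ ring₂ t q ⟩
        2 * ((q + 1) * t) + (3 * q + 1) ∎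
        where
        ring₁ : ∀ ρ t q → suc (2 * (ρ + t * q + suc t) + q) ≡ 2 * suc ρ + (2 * ((q + 1) * t) + suc q)
        ring₁ = solve-∀
        ring₂ : ∀ t q → 2 * q + (2 * ((q + 1) * t) + suc q) ≡ 2 * ((q + 1) * t) + (3 * q + 1)
        ring₂ = solve-∀

      gap : suc e * (t * Y ^ e) + 2 * X ^ suc e ≤ 2 * Y ^ suc e
      gap = power-gap X t e 0<Y (≤-trans (≤-trans (m≤m+n _ _) (≤-reflexive (ring t e))) tq≤Y)
        where
        ring : ∀ t e → 2 * (t * e) + t * (4 + 2 * e) ≡ t * ((4 + 4 * e))
        ring = solve-∀

      1≤Q : 1 ≤ C ^ e * Y ^ e
      1≤Q = *-mono-≤ (ℕ.m^n>0 C {{>-nonZero 1≤C}} e) (ℕ.m^n>0 Y {{>-nonZero 0<Y}} e)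

    -- The left side pays for J independent layers, for the choice of a residue (q bits) and for
    -- what follows the step. In units of C^e Y^e the first two cost at most 4 (q + 1) t + 2 (3 q +
    -- 1) + q. Since q = 4 (e + 1), the part with t is at most 20 (e + 1) t, which `gap` exchanges
    -- for 40 (Y^(e+1) - X^(e+1)); the rest is at most 8 q and is paid by lowering k.
    step-cost : ∀ k → J * (C * (N′ + G)) ^ e + (q + C ^ e * (40 * X ^ suc e + 8 * q * k * Y ^ e)) ≤ C ^ e * (40 * Y ^ suc e + 8 * q * suc k * Y ^ e)
    step-cost k = begin
      J * (C * (N′ + G)) ^ e + (q + C ^ e * (40 * X ^ suc e + 8 * q * k * P))
        ≤⟨ +-mono-≤ (*-mono-≤ J≤ two) (+-monoˡ-≤ _ (≤-trans (≤-reflexive (sym (ℕ.*-identityʳ q))) (*-monoʳ-≤ q 1≤Q))) ⟩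
      (2 * ((q + 1) * t) + (3 * q + 1)) * (2 * (c * P)) + (q * (c * P) + c * (40 * X ^ suc e + 8 * q * k * P))
        -- This slack turns the estimate into a polynomial identity: 20 (e + 1) - 4 (q + 1) = 4 e
        -- and 8 q - (7 q + 2) = 2 (2 e + 1).
        ≤⟨ m≤m+n _ (c * (4 * e * (t * P) + 2 * (2 * e + 1) * P)) ⟩
      (2 * ((q + 1) * t) + (3 * q + 1)) * (2 * (c * P)) + (q * (c * P) + c * (40 * X ^ suc e + 8 * q * k * P)) + c * (4 * e * (t * P) + 2 * (2 * e + 1) * P)
        ≡⟨ ring e t c P (X ^ suc e) k ⟩
      c * (20 * (suc e * (t * P) + 2 * X ^ suc e) + 8 * q * suc k * P)
        ≤⟨ *-monoʳ-≤ c (+-monoˡ-≤ _ (*-monoʳ-≤ 20 gap)) ⟩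
      c * (20 * (2 * Y ^ suc e) + 8 * q * suc k * P) ≡⟨ cong (λ z → c * (z + 8 * q * suc k * P)) (sym (ℕ.*-assoc 20 2 (Y ^ suc e))) ⟩
      c * (40 * Y ^ suc e + 8 * q * suc k * P) ∎
      where
      c = C ^ e
      P = Y ^ e
      ring : ∀ e t c P x k → (2 * (((4 + 4 * e) + 1) * t) + (3 * ((4 + 4 * e)) + 1)) * (2 * (c * P)) + (((4 + 4 * e)) * (c * P) + c * (40 * x + 8 * ((4 + 4 * e)) * k * P)) + c * (4 * e * (t * P) + 2 * (2 * e + 1) * P)
        ≡ c * (20 * (suc e * (t * P) + 2 * x) + 8 * ((4 + 4 * e)) * suc k * P)
      ring = solve-∀

-- Weighted sums over chains of states

multiple : ∀ {A : Set} → (A → A → A) → A → A → ℕ → A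
multiple _∙_ z x zero    = z
multiple _∙_ z x (suc n) = x ∙ multiple _∙_ z x n

-- These are the laws of the nonnegative rationals on which the counting rests. With an abstract
-- carrier the weights never unfold to fractions. `recip n` is 1/(n + 1), and `ι-cancel-⊑` leads
-- back from weights to cardinalities.
record Semifield⁺ : Set₁ where
  infixl 6 _⊕_
  infixl 7 _⊗_
  infix 4 _⊑_
  field
    Carrier : Set
    _⊕_ _⊗_ : Carrier → Carrier → Carrier
    𝟘 𝟙     : Carrier
    _⊑_     : Carrier → Carrier → Set
    isCommutativeSemiring : IsCommutativeSemiring _≡_ _⊕_ _⊗_ 𝟘 𝟙
    ⊑-refl  : ∀ {x} → x ⊑ x
    ⊑-trans : ∀ {x y z} → x ⊑ y → y ⊑ z → x ⊑ z
    𝟘⊑      : ∀ {x} → 𝟘 ⊑ x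
    ⊕-mono  : ∀ {x y u v} → x ⊑ y → u ⊑ v → x ⊕ u ⊑ y ⊕ v
    ⊗-mono  : ∀ {x y u v} → x ⊑ y → u ⊑ v → x ⊗ u ⊑ y ⊗ v
    recip   : ℕ → Carrier
    ι⊗recip : ∀ n → multiple _⊕_ 𝟘 𝟙 (suc n) ⊗ recip n ≡ 𝟙
    ι-cancel-⊑ : ∀ {m n} → multiple _⊕_ 𝟘 𝟙 m ⊑ multiple _⊕_ 𝟘 𝟙 n → m ≤ n

  ι : ℕ → Carrier
  ι = multiple _⊕_ 𝟘 𝟙

module WeightedCounting (K : Semifield⁺) where
  open Semifield⁺ K

  private
    R : CommutativeSemiring _ _
    R = record { isCommutativeSemiring = isCommutativeSemiring }

  open CommutativeSemiring R using (+-assoc; +-comm; +-identityˡ; +-identityʳ; *-assoc; *-comm; *-identityˡ; *-identityʳ; distribˡ; distribʳ; zeroˡ; zeroʳ)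
  module ⊕ = CommutativeSemigroup (CommutativeMonoid.commutativeSemigroup (CommutativeSemiring.+-commutativeMonoid R))
  module ⊗ = CommutativeSemigroup (CommutativeMonoid.commutativeSemigroup (CommutativeSemiring.*-commutativeMonoid R))

  ⊑-reflexive : ∀ {x y} → x ≡ y → x ⊑ y
  ⊑-reflexive refl = ⊑-refl

  module ⊑-Reasoning where
    infix  1 begin_
    infixr 2 _⊑⟨_⟩_ _≡⟨_⟩_
    infix  3 _∎
    begin_ : ∀ {x y} → x ⊑ y → x ⊑ y
    begin p = p
    _⊑⟨_⟩_ : ∀ x {y z} → x ⊑ y → y ⊑ z → x ⊑ z
    _ ⊑⟨ p ⟩ q = ⊑-trans p q
    _≡⟨_⟩_ : ∀ x {y z} → x ≡ y → y ⊑ z → x ⊑ z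
    _ ≡⟨ refl ⟩ q = q
    _∎ : ∀ x → x ⊑ x
    _ ∎ = ⊑-refl

  ⊕-monoˡ : ∀ {x y u} → x ⊑ y → x ⊕ u ⊑ y ⊕ u
  ⊕-monoˡ p = ⊕-mono p ⊑-refl
  ⊕-monoʳ : ∀ {x y u} → x ⊑ y → u ⊕ x ⊑ u ⊕ y
  ⊕-monoʳ p = ⊕-mono ⊑-refl p
  ⊗-monoˡ : ∀ {x y u} → x ⊑ y → x ⊗ u ⊑ y ⊗ u
  ⊗-monoˡ p = ⊗-mono p ⊑-refl
  ⊗-monoʳ : ∀ {x y u} → x ⊑ y → u ⊗ x ⊑ u ⊗ y
  ⊗-monoʳ p = ⊗-mono ⊑-refl p

  x⊑x⊕y : ∀ {x y} → x ⊑ x ⊕ y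
  x⊑x⊕y {x} {y} = ⊑-trans (⊑-reflexive (sym (+-identityʳ x))) (⊕-monoʳ 𝟘⊑)

  x⊑y⊕x : ∀ {x y} → x ⊑ y ⊕ x
  x⊑y⊕x {x} {y} = ⊑-trans x⊑x⊕y (⊑-reflexive (+-comm x y))

  x⊗y⊑y : ∀ {x y} → x ⊑ 𝟙 → x ⊗ y ⊑ y
  x⊗y⊑y {x} {y} p = ⊑-trans (⊗-monoˡ p) (⊑-reflexive (*-identityˡ y))

  ι-+ : ∀ m n → ι (m + n) ≡ ι m ⊕ ι n
  ι-+ zero    n = sym (+-identityˡ (ι n))
  ι-+ (suc m) n = trans (cong (𝟙 ⊕_) (ι-+ m n)) (sym (+-assoc 𝟙 (ι m) (ι n)))

  ι-* : ∀ m n → ι (m * n) ≡ ι m ⊗ ι n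
  ι-* zero    n = sym (zeroˡ (ι n))
  ι-* (suc m) n = trans (ι-+ n (m * n)) (trans (cong₂ _⊕_ (sym (*-identityˡ (ι n))) (ι-* m n)) (sym (distribʳ (ι n) 𝟙 (ι m))))

  ι-mono : ∀ {m n} → m ≤ n → ι m ⊑ ι n
  ι-mono z≤n     = 𝟘⊑
  ι-mono (s≤s p) = ⊕-monoʳ (ι-mono p)

  ι1≡𝟙 : ι 1 ≡ 𝟙
  ι1≡𝟙 = +-identityʳ 𝟙

  infixr 8 _↑_
  _↑_ : Carrier → ℕ → Carrier
  x ↑ zero  = 𝟙
  x ↑ suc n = x ⊗ x ↑ n

  ↑-+ : ∀ x m n → x ↑ (m + n) ≡ x ↑ m ⊗ x ↑ n
  ↑-+ x zero    n = sym (*-identityˡ (x ↑ n))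
  ↑-+ x (suc m) n = trans (cong (x ⊗_) (↑-+ x m n)) (sym (*-assoc x (x ↑ m) (x ↑ n)))

  ↑-mono : ∀ {x y} n → x ⊑ y → x ↑ n ⊑ y ↑ n
  ↑-mono zero    p = ⊑-refl
  ↑-mono (suc n) p = ⊗-mono p (↑-mono n p)

  𝟙↑ : ∀ n → 𝟙 ↑ n ≡ 𝟙
  𝟙↑ zero    = refl
  𝟙↑ (suc n) = trans (*-identityˡ (𝟙 ↑ n)) (𝟙↑ n)

  ↑-⊗ : ∀ x y n → (x ⊗ y) ↑ n ≡ x ↑ n ⊗ y ↑ n
  ↑-⊗ x y zero    = sym (*-identityˡ 𝟙)
  ↑-⊗ x y (suc n) = trans (cong (x ⊗ y ⊗_) (↑-⊗ x y n)) (⊗.interchange x y (x ↑ n) (y ↑ n))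

  ↑-* : ∀ x m n → x ↑ (m * n) ≡ (x ↑ n) ↑ m
  ↑-* x zero    n = refl
  ↑-* x (suc m) n = trans (↑-+ x n (m * n)) (cong (x ↑ n ⊗_) (↑-* x m n))

  ↑-⊑𝟙 : ∀ {x} n → x ⊑ 𝟙 → x ↑ n ⊑ 𝟙
  ↑-⊑𝟙 n p = ⊑-trans (↑-mono n p) (⊑-reflexive (𝟙↑ n))

  𝟙⊑↑ : ∀ {x} n → 𝟙 ⊑ x → 𝟙 ⊑ x ↑ n
  𝟙⊑↑ n p = ⊑-trans (⊑-reflexive (sym (𝟙↑ n))) (↑-mono n p)

  ↑-anti : ∀ {x m n} → x ⊑ 𝟙 → m ≤ n → x ↑ n ⊑ x ↑ m
  ↑-anti {n = n} p z≤n     = ↑-⊑𝟙 n p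
  ↑-anti         p (s≤s q) = ⊗-monoʳ (↑-anti p q)

  ↑-monoʳ : ∀ {x m n} → 𝟙 ⊑ x → m ≤ n → x ↑ m ⊑ x ↑ n
  ↑-monoʳ {n = n} p z≤n     = 𝟙⊑↑ n p
  ↑-monoʳ         p (s≤s q) = ⊗-monoʳ (↑-monoʳ p q)

  ι-^ : ∀ m n → ι (m ^ n) ≡ ι m ↑ n
  ι-^ m zero    = ι1≡𝟙
  ι-^ m (suc n) = trans (ι-* m (m ^ n)) (cong (ι m ⊗_) (ι-^ m n))

  𝟚 ½ : Carrier
  𝟚 = ι 2
  ½ = recip 1

  𝟚⊗½ : 𝟚 ⊗ ½ ≡ 𝟙
  𝟚⊗½ = ι⊗recip 1

  𝟚⊗ : ∀ x → 𝟚 ⊗ x ≡ x ⊕ x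
  𝟚⊗ x = trans (distribʳ x 𝟙 (ι 1)) (cong₂ _⊕_ (*-identityˡ x) (trans (cong (_⊗ x) ι1≡𝟙) (*-identityˡ x)))

  𝟙⊑𝟚 : 𝟙 ⊑ 𝟚
  𝟙⊑𝟚 = ⊑-trans (⊑-reflexive (sym ι1≡𝟙)) (ι-mono {1} {2} (s≤s z≤n))

  ½⊑𝟙 : ½ ⊑ 𝟙
  ½⊑𝟙 = ⊑-trans (⊑-reflexive (sym (*-identityˡ ½))) (⊑-trans (⊗-monoˡ 𝟙⊑𝟚) (⊑-reflexive 𝟚⊗½))

  ½↑⊗𝟚↑ : ∀ n → ½ ↑ n ⊗ 𝟚 ↑ n ≡ 𝟙
  ½↑⊗𝟚↑ n = trans (sym (↑-⊗ ½ 𝟚 n)) (trans (cong (_↑ n) (trans (*-comm ½ 𝟚) 𝟚⊗½)) (𝟙↑ n))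

  ⊗-cancelˡ : ∀ {x y c c′} → c′ ⊗ c ≡ 𝟙 → c ⊗ x ⊑ c ⊗ y → x ⊑ y
  ⊗-cancelˡ {x} {y} {c} {c′} inv p = begin
    x             ≡⟨ e x ⟩
    c′ ⊗ (c ⊗ x)  ⊑⟨ ⊗-monoʳ p ⟩
    c′ ⊗ (c ⊗ y)  ≡⟨ sym (e y) ⟩
    y             ∎
    where
    open ⊑-Reasoning
    e : ∀ z → z ≡ c′ ⊗ (c ⊗ z)
    e z = trans (sym (*-identityˡ z)) (trans (cong (_⊗ z) (sym inv)) (*-assoc c′ c z))

  ∑ : ∀ {A : Set} → List A → (A → Carrier) → Carrier
  ∑ []       f = 𝟘
  ∑ (x ∷ xs) f = f x ⊕ ∑ xs f

  ∑-mono-∈ : ∀ {A : Set} (xs : List A) {f g} → (∀ {x} → x ∈ xs → f x ⊑ g x) → ∑ xs f ⊑ ∑ xs g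
  ∑-mono-∈ []       p = ⊑-refl
  ∑-mono-∈ (x ∷ xs) p = ⊕-mono (p (here refl)) (∑-mono-∈ xs λ x∈ → p (there x∈))

  ∑-mono : ∀ {A : Set} (xs : List A) {f g} → (∀ x → f x ⊑ g x) → ∑ xs f ⊑ ∑ xs g
  ∑-mono xs p = ∑-mono-∈ xs λ {x} _ → p x

  ∑-cong : ∀ {A : Set} (xs : List A) {f g} → (∀ x → f x ≡ g x) → ∑ xs f ≡ ∑ xs g
  ∑-cong []       p = refl
  ∑-cong (x ∷ xs) p = cong₂ _⊕_ (p x) (∑-cong xs p)

  ∑-𝟘 : ∀ {A : Set} (xs : List A) → ∑ xs (λ _ → 𝟘) ≡ 𝟘
  ∑-𝟘 []       = refl
  ∑-𝟘 (x ∷ xs) = trans (+-identityˡ _) (∑-𝟘 xs)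

  ∑-⊕ : ∀ {A : Set} (xs : List A) f g → ∑ xs (λ x → f x ⊕ g x) ≡ ∑ xs f ⊕ ∑ xs g
  ∑-⊕ []       f g = sym (+-identityˡ 𝟘)
  ∑-⊕ (x ∷ xs) f g = trans (cong (f x ⊕ g x ⊕_) (∑-⊕ xs f g)) (⊕.interchange (f x) (g x) (∑ xs f) (∑ xs g))

  ∑-⊗ : ∀ {A : Set} (xs : List A) c f → c ⊗ ∑ xs f ≡ ∑ xs (λ x → c ⊗ f x)
  ∑-⊗ []       c f = zeroʳ c
  ∑-⊗ (x ∷ xs) c f = trans (distribˡ c (f x) (∑ xs f)) (cong (c ⊗ f x ⊕_) (∑-⊗ xs c f))

  ∑-swap : ∀ {A B : Set} (xs : List A) (ys : List B) (f : A → B → Carrier) → ∑ xs (λ x → ∑ ys (f x)) ≡ ∑ ys (λ y → ∑ xs (λ x → f x y))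
  ∑-swap []       ys f = sym (∑-𝟘 ys)
  ∑-swap (x ∷ xs) ys f = trans (cong (∑ ys (f x) ⊕_) (∑-swap xs ys f)) (sym (∑-⊕ ys (f x) (λ y → ∑ xs (λ x → f x y))))

  ∑-++ : ∀ {A : Set} (xs ys : List A) f → ∑ (xs ++ ys) f ≡ ∑ xs f ⊕ ∑ ys f
  ∑-++ []       ys f = sym (+-identityˡ _)
  ∑-++ (x ∷ xs) ys f = trans (cong (f x ⊕_) (∑-++ xs ys f)) (sym (+-assoc _ _ _))

  ∑-map : ∀ {A B : Set} (h : A → B) (xs : List A) f → ∑ (map h xs) f ≡ ∑ xs (λ x → f (h x))
  ∑-map h []       f = refl
  ∑-map h (x ∷ xs) f = cong (f (h x) ⊕_) (∑-map h xs f)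

  ∑-concatMap : ∀ {A B : Set} (h : A → List B) (xs : List A) f → ∑ (concatMap h xs) f ≡ ∑ xs (λ x → ∑ (h x) f)
  ∑-concatMap h []       f = refl
  ∑-concatMap h (x ∷ xs) f = trans (∑-++ (h x) (concatMap h xs) f) (cong (∑ (h x) f ⊕_) (∑-concatMap h xs f))

  ∑-∈ : ∀ {A : Set} {xs : List A} {x} f → x ∈ xs → f x ⊑ ∑ xs f
  ∑-∈ f (here refl) = x⊑x⊕y
  ∑-∈ f (there x∈)  = ⊑-trans (∑-∈ f x∈) x⊑y⊕x

  ∑-const : ∀ {A : Set} (xs : List A) c → ∑ xs (λ _ → c) ≡ ι (length xs) ⊗ c
  ∑-const []       c = sym (zeroˡ c)
  ∑-const (x ∷ xs) c = trans (cong₂ _⊕_ (sym (*-identityˡ c)) (∑-const xs c)) (sym (distribʳ c 𝟙 (ι (length xs))))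

  when : Bool → Carrier → Carrier
  when b x = if b then x else 𝟘

  when-mono : ∀ b {x y} → (b ≡ true → x ⊑ y) → when b x ⊑ when b y
  when-mono true  p = p refl
  when-mono false p = ⊑-refl

  when-⊑ : ∀ b {x} → when b x ⊑ x
  when-⊑ true  = ⊑-refl
  when-⊑ false = 𝟘⊑

  when-⊗ : ∀ b c x → c ⊗ when b x ≡ when b (c ⊗ x)
  when-⊗ true  c x = refl
  when-⊗ false c x = zeroʳ c

  when-∑ : ∀ {A : Set} b (xs : List A) f → when b (∑ xs f) ≡ ∑ xs (λ x → when b (f x))
  when-∑ true  xs f = refl
  when-∑ false xs f = sym (∑-𝟘 xs)

  -- Stands for the lower sets of one dimension inside a box. The essential field is `interval`: a
  -- state between a and b can be named with size b - size a bits. For sets this holds because an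
  -- intermediate set is given by a subset of the difference.
  record Level : Set₁ where
    infix 4 _≼_
    field
      State    : Set
      states   : List State
      _≼_      : State → State → Bool
      size     : State → ℕ
      ≼-trans  : ∀ {a b c} → (a ≼ b) ≡ true → (b ≼ c) ≡ true → (a ≼ c) ≡ true
      size-mono : ∀ {a b} → (a ≼ b) ≡ true → size a ≤ size b
      ⊥        : State
      ⊥∈states : ⊥ ∈ states
      ⊥≼       : ∀ a → (⊥ ≼ a) ≡ true
      size-⊥   : size ⊥ ≡ 0
      interval : ∀ {a b} → (a ≼ b) ≡ true →
                 ∑ states (λ y → when (a ≼ y) (when (y ≼ b) 𝟙)) ⊑ 𝟚 ↑ (size b ∸ size a)

  ∧-true : ∀ {a b} → a ∧ b ≡ true → a ≡ true × b ≡ true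
  ∧-true {true} {true} _ = refl , refl

  module Chains (Λ : Level) where
    open Level Λ public
    open ⊑-Reasoning

    data Chain : State → ∀ {m} → Vec State m → Set where
      []  : ∀ {a} → Chain a []
      _∷_ : ∀ {a b m} {v : Vec State m} → (b ≼ a) ≡ true → Chain b v → Chain a (b ∷ v)

    chains : ∀ m → State → List (Vec State m)
    chains zero    a = [] ∷ []
    chains (suc m) a = concatMap (λ b → map (b ∷_) (if b ≼ a then chains m b else [])) states

    -- A `Level` has a least state but no greatest one below which all chains could start. These
    -- unrestricted chains are the states of the next dimension.
    chains⁺ : ∀ m → List (Vec State m)
    chains⁺ zero    = [] ∷ []
    chains⁺ (suc m) = concatMap (λ b → map (b ∷_) (chains m b)) states

    ∑-if : ∀ {A : Set} b (xs : List A) f → ∑ (if b then xs else []) f ≡ when b (∑ xs f)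
    ∑-if true  xs f = refl
    ∑-if false xs f = refl

    ∑-chains : ∀ m a f → ∑ (chains (suc m) a) f ≡ ∑ states (λ b → when (b ≼ a) (∑ (chains m b) (λ v → f (b ∷ v))))
    ∑-chains m a f = trans (∑-concatMap _ states f) (∑-cong states λ b →
      trans (∑-map (b ∷_) (if b ≼ a then chains m b else []) f) (∑-if (b ≼ a) (chains m b) _))

    ∑-chains⁺ : ∀ m f → ∑ (chains⁺ (suc m)) f ≡ ∑ states (λ b → ∑ (chains m b) (λ v → f (b ∷ v)))
    ∑-chains⁺ m f = trans (∑-concatMap _ states f) (∑-cong states λ b → ∑-map (b ∷_) (chains m b) f)

    ∑-chains-mono : ∀ m a {f g} → (∀ {v} → Chain a v → f v ⊑ g v) → ∑ (chains m a) f ⊑ ∑ (chains m a) g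
    ∑-chains-mono zero    a p = ⊕-monoˡ (p [])
    ∑-chains-mono (suc m) a {f} {g} p = begin
      ∑ (chains (suc m) a) f   ≡⟨ ∑-chains m a f ⟩
      ∑ states (λ b → when (b ≼ a) (∑ (chains m b) (λ v → f (b ∷ v))))
        ⊑⟨ ∑-mono states (λ b → when-mono (b ≼ a) λ b≼a → ∑-chains-mono m b λ c → p (b≼a ∷ c)) ⟩
      ∑ states (λ b → when (b ≼ a) (∑ (chains m b) (λ v → g (b ∷ v)))) ≡⟨ sym (∑-chains m a g) ⟩
      ∑ (chains (suc m) a) g ∎

    sizes : ∀ {m} → Vec State m → ℕ
    sizes []      = 0
    sizes (b ∷ v) = size b + sizes v

    _≼ᵛ_ : ∀ {m} → Vec State m → Vec State m → Bool
    []      ≼ᵛ []      = true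
    (a ∷ v) ≼ᵛ (b ∷ w) = (a ≼ b) ∧ (v ≼ᵛ w)

    ≼ᵛ-trans : ∀ {m} {u v w : Vec State m} → (u ≼ᵛ v) ≡ true → (v ≼ᵛ w) ≡ true → (u ≼ᵛ w) ≡ true
    ≼ᵛ-trans {u = []} {[]} {[]} p q = refl
    ≼ᵛ-trans {u = a ∷ u} {b ∷ v} {c ∷ w} p q
      rewrite ≼-trans (proj₁ (∧-true {a ≼ b} p)) (proj₁ (∧-true {b ≼ c} q)) =
      ≼ᵛ-trans {u = u} {v} {w} (proj₂ (∧-true {a ≼ b} p)) (proj₂ (∧-true {b ≼ c} q))

    sizes-mono : ∀ {m} {v w : Vec State m} → (v ≼ᵛ w) ≡ true → sizes v ≤ sizes w
    sizes-mono {v = []}    {[]}    p = z≤n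
    sizes-mono {v = a ∷ v} {b ∷ w} p =
      ℕ.+-mono-≤ (size-mono (proj₁ (∧-true {a ≼ b} p))) (sizes-mono {v = v} {w} (proj₂ (∧-true {a ≼ b} p)))

    ⊥∈chains : ∀ m a → replicate m ⊥ ∈ chains m a
    ⊥∈chains⁺ : ∀ m → replicate m ⊥ ∈ chains⁺ m

    private
      ∈-concatMap : ∀ {A B : Set} {f : A → List B} {xs x y} → x ∈ xs → y ∈ f x → y ∈ concatMap f xs
      ∈-concatMap {f = f} x∈ y∈ = ∈-concatMap⁺ f (Any.map (λ { refl → y∈ }) x∈)

    ∈-chains : ∀ {m a b} {v : Vec State m} → b ∈ states → (b ≼ a) ≡ true → v ∈ chains m b → (b ∷ v) ∈ chains (suc m) a
    ∈-chains {m} {a} {b} {v} b∈ b≼a v∈ = ∈-concatMap b∈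
      (∈-map⁺ (b ∷_) (subst (λ t → v ∈ (if t then chains m b else [])) (sym b≼a) v∈))

    ∈-chains⁺ : ∀ {m b} {v : Vec State m} → b ∈ states → v ∈ chains m b → (b ∷ v) ∈ chains⁺ (suc m)
    ∈-chains⁺ {b = b} b∈ v∈ = ∈-concatMap b∈ (∈-map⁺ (b ∷_) v∈)

    ⊥∈chains zero    a = here refl
    ⊥∈chains (suc m) a = ∈-chains ⊥∈states (⊥≼ a) (⊥∈chains m ⊥)

    ⊥∈chains⁺ zero    = here refl
    ⊥∈chains⁺ (suc m) = ∈-chains⁺ ⊥∈states (⊥∈chains m ⊥)

    private
      +∸+ : ∀ {a b c d} → a ≤ b → c ≤ d → (b + d) ∸ (a + c) ≡ (b ∸ a) + (d ∸ c)
      +∸+ {a} {b} {c} {d} a≤b c≤d = trans (cong (_∸ (a + c)) e) (ℕ.m+n∸m≡n (a + c) _)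
        where
        e : b + d ≡ (a + c) + ((b ∸ a) + (d ∸ c))
        e = trans (cong₂ _+_ (sym (ℕ.m+[n∸m]≡n a≤b)) (sym (ℕ.m+[n∸m]≡n c≤d)))
                  (ring a (b ∸ a) c (d ∸ c))
          where
          ring : ∀ a x c y → (a + x) + (c + y) ≡ (a + c) + (x + y)
          ring = solve-∀

    -- For intervals the chain condition only removes terms.
    intervalᵛ : ∀ {m} a {v w : Vec State m} → (v ≼ᵛ w) ≡ true →
                ∑ (chains m a) (λ y → when (v ≼ᵛ y) (when (y ≼ᵛ w) 𝟙)) ⊑ 𝟚 ↑ (sizes w ∸ sizes v)
    interval-step : ∀ {m} {b c} {v w : Vec State m} → (b ≼ c) ≡ true → (v ≼ᵛ w) ≡ true →
                ∑ states (λ x → ∑ (chains m x) (λ y → when ((b ≼ x) ∧ (v ≼ᵛ y)) (when ((x ≼ c) ∧ (y ≼ᵛ w)) 𝟙)))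
                  ⊑ 𝟚 ↑ ((size c + sizes w) ∸ (size b + sizes v))

    interval-step {m} {b} {c} {v} {w} b≼c v≼w = begin
      ∑ states (λ x → ∑ (chains m x) (λ y → when ((b ≼ x) ∧ (v ≼ᵛ y)) (when ((x ≼ c) ∧ (y ≼ᵛ w)) 𝟙)))
        ⊑⟨ ∑-mono states (λ x → inner x (b ≼ x) (x ≼ c)) ⟩
      ∑ states (λ x → 𝟚 ↑ (sizes w ∸ sizes v) ⊗ when (b ≼ x) (when (x ≼ c) 𝟙))
        ≡⟨ sym (∑-⊗ states _ _) ⟩
      𝟚 ↑ (sizes w ∸ sizes v) ⊗ ∑ states (λ x → when (b ≼ x) (when (x ≼ c) 𝟙))
        ⊑⟨ ⊗-monoʳ (interval b≼c) ⟩
      𝟚 ↑ (sizes w ∸ sizes v) ⊗ 𝟚 ↑ (size c ∸ size b)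
        ≡⟨ trans (*-comm _ _) (sym (↑-+ 𝟚 (size c ∸ size b) (sizes w ∸ sizes v))) ⟩
      𝟚 ↑ ((size c ∸ size b) + (sizes w ∸ sizes v))
        ≡⟨ cong (𝟚 ↑_) (sym (+∸+ (size-mono b≼c) (sizes-mono {v = v} {w} v≼w))) ⟩
      𝟚 ↑ ((size c + sizes w) ∸ (size b + sizes v)) ∎
      where
      inner : ∀ x t₁ t₂ → ∑ (chains m x) (λ y → when (t₁ ∧ (v ≼ᵛ y)) (when (t₂ ∧ (y ≼ᵛ w)) 𝟙))
                        ⊑ 𝟚 ↑ (sizes w ∸ sizes v) ⊗ when t₁ (when t₂ 𝟙)
      inner x true true = ⊑-trans (intervalᵛ x {v} {w} v≼w) (⊑-reflexive (sym (*-identityʳ _)))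
      inner x false t₂  = ⊑-trans (⊑-reflexive (∑-𝟘 (chains m x))) 𝟘⊑
      inner x true false = ⊑-trans (∑-mono (chains m x) (λ y → when-⊑𝟘 (v ≼ᵛ y)))
                             (⊑-trans (⊑-reflexive (∑-𝟘 (chains m x))) 𝟘⊑)
        where
        when-⊑𝟘 : ∀ t → when t 𝟘 ⊑ 𝟘
        when-⊑𝟘 true  = ⊑-refl
        when-⊑𝟘 false = ⊑-refl

    intervalᵛ {zero}  a {[]} {[]} p = ⊑-reflexive (+-identityʳ 𝟙)
    intervalᵛ {suc m} a {b ∷ v} {c ∷ w} p =
      ⊑-trans (⊑-reflexive (∑-chains m a _)) (⊑-trans (∑-mono states (λ x → when-⊑ (x ≼ a)))
        (interval-step {v = v} {w} (proj₁ (∧-true {b ≼ c} p)) (proj₂ (∧-true {b ≼ c} p))))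

    intervalᵛ⁺ : ∀ {m} {v w : Vec State m} → (v ≼ᵛ w) ≡ true →
                 ∑ (chains⁺ m) (λ y → when (v ≼ᵛ y) (when (y ≼ᵛ w) 𝟙)) ⊑ 𝟚 ↑ (sizes w ∸ sizes v)
    intervalᵛ⁺ {zero}  {[]} {[]} p = ⊑-reflexive (+-identityʳ 𝟙)
    intervalᵛ⁺ {suc m} {b ∷ v} {c ∷ w} p =
      ⊑-trans (⊑-reflexive (∑-chains⁺ m _)) (interval-step {v = v} {w} (proj₁ (∧-true {b ≼ c} p)) (proj₂ (∧-true {b ≼ c} p)))

    ⊥≼ᵛ : ∀ {m} (v : Vec State m) → (replicate m ⊥ ≼ᵛ v) ≡ true
    ⊥≼ᵛ []      = refl
    ⊥≼ᵛ (a ∷ v) rewrite ⊥≼ a = ⊥≼ᵛ v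

    sizes-⊥ : ∀ m → sizes (replicate m ⊥) ≡ 0
    sizes-⊥ zero    = refl
    sizes-⊥ (suc m) = cong₂ _+_ size-⊥ (sizes-⊥ m)

    level⁺ : ℕ → Level
    level⁺ m = record
      { State     = Vec State m
      ; states    = chains⁺ m
      ; _≼_       = _≼ᵛ_
      ; size      = sizes
      ; ≼-trans   = λ {u} {v} {w} → ≼ᵛ-trans {u = u} {v} {w}
      ; size-mono = λ {v} {w} → sizes-mono {v = v} {w}
      ; ⊥         = replicate m ⊥
      ; ⊥∈states  = ⊥∈chains⁺ m
      ; ⊥≼        = ⊥≼ᵛ
      ; size-⊥    = sizes-⊥ m
      ; interval  = λ {v} {w} → intervalᵛ⁺ {v = v} {w}
      }

  -- A state with k points gets weight w (u * k); for N * u = L this is about 2^(-k/N).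
  record Weight : Set where
    field
      w   : ℕ → Carrier
      L   : ℕ
      w-0 : w 0 ≡ 𝟙
      w-+ : ∀ i j → w (i + j) ≡ w i ⊗ w j
      w-anti : ∀ {i j} → i ≤ j → w j ⊑ w i
      w-L : ∀ k → w (L * k) ⊑ ½ ↑ k

    w⊑𝟙 : ∀ k → w k ⊑ 𝟙
    w⊑𝟙 k = ⊑-trans (w-anti z≤n) (⊑-reflexive w-0)

  -- Deleting layers from a chain

  module Drop (Λ : Level) (W : Weight) where
    open Chains Λ
    open Weight W
    open ⊑-Reasoning

    -- Partition functions: `F` for m layers below a given state, `F⁺` for m unrestricted layers,
    -- `Z` for a single layer. `F⁺` is therefore the `Z` of the next dimension.
    F : ℕ → ∀ m → State → Carrier
    F u m a = ∑ (chains m a) (λ v → w (u * sizes v))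

    F⁺ : ℕ → ℕ → Carrier
    F⁺ u m = ∑ (chains⁺ m) (λ v → w (u * sizes v))

    Z : ℕ → Carrier
    Z u = ∑ states (λ b → w (u * size b))

    private
      w-∷ : ∀ u b {m} (v : Vec State m) → w (u * sizes (b ∷ v)) ≡ w (u * size b) ⊗ w (u * sizes v)
      w-∷ u b v = trans (cong w (ℕ.*-distribˡ-+ u (size b) (sizes v))) (w-+ (u * size b) (u * sizes v))

    F-zero : ∀ u a → F u 0 a ≡ 𝟙
    F-zero u a = trans (+-identityʳ _) (trans (cong w (ℕ.*-zeroʳ u)) w-0)

    F-suc : ∀ u m a → F u (suc m) a ≡ ∑ states (λ b → when (b ≼ a) (w (u * size b) ⊗ F u m b))
    F-suc u m a = trans (∑-chains m a _) (∑-cong states λ b → cong (when (b ≼ a))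
      (trans (∑-cong (chains m b) (λ v → w-∷ u b v)) (sym (∑-⊗ (chains m b) _ _))))

    F⁺-suc : ∀ u m → F⁺ u (suc m) ≡ ∑ states (λ b → w (u * size b) ⊗ F u m b)
    F⁺-suc u m = trans (∑-chains⁺ m _) (∑-cong states λ b →
      trans (∑-cong (chains m b) (λ v → w-∷ u b v)) (sym (∑-⊗ (chains m b) _ _)))

    F⊑F⁺ : ∀ u m a → F u m a ⊑ F⁺ u m
    F⊑F⁺ u zero    a = ⊑-refl
    F⊑F⁺ u (suc m) a = begin
      F u (suc m) a ≡⟨ F-suc u m a ⟩
      ∑ states (λ b → when (b ≼ a) (w (u * size b) ⊗ F u m b)) ⊑⟨ ∑-mono states (λ b → when-⊑ (b ≼ a)) ⟩
      ∑ states (λ b → w (u * size b) ⊗ F u m b) ≡⟨ sym (F⁺-suc u m) ⟩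
      F⁺ u (suc m) ∎

    𝟙⊑F : ∀ u m a → 𝟙 ⊑ F u m a
    𝟙⊑F u m a = begin
      𝟙                                ≡⟨ sym w-0 ⟩
      w 0                              ≡⟨ cong w (sym (trans (cong (u *_) (sizes-⊥ m)) (ℕ.*-zeroʳ u))) ⟩
      w (u * sizes (replicate m ⊥))    ⊑⟨ ∑-∈ (λ v → w (u * sizes v)) (⊥∈chains m a) ⟩
      F u m a ∎

    module _ (q′ : ℕ) where
      private
        q = suc (suc q′)

      -- The number of bits needed to recover a chain below a from what remains after
      -- deleting the entries with indices r, r + q, r + 2q, …
      loss : ℕ → State → ∀ {m} → Vec State m → ℕ
      loss r       a []          = 0
      loss (suc r) a (b ∷ v)     = loss r b v
      -- A deleted last entry has no lower neighbour; the empty state takes its place.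
      loss zero    a (y ∷ [])    = size a
      -- The entry c survives, and so do `q′` = q - 2 further ones before the next deletion.
      loss zero    a (y ∷ c ∷ v) = (size a ∸ size c) + loss q′ c v

      private
        -- Each entry is deleted for exactly one r and then costs the difference of its two
        -- neighbours. Summed over r, these differences telescope along two interleaved
        -- subsequences, and only the two leading sizes remain.
        sum-loss : ∀ {a b m} {v : Vec State m} → Chain a (b ∷ v) → sumTo q (λ r → loss r a (b ∷ v)) ≤ size a + size b
        sum-loss {a} {b} (_ ∷ []) = subst (_≤ size a + size b) (sym (trans (cong (size a +_) (sumTo-0 (suc q′))) (ℕ.+-identityʳ (size a)))) (ℕ.m≤m+n (size a) (size b))
        sum-loss {a} {b} {v = c ∷ v} (b≼a ∷ c≼b ∷ ch) = begin′
          where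
          rest = sumTo (suc q′) (λ r → loss r b (c ∷ v))
          split : (size a ∸ size c) + loss q′ c v + rest ≡ (size a ∸ size c) + sumTo q (λ r → loss r b (c ∷ v))
          split = trans (ℕ.+-assoc (size a ∸ size c) _ _) (cong ((size a ∸ size c) +_)
                    (trans (ℕ.+-comm (loss q′ c v) rest) (sym (sumTo-last (suc q′) (λ r → loss r b (c ∷ v))))))
          begin′ : (size a ∸ size c) + loss q′ c v + rest ≤ size a + size b
          begin′ = ℕ.≤-trans (ℕ.≤-reflexive split)
            (ℕ.≤-trans (ℕ.+-monoʳ-≤ (size a ∸ size c) (sum-loss (c≼b ∷ ch)))
            (ℕ.≤-reflexive (trans (cong ((size a ∸ size c) +_) (ℕ.+-comm (size b) (size c)))
              (trans (sym (ℕ.+-assoc (size a ∸ size c) (size c) (size b)))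
                (cong (_+ size b) (ℕ.m∸n+n≡m (size-mono (≼-trans c≼b b≼a))))))))

      loss-pigeonhole : ∀ {a m} {v : Vec State m} → Chain a v → ∃ λ r → r < q × q * loss r a v ≤ 2 * size a
      loss-pigeonhole {a} []  = 0 , s≤s z≤n , subst (_≤ 2 * size a) (sym (ℕ.*-zeroʳ q)) z≤n
      loss-pigeonhole {a} {v = b ∷ v} ch@(b≼a ∷ _) = pigeonhole q (λ r → loss r a (b ∷ v))
        (ℕ.≤-trans (sum-loss ch) (ℕ.≤-trans (ℕ.+-monoʳ-≤ (size a) (size-mono b≼a))
          (ℕ.≤-reflexive (cong (size a +_) (sym (ℕ.+-identityʳ (size a)))))))

      D : ℕ → ℕ → ∀ m → State → Carrier
      D u r m a = ∑ (chains m a) (λ v → ½ ↑ loss r a v ⊗ w (u * sizes v))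

      private
        D-zero : ∀ u r a → D u r 0 a ≡ 𝟙
        D-zero u r a = trans (+-identityʳ _) (trans (*-identityˡ _) (trans (cong w (ℕ.*-zeroʳ u)) w-0))

        D-suc : ∀ u r m a → D u (suc r) (suc m) a ≡ ∑ states (λ b → when (b ≼ a) (w (u * size b) ⊗ D u r m b))
        D-suc u r m a = trans (∑-chains m a _) (∑-cong states λ b → cong (when (b ≼ a))
          (trans (∑-cong (chains m b) (λ v → trans (cong (½ ↑ loss r b v ⊗_) (w-∷ u b v)) (⊗.x∙yz≈y∙xz _ _ _)))
                 (sym (∑-⊗ (chains m b) _ _))))

        D-one : ∀ u a → D u 0 1 a ≡ ∑ states (λ y → when (y ≼ a) (½ ↑ size a ⊗ w (u * size y)))
        D-one u a = trans (∑-chains 0 a _) (∑-cong states λ b → cong (when (b ≼ a))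
          (trans (+-identityʳ _) (cong (λ s → ½ ↑ size a ⊗ w (u * s)) (ℕ.+-identityʳ (size b)))))

        D-drop : ∀ u m a → D u 0 (2 + m) a ≡
          ∑ states (λ y → ∑ states (λ c → when (y ≼ a) (when (c ≼ y)
            (w (u * size y) ⊗ (½ ↑ (size a ∸ size c) ⊗ (w (u * size c) ⊗ D u q′ m c))))))
        D-drop u m a = trans (∑-chains (suc m) a _) (∑-cong states λ y →
          trans (cong (when (y ≼ a)) (trans (∑-chains m y _) (∑-cong states λ c → cong (when (c ≼ y)) (eq y c))))
                (when-∑ (y ≼ a) states _))
          where
          eq : ∀ y c → ∑ (chains m c) (λ v → ½ ↑ ((size a ∸ size c) + loss q′ c v) ⊗ w (u * (size y + (size c + sizes v))))
                     ≡ w (u * size y) ⊗ (½ ↑ (size a ∸ size c) ⊗ (w (u * size c) ⊗ D u q′ m c))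
          eq y c = trans (∑-cong (chains m c) term) (trans (sym (∑-⊗ (chains m c) (w (u * size y)) _))
            (cong (w (u * size y) ⊗_) (trans (sym (∑-⊗ (chains m c) (½ ↑ (size a ∸ size c)) _))
            (cong (½ ↑ (size a ∸ size c) ⊗_) (sym (∑-⊗ (chains m c) (w (u * size c)) _))))))
            where
            term : ∀ v → ½ ↑ ((size a ∸ size c) + loss q′ c v) ⊗ w (u * (size y + (size c + sizes v)))
                   ≡ w (u * size y) ⊗ (½ ↑ (size a ∸ size c) ⊗ (w (u * size c) ⊗ (½ ↑ loss q′ c v ⊗ w (u * sizes v))))
            term v = trans (cong₂ _⊗_ (↑-+ ½ (size a ∸ size c) _) (trans (w-∷ u y (c ∷ v)) (cong (w (u * size y) ⊗_) (w-∷ u c v))))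
              (shuffle _ _ _ _ _)
              where
              shuffle : ∀ h l y c v → (h ⊗ l) ⊗ (y ⊗ (c ⊗ v)) ≡ y ⊗ (h ⊗ (c ⊗ (l ⊗ v)))
              shuffle h l y c v = trans (⊗.x∙yz≈y∙xz (h ⊗ l) y (c ⊗ v)) (cong (y ⊗_)
                (trans (*-assoc h l (c ⊗ v)) (cong (h ⊗_) (⊗.x∙yz≈y∙xz l c v))))

      -- After a deletion the deleted entry, being at least as large as the q - 1 entries that
      -- follow, lends each of them δ units of weight per point; r δ is what is still on loan
      -- r entries before the next deletion.
      module _ {u δ : ℕ} (δ-small : suc q′ * δ ≤ u) where

        -- The first hypothesis says that at most k entries survive, in a form where both sides drop
        -- by q with every survivor, also across a deletion. If fewer survive, the missing layers
        -- are harmless because `F` is at least 1.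
        D⊑F : ∀ r m k a → m * suc q′ + r ≤ q * k → r ≤ suc q′ →
              w (r * δ * size a) ⊗ D u r m a ⊑ F (u + δ) k a
        D⊑F r zero k a h r≤ = begin
          w (r * δ * size a) ⊗ D u r 0 a  ⊑⟨ x⊗y⊑y (w⊑𝟙 _) ⟩
          D u r 0 a                       ≡⟨ D-zero u r a ⟩
          𝟙                               ⊑⟨ 𝟙⊑F (u + δ) k a ⟩
          F (u + δ) k a ∎
        D⊑F (suc r) (suc m) zero a h r≤ = contradiction (subst (suc m * suc q′ + suc r ≤_) (ℕ.*-zeroʳ q) h) λ ()
        D⊑F (suc r) (suc m) (suc k) a h r≤ = begin
          w (suc r * δ * size a) ⊗ D u (suc r) (suc m) a
            ≡⟨ trans (cong (w (suc r * δ * size a) ⊗_) (D-suc u r m a)) (trans (∑-⊗ states _ _) (∑-cong states λ b → when-⊗ (b ≼ a) _ _)) ⟩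
          ∑ states (λ b → when (b ≼ a) (w (suc r * δ * size a) ⊗ (w (u * size b) ⊗ D u r m b)))
            ⊑⟨ ∑-mono states (λ b → when-mono (b ≼ a) (term b)) ⟩
          ∑ states (λ b → when (b ≼ a) (w ((u + δ) * size b) ⊗ F (u + δ) k b)) ≡⟨ sym (F-suc (u + δ) k a) ⟩
          F (u + δ) (suc k) a ∎
          where
          h′ : m * suc q′ + r ≤ q * k
          h′ = ℕ.+-cancelˡ-≤ q _ _ (subst₂ _≤_ (ring m q′ r) (ℕ.*-suc q k) h)
            where
            ring : ∀ m q′ r → suc m * suc q′ + suc r ≡ suc (suc q′) + (m * suc q′ + r)
            ring = solve-∀
          term : ∀ b → (b ≼ a) ≡ true → w (suc r * δ * size a) ⊗ (w (u * size b) ⊗ D u r m b) ⊑ w ((u + δ) * size b) ⊗ F (u + δ) k b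
          term b b≼a = begin
            w (suc r * δ * size a) ⊗ (w (u * size b) ⊗ D u r m b)
              ⊑⟨ ⊗-monoˡ (w-anti (ℕ.*-monoʳ-≤ (suc r * δ) (size-mono b≼a))) ⟩
            w (suc r * δ * size b) ⊗ (w (u * size b) ⊗ D u r m b) ≡⟨ sym (*-assoc _ _ _) ⟩
            w (suc r * δ * size b) ⊗ w (u * size b) ⊗ D u r m b
              ≡⟨ cong (_⊗ D u r m b) (trans (sym (w-+ (suc r * δ * size b) (u * size b))) (trans (cong w (ring u δ r (size b))) (w-+ ((u + δ) * size b) (r * δ * size b)))) ⟩
            w ((u + δ) * size b) ⊗ w (r * δ * size b) ⊗ D u r m b ≡⟨ *-assoc _ _ _ ⟩
            w ((u + δ) * size b) ⊗ (w (r * δ * size b) ⊗ D u r m b)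
              ⊑⟨ ⊗-monoʳ (D⊑F r m k b h′ (ℕ.≤-trans (ℕ.n≤1+n r) r≤)) ⟩
            w ((u + δ) * size b) ⊗ F (u + δ) k b ∎
            where
            ring : ∀ u δ r s → suc r * δ * s + u * s ≡ (u + δ) * s + r * δ * s
            ring = solve-∀
        D⊑F zero (suc zero) k a h r≤ = begin
          w 0 ⊗ D u 0 1 a   ⊑⟨ x⊗y⊑y (w⊑𝟙 0) ⟩
          D u 0 1 a         ≡⟨ D-one u a ⟩
          ∑ states (λ y → when (y ≼ a) (½ ↑ size a ⊗ w (u * size y))) ⊑⟨ ∑-mono states term ⟩
          ∑ states (λ y → ½ ↑ size a ⊗ when (⊥ ≼ y) (when (y ≼ a) 𝟙)) ≡⟨ sym (∑-⊗ states _ _) ⟩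
          ½ ↑ size a ⊗ ∑ states (λ y → when (⊥ ≼ y) (when (y ≼ a) 𝟙)) ⊑⟨ ⊗-monoʳ (interval (⊥≼ a)) ⟩
          ½ ↑ size a ⊗ 𝟚 ↑ (size a ∸ size ⊥) ≡⟨ cong (λ s → ½ ↑ size a ⊗ 𝟚 ↑ (size a ∸ s)) size-⊥ ⟩
          ½ ↑ size a ⊗ 𝟚 ↑ size a ≡⟨ ½↑⊗𝟚↑ (size a) ⟩
          𝟙                 ⊑⟨ 𝟙⊑F (u + δ) k a ⟩
          F (u + δ) k a ∎
          where
          term : ∀ y → when (y ≼ a) (½ ↑ size a ⊗ w (u * size y)) ⊑ ½ ↑ size a ⊗ when (⊥ ≼ y) (when (y ≼ a) 𝟙)
          term y rewrite ⊥≼ y = ⊑-trans (when-mono (y ≼ a) λ _ → ⊗-monoʳ (w⊑𝟙 _)) (⊑-reflexive (sym (when-⊗ (y ≼ a) _ 𝟙)))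
        D⊑F zero (suc (suc m)) zero a h r≤ = contradiction (subst (suc (suc m) * suc q′ + 0 ≤_) (ℕ.*-zeroʳ q) h) λ ()
        D⊑F zero (suc (suc m)) (suc k) a h r≤ = begin
          w 0 ⊗ D u 0 (2 + m) a   ⊑⟨ x⊗y⊑y (w⊑𝟙 0) ⟩
          -- Once the survivor c is fixed, the deleted y ranges over the states between c and a, and
          -- their number cancels the factor ½ ↑ (size a ∸ size c).
          D u 0 (2 + m) a         ≡⟨ trans (D-drop u m a) (∑-swap states states _) ⟩
          ∑ states (λ c → ∑ states (λ y → when (y ≼ a) (when (c ≼ y)
            (w (u * size y) ⊗ (½ ↑ (size a ∸ size c) ⊗ (w (u * size c) ⊗ D u q′ m c))))))
            ⊑⟨ ∑-mono states term ⟩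
          ∑ states (λ c → when (c ≼ a) (w ((u + δ) * size c) ⊗ F (u + δ) k c)) ≡⟨ sym (F-suc (u + δ) k a) ⟩
          F (u + δ) (suc k) a ∎
          where
          h′ : m * suc q′ + q′ ≤ q * k
          h′ = ℕ.+-cancelˡ-≤ q _ _ (subst₂ _≤_ (ring m q′) (ℕ.*-suc q k) h)
            where
            ring : ∀ m q′ → suc (suc m) * suc q′ + 0 ≡ suc (suc q′) + (m * suc q′ + q′)
            ring = solve-∀

          bound : ∀ c → w (u * size c) ⊗ (w (u * size c) ⊗ D u q′ m c) ⊑ w ((u + δ) * size c) ⊗ F (u + δ) k c
          bound c = begin
            w (u * size c) ⊗ (w (u * size c) ⊗ D u q′ m c)
              -- One of the two factors for c comes from the deleted entry. It becomes δ for c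
              -- itself and a loan of `q′` δ for the entries after c.
              ⊑⟨ ⊗-monoˡ (w-anti (ℕ.*-monoˡ-≤ (size c) δ-small)) ⟩
            w (suc q′ * δ * size c) ⊗ (w (u * size c) ⊗ D u q′ m c) ≡⟨ sym (*-assoc _ _ _) ⟩
            w (suc q′ * δ * size c) ⊗ w (u * size c) ⊗ D u q′ m c
              ≡⟨ cong (_⊗ D u q′ m c) (trans (sym (w-+ (suc q′ * δ * size c) (u * size c))) (trans (cong w (ring u δ q′ (size c))) (w-+ ((u + δ) * size c) (q′ * δ * size c)))) ⟩
            w ((u + δ) * size c) ⊗ w (q′ * δ * size c) ⊗ D u q′ m c ≡⟨ *-assoc _ _ _ ⟩
            w ((u + δ) * size c) ⊗ (w (q′ * δ * size c) ⊗ D u q′ m c)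
              ⊑⟨ ⊗-monoʳ (D⊑F q′ m k c h′ (ℕ.n≤1+n q′)) ⟩
            w ((u + δ) * size c) ⊗ F (u + δ) k c ∎
            where
            ring : ∀ u δ r s → suc r * δ * s + u * s ≡ (u + δ) * s + r * δ * s
            ring = solve-∀

          Y : State → Carrier
          Y c = w ((u + δ) * size c) ⊗ F (u + δ) k c

          term : ∀ c → ∑ states (λ y → when (y ≼ a) (when (c ≼ y)
                   (w (u * size y) ⊗ (½ ↑ (size a ∸ size c) ⊗ (w (u * size c) ⊗ D u q′ m c)))))
                 ⊑ when (c ≼ a) (Y c)
          term c with c ≼ a in c≼a
          ... | false = ⊑-reflexive (trans (∑-cong states λ y → none y (y ≼ a) (c ≼ y) refl refl) (∑-𝟘 states))
            where
            none : ∀ y s t {x} → (y ≼ a) ≡ s → (c ≼ y) ≡ t → when s (when t x) ≡ 𝟘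
            none y false t     p r = refl
            none y true  false p r = refl
            none y true  true  p r = contradiction (trans (sym c≼a) (≼-trans r p)) λ ()
          ... | true = begin
            ∑ states (λ y → when (y ≼ a) (when (c ≼ y)
               (w (u * size y) ⊗ (½ ↑ (size a ∸ size c) ⊗ (w (u * size c) ⊗ D u q′ m c)))))
              ⊑⟨ ∑-mono states (λ y → one y (y ≼ a) (c ≼ y) refl) ⟩
            ∑ states (λ y → (½ ↑ (size a ∸ size c) ⊗ Y c) ⊗ when (c ≼ y) (when (y ≼ a) 𝟙)) ≡⟨ sym (∑-⊗ states _ _) ⟩
            (½ ↑ (size a ∸ size c) ⊗ Y c) ⊗ ∑ states (λ y → when (c ≼ y) (when (y ≼ a) 𝟙)) ⊑⟨ ⊗-monoʳ (interval c≼a) ⟩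
            (½ ↑ (size a ∸ size c) ⊗ Y c) ⊗ 𝟚 ↑ (size a ∸ size c) ≡⟨ ⊗.xy∙z≈xz∙y _ _ _ ⟩
            (½ ↑ (size a ∸ size c) ⊗ 𝟚 ↑ (size a ∸ size c)) ⊗ Y c ≡⟨ trans (cong (_⊗ Y c) (½↑⊗𝟚↑ (size a ∸ size c))) (*-identityˡ _) ⟩
            Y c ∎
            where
            one : ∀ y s t → (c ≼ y) ≡ t → when s (when t (w (u * size y) ⊗ (½ ↑ (size a ∸ size c) ⊗ (w (u * size c) ⊗ D u q′ m c))))
                  ⊑ (½ ↑ (size a ∸ size c) ⊗ Y c) ⊗ when t (when s 𝟙)
            one y false t     p = 𝟘⊑
            one y true  false p = 𝟘⊑
            one y true  true  p = begin
              w (u * size y) ⊗ (½ ↑ (size a ∸ size c) ⊗ (w (u * size c) ⊗ D u q′ m c))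
                ⊑⟨ ⊗-monoˡ (w-anti (ℕ.*-monoʳ-≤ u (size-mono p))) ⟩
              w (u * size c) ⊗ (½ ↑ (size a ∸ size c) ⊗ (w (u * size c) ⊗ D u q′ m c)) ≡⟨ ⊗.x∙yz≈y∙xz _ _ _ ⟩
              ½ ↑ (size a ∸ size c) ⊗ (w (u * size c) ⊗ (w (u * size c) ⊗ D u q′ m c)) ⊑⟨ ⊗-monoʳ (bound c) ⟩
              ½ ↑ (size a ∸ size c) ⊗ Y c ≡⟨ sym (*-identityʳ _) ⟩
              ½ ↑ (size a ∸ size c) ⊗ Y c ⊗ 𝟙 ∎

        -- The residue r found by averaging depends on the chain, hence the sum over all q residues
        -- and the factor `ι q`. The reserve of g per point of a covers the loss, 2/q bits per point
        -- at L units each, and the initial loan r δ ≤ u.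
        coarsen : ∀ {g} m k a → suc m * suc q′ ≤ q * k → 2 * L + q * u ≤ q * g →
                  w (g * size a) ⊗ F u m a ⊑ ι q ⊗ F⁺ (u + δ) k
        coarsen {g} m k a h g-large = begin
          w (g * size a) ⊗ F u m a ≡⟨ ∑-⊗ (chains m a) _ _ ⟩
          ∑ (chains m a) (λ v → w (g * size a) ⊗ w (u * sizes v)) ⊑⟨ ∑-chains-mono m a pointwise ⟩
          ∑ (chains m a) (λ v → ∑ (downFrom q) (λ r → w (r * δ * size a) ⊗ (½ ↑ loss r a v ⊗ w (u * sizes v))))
            ≡⟨ ∑-swap (chains m a) (downFrom q) _ ⟩
          ∑ (downFrom q) (λ r → ∑ (chains m a) (λ v → w (r * δ * size a) ⊗ (½ ↑ loss r a v ⊗ w (u * sizes v))))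
            ≡⟨ ∑-cong (downFrom q) (λ r → sym (∑-⊗ (chains m a) _ _)) ⟩
          ∑ (downFrom q) (λ r → w (r * δ * size a) ⊗ D u r m a)
            ⊑⟨ ∑-mono-∈ (downFrom q) (λ {r} r∈ → ⊑-trans (D⊑F r m k a (fit (∈-downFrom⁻ r∈)) (ℕ.≤-pred (∈-downFrom⁻ r∈))) (F⊑F⁺ (u + δ) k a)) ⟩
          ∑ (downFrom q) (λ r → F⁺ (u + δ) k) ≡⟨ ∑-const (downFrom q) _ ⟩
          ι (length (downFrom q)) ⊗ F⁺ (u + δ) k ≡⟨ cong (λ n → ι n ⊗ F⁺ (u + δ) k) (length-downFrom q) ⟩
          ι q ⊗ F⁺ (u + δ) k ∎
          where
          fit : ∀ {r} → r < q → m * suc q′ + r ≤ q * k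
          fit {r} (s≤s r≤) = ℕ.≤-trans (ℕ.+-monoʳ-≤ (m * suc q′) r≤)
            (ℕ.≤-trans (ℕ.≤-reflexive (ℕ.+-comm (m * suc q′) (suc q′))) h)
          pointwise : ∀ {v} → Chain a v → w (g * size a) ⊗ w (u * sizes v)
                      ⊑ ∑ (downFrom q) (λ r → w (r * δ * size a) ⊗ (½ ↑ loss r a v ⊗ w (u * sizes v)))
          pointwise {v} ch with loss-pigeonhole ch
          ... | r , r<q , qℓ≤2s = ⊑-trans (begin
              w (g * size a) ⊗ w (u * sizes v)
                ⊑⟨ ⊗-monoˡ (w-anti cost) ⟩
              w (r * δ * size a + L * loss r a v) ⊗ w (u * sizes v) ≡⟨ cong (_⊗ w (u * sizes v)) (w-+ (r * δ * size a) _) ⟩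
              w (r * δ * size a) ⊗ w (L * loss r a v) ⊗ w (u * sizes v) ≡⟨ *-assoc _ _ _ ⟩
              w (r * δ * size a) ⊗ (w (L * loss r a v) ⊗ w (u * sizes v))
                ⊑⟨ ⊗-monoʳ (⊗-monoˡ (w-L (loss r a v))) ⟩
              w (r * δ * size a) ⊗ (½ ↑ loss r a v ⊗ w (u * sizes v)) ∎)
              (∑-∈ (λ r → w (r * δ * size a) ⊗ (½ ↑ loss r a v ⊗ w (u * sizes v))) (∈-downFrom⁺ r<q))
            where
            rδ≤u : r * δ ≤ u
            rδ≤u = ℕ.≤-trans (ℕ.*-monoˡ-≤ δ (ℕ.≤-pred r<q)) δ-small
            cost : r * δ * size a + L * loss r a v ≤ g * size a
            cost = ℕ.*-cancelˡ-≤ q (ℕ.≤-trans (ℕ.≤-reflexive (e₁ q (r * δ) (size a) L (loss r a v)))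
              (ℕ.≤-trans (ℕ.+-mono-≤ (ℕ.*-monoʳ-≤ L qℓ≤2s) (ℕ.*-monoʳ-≤ q (ℕ.*-monoˡ-≤ (size a) rδ≤u)))
              (ℕ.≤-trans (ℕ.≤-reflexive (e₂ q u (size a) L)) (ℕ.≤-trans (ℕ.*-monoˡ-≤ (size a) g-large)
                (ℕ.≤-reflexive (ℕ.*-assoc q g (size a)))))))
              where
              e₁ : ∀ q t s L l → q * (t * s + L * l) ≡ L * (q * l) + q * (t * s)
              e₁ = solve-∀
              e₂ : ∀ q u s L → L * (2 * s) + q * (u * s) ≡ (2 * L + q * u) * s
              e₂ = solve-∀

    -- Of the weight u′ + ε per point, every layer spends u′ on an independent factor `Z u′` and
    -- hands ε on to the next layer, which is no larger. Thus c grows by ε per layer until it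
    -- reaches g.
    prefix : ∀ {u′ ε g R m} → (∀ a → w (g * size a) ⊗ F (u′ + ε) m a ⊑ R) →
             ∀ j c a → g ≤ c + j * ε → w (c * size a) ⊗ F (u′ + ε) (j + m) a ⊑ Z u′ ↑ j ⊗ R
    prefix {u′} {ε} {g} {R} {m} base zero c a h = begin
      w (c * size a) ⊗ F (u′ + ε) m a ⊑⟨ ⊗-monoˡ (w-anti (ℕ.*-monoˡ-≤ (size a) (subst (g ≤_) (ℕ.+-identityʳ c) h))) ⟩
      w (g * size a) ⊗ F (u′ + ε) m a ⊑⟨ base a ⟩
      R                               ≡⟨ sym (*-identityˡ R) ⟩
      𝟙 ⊗ R ∎
    prefix {u′} {ε} {g} {R} {m} base (suc j) c a h = begin
      w (c * size a) ⊗ F (u′ + ε) (suc j + m) a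
        ≡⟨ trans (cong (w (c * size a) ⊗_) (F-suc (u′ + ε) (j + m) a)) (trans (∑-⊗ states _ _) (∑-cong states λ b → when-⊗ (b ≼ a) _ _)) ⟩
      ∑ states (λ b → when (b ≼ a) (w (c * size a) ⊗ (w ((u′ + ε) * size b) ⊗ F (u′ + ε) (j + m) b)))
        ⊑⟨ ∑-mono states (λ b → ⊑-trans (when-mono (b ≼ a) (term b)) (when-⊑ (b ≼ a))) ⟩
      ∑ states (λ b → Z u′ ↑ j ⊗ R ⊗ w (u′ * size b)) ≡⟨ sym (∑-⊗ states _ _) ⟩
      Z u′ ↑ j ⊗ R ⊗ Z u′ ≡⟨ trans (*-comm _ _) (sym (*-assoc _ _ _)) ⟩
      Z u′ ↑ suc j ⊗ R ∎
      where
      term : ∀ b → (b ≼ a) ≡ true → w (c * size a) ⊗ (w ((u′ + ε) * size b) ⊗ F (u′ + ε) (j + m) b) ⊑ Z u′ ↑ j ⊗ R ⊗ w (u′ * size b)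
      term b b≼a = begin
        w (c * size a) ⊗ (w ((u′ + ε) * size b) ⊗ F (u′ + ε) (j + m) b)
          ⊑⟨ ⊗-monoˡ (w-anti (ℕ.*-monoʳ-≤ c (size-mono b≼a))) ⟩
        w (c * size b) ⊗ (w ((u′ + ε) * size b) ⊗ F (u′ + ε) (j + m) b) ≡⟨ sym (*-assoc _ _ _) ⟩
        w (c * size b) ⊗ w ((u′ + ε) * size b) ⊗ F (u′ + ε) (j + m) b
          ≡⟨ cong (_⊗ F (u′ + ε) (j + m) b) (trans (sym (w-+ (c * size b) _)) (trans (cong w (ring u′ ε c (size b))) (w-+ (u′ * size b) _))) ⟩
        w (u′ * size b) ⊗ w ((c + ε) * size b) ⊗ F (u′ + ε) (j + m) b ≡⟨ *-assoc _ _ _ ⟩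
        w (u′ * size b) ⊗ (w ((c + ε) * size b) ⊗ F (u′ + ε) (j + m) b)
          ⊑⟨ ⊗-monoʳ (prefix {u′} {ε} {g = g} base j (c + ε) b (subst (g ≤_) (sym (ℕ.+-assoc c ε (j * ε))) h)) ⟩
        w (u′ * size b) ⊗ (Z u′ ↑ j ⊗ R) ≡⟨ *-comm _ _ ⟩
        Z u′ ↑ j ⊗ R ⊗ w (u′ * size b) ∎
        where
        ring : ∀ u ε c s → c * s + (u + ε) * s ≡ u * s + (c + ε) * s
        ring = solve-∀

    prefix⁺ : ∀ {u′ ε g R m} → (∀ a → w (g * size a) ⊗ F (u′ + ε) m a ⊑ R) →
              ∀ j → g ≤ suc j * ε → F⁺ (u′ + ε) (suc j + m) ⊑ Z u′ ↑ suc j ⊗ R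
    prefix⁺ {u′} {ε} {g} {R} {m} base j h = begin
      F⁺ (u′ + ε) (suc j + m) ≡⟨ F⁺-suc (u′ + ε) (j + m) ⟩
      ∑ states (λ b → w ((u′ + ε) * size b) ⊗ F (u′ + ε) (j + m) b) ⊑⟨ ∑-mono states term ⟩
      ∑ states (λ b → Z u′ ↑ j ⊗ R ⊗ w (u′ * size b)) ≡⟨ sym (∑-⊗ states _ _) ⟩
      Z u′ ↑ j ⊗ R ⊗ Z u′ ≡⟨ trans (*-comm _ _) (sym (*-assoc _ _ _)) ⟩
      Z u′ ↑ suc j ⊗ R ∎
      where
      term : ∀ b → w ((u′ + ε) * size b) ⊗ F (u′ + ε) (j + m) b ⊑ Z u′ ↑ j ⊗ R ⊗ w (u′ * size b)
      term b = begin
        w ((u′ + ε) * size b) ⊗ F (u′ + ε) (j + m) b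
          ≡⟨ cong (_⊗ F (u′ + ε) (j + m) b) (trans (cong w (ℕ.*-distribʳ-+ (size b) u′ ε)) (w-+ (u′ * size b) _)) ⟩
        w (u′ * size b) ⊗ w (ε * size b) ⊗ F (u′ + ε) (j + m) b ≡⟨ *-assoc _ _ _ ⟩
        w (u′ * size b) ⊗ (w (ε * size b) ⊗ F (u′ + ε) (j + m) b)
          ⊑⟨ ⊗-monoʳ (prefix {u′} {ε} {g = g} base j ε b h) ⟩
        w (u′ * size b) ⊗ (Z u′ ↑ j ⊗ R) ≡⟨ *-comm _ _ ⟩
        Z u′ ↑ j ⊗ R ⊗ w (u′ * size b) ∎

    F⁺-step : ∀ q′ {u′ ε δ} j m k → suc q′ * δ ≤ u′ + ε → suc m * suc q′ ≤ (2 + q′) * k →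
              2 * L + (2 + q′) * (u′ + ε) ≤ (2 + q′) * (suc j * ε) →
              F⁺ (u′ + ε) (suc j + m) ⊑ Z u′ ↑ suc j ⊗ (ι (2 + q′) ⊗ F⁺ (u′ + ε + δ) k)
    F⁺-step q′ {u′} {ε} {δ} j m k h₁ h₂ h₃ =
      prefix⁺ {u′} {ε} {g = suc j * ε} (λ a → coarsen q′ h₁ {g = suc j * ε} m k a h₂ h₃) j ℕ.≤-refl

    F⁺-short : ∀ {u′ ε} m → F⁺ (u′ + ε) m ⊑ Z u′ ↑ m
    F⁺-short {u′} {ε} zero    = ⊑-reflexive (F-zero (u′ + ε) ⊥)
    F⁺-short {u′} {ε} (suc j) = ⊑-trans (⊑-reflexive (cong (λ m → F⁺ (u′ + ε) m) (sym (ℕ.+-identityʳ (suc j)))))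
      (⊑-trans (prefix⁺ {u′} {ε} {0} {𝟙} {0} (λ a → ⊑-trans (x⊗y⊑y (w⊑𝟙 _)) (⊑-reflexive (F-zero (u′ + ε) a))) j z≤n)
        (⊑-reflexive (*-identityʳ _)))

  -- From one dimension to the next

  𝟚↑-mono : ∀ {m n} → m ≤ n → 𝟚 ↑ m ⊑ 𝟚 ↑ n
  𝟚↑-mono = ↑-monoʳ 𝟙⊑𝟚

  ι⊑𝟚↑ : ∀ n → ι n ⊑ 𝟚 ↑ n
  ι⊑𝟚↑ n = ⊑-trans (ι-mono (n≤2^n n)) (⊑-reflexive (ι-^ 2 n))

  -- Z Λ W (L / N) is bounded as if Λ consisted of the lower sets in dimension e + 1.
  Bounded : Level → Weight → (C e G B : ℕ) → Set
  Bounded Λ W C e G B = ∀ {N u} → 0 < N → N ≤ B → N * u ≡ Weight.L W → Drop.Z Λ W u ⊑ 𝟚 ↑ ((C * (N + G)) ^ e)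

  -- The independent layers are summed at N′, which can be twice N. So the bound in the lower
  -- dimension has to reach up to 2 B.
  module _ (Λ : Level) (W : Weight) (C e G B : ℕ) (1≤C : 1 ≤ C)
           (divisible : ∀ N → 0 < N → N ≤ 2 * B → ∃ λ u → N * u ≡ Weight.L W)
           (bounded : Bounded Λ W C e G (2 * B)) where
    open Drop Λ W
    open Weight W
    private
      q⁻ q : ℕ
      q⁻ = 3 + 4 * e
      q = suc q⁻

      -- The terms t Yᵉ of the steps, Y = N + G, telescope against 40 Yᵉ⁺¹; the others are paid once per step.
      potential : ℕ → ℕ → ℕ
      potential k N = C ^ e * (40 * (N + G) ^ suc e + 8 * q * suc k * (N + G) ^ e)

      smaller-unit : ∀ {N N′ u u′} → 0 < N → N ≤ N′ → N * u ≡ L → N′ * u′ ≡ L → u′ ≤ u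
      smaller-unit {N} {N′} {u} {u′} 0<N N≤N′ Nu N′u′ = ℕ.*-cancelˡ-≤ N {{>-nonZero 0<N}}
        (≤-trans (*-monoˡ-≤ u′ N≤N′) (≤-reflexive (trans N′u′ (sym Nu))))

      -- `u′`, `u` and `u″` are L/N′, L/N and L/N″, where N″ = N - t. The first layers hold back ε =
      -- u - u′ per point; after the deletions the survivors gain δ = u″ - u, which lowers N to N″.
      module Step (q≤G : q ≤ G) (ρ t u : ℕ) (ρ<q : ρ < q) (0<N : 0 < ρ + t * q) (N≤B : ρ + t * q ≤ B) (Nu≡L : (ρ + t * q) * u ≡ L) where
        open Budget C e t ρ G 1≤C hiding (q)

        N≤N′ : N ≤ N′
        N≤N′ = m≤m+n N (suc t)

        0<N′ : 0 < N′
        0<N′ = ≤-trans 0<N N≤N′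

        t<N : suc t ≤ N
        t<N = case t 0<N
          where
          case : ∀ t → 0 < ρ + t * q → suc t ≤ ρ + t * q
          case zero    h = h
          case (suc t) h = ≤-trans (≤-trans (m≤m+n _ _) (≤-reflexive (ring t e))) (m≤n+m _ ρ)
            where
            ring : ∀ t e → suc (suc t) + (2 + 4 * e + t * (3 + 4 * e)) ≡ suc t * (4 + 4 * e)
            ring = solve-∀

        N′≤2B : N′ ≤ 2 * B
        N′≤2B = ≤-trans (+-monoʳ-≤ N t<N) (≤-trans (≤-reflexive (cong (N +_) (sym (ℕ.+-identityʳ N)))) (*-monoʳ-≤ 2 N≤B))

        u′ : ℕ
        u′ = proj₁ (divisible N′ 0<N′ N′≤2B)
        N′u′≡L : N′ * u′ ≡ L
        N′u′≡L = proj₂ (divisible N′ 0<N′ N′≤2B)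
        u′≤u : u′ ≤ u
        u′≤u = smaller-unit 0<N N≤N′ Nu≡L N′u′≡L
        ε : ℕ
        ε = u ∸ u′
        u′+ε≡u : u′ + ε ≡ u
        u′+ε≡u = ℕ.m+[n∸m]≡n u′≤u

        N″ : ℕ
        N″ = ρ + t * q⁻
        N″+t≡N : N″ + t ≡ N
        N″+t≡N = ring ρ t q⁻
          where
          ring : ∀ ρ t q⁻ → ρ + t * q⁻ + t ≡ ρ + t * suc q⁻
          ring = solve-∀
        N″≤N : N″ ≤ N
        N″≤N = ≤-trans (m≤m+n N″ t) (≤-reflexive N″+t≡N)
        0<N″ : 0 < N″
        0<N″ = ℕ.+-cancelʳ-≤ t 1 N″ (≤-trans t<N (≤-reflexive (sym N″+t≡N)))
        N″≤B : N″ ≤ B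
        N″≤B = ≤-trans N″≤N N≤B
        N″≤2B : N″ ≤ 2 * B
        N″≤2B = ≤-trans N″≤B (m≤m+n B _)
        u″ : ℕ
        u″ = proj₁ (divisible N″ 0<N″ N″≤2B)
        N″u″≡L : N″ * u″ ≡ L
        N″u″≡L = proj₂ (divisible N″ 0<N″ N″≤2B)
        u≤u″ : u ≤ u″
        u≤u″ = smaller-unit 0<N″ N″≤N N″u″≡L Nu≡L
        δ : ℕ
        δ = u″ ∸ u
        u+δ≡u″ : u + δ ≡ u″
        u+δ≡u″ = ℕ.m+[n∸m]≡n u≤u″

        -- Multiplied by N N″ / L this reads q⁻ (N - N″) ≤ N″, that is q⁻ N ≤ q N″. It holds because
        -- N″ = N - t with t q ≤ N.
        q⁻δ≤u : q⁻ * δ ≤ u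
        q⁻δ≤u = ℕ.+-cancelˡ-≤ (q⁻ * u) _ _ (≤-trans (≤-reflexive (trans (sym (ℕ.*-distribˡ-+ q⁻ u δ)) (cong (q⁻ *_) u+δ≡u″)))
          (≤-trans q⁻u″≤qu (≤-reflexive (ℕ.+-comm u (q⁻ * u)))))
          where
          q⁻N≤qN″ : q⁻ * N ≤ q * N″
          q⁻N≤qN″ = ≤-trans (m≤m+n (q⁻ * N) ρ) (≤-reflexive (ring ρ t q⁻))
            where
            ring : ∀ ρ t q⁻ → q⁻ * (ρ + t * suc q⁻) + ρ ≡ suc q⁻ * (ρ + t * q⁻)
            ring = solve-∀
          q⁻u″≤qu : q⁻ * u″ ≤ q * u
          q⁻u″≤qu = ℕ.*-cancelˡ-≤ N″ {{>-nonZero 0<N″}} (begin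
            N″ * (q⁻ * u″)  ≡⟨ ring₁ N″ q⁻ u″ ⟩
            q⁻ * (N″ * u″)  ≡⟨ cong (q⁻ *_) (trans N″u″≡L (sym Nu≡L)) ⟩
            q⁻ * (N * u)    ≡⟨ sym (ℕ.*-assoc q⁻ N u) ⟩
            q⁻ * N * u      ≤⟨ *-monoˡ-≤ u q⁻N≤qN″ ⟩
            q * N″ * u     ≡⟨ ring₂ q N″ u ⟩
            N″ * (q * u) ∎)
            where
            open ℕ.≤-Reasoning
            ring₁ : ∀ n q⁻ u → n * (q⁻ * u) ≡ q⁻ * (n * u)
            ring₁ = solve-∀
            ring₂ : ∀ q n u → q * n * u ≡ n * (q * u)
            ring₂ = solve-∀

        NN′ε : N * N′ * ε ≡ L * suc t
        NN′ε = ℕ.+-cancelˡ-≡ (N * L) _ _ (begin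
          N * L + N * N′ * ε            ≡⟨ cong (λ l → N * l + N * N′ * ε) (sym N′u′≡L) ⟩
          N * (N′ * u′) + N * N′ * ε    ≡⟨ ring₁ N N′ u′ ε ⟩
          N′ * (N * (u′ + ε))           ≡⟨ cong (N′ *_) (trans (cong (N *_) u′+ε≡u) Nu≡L) ⟩
          N′ * L                        ≡⟨ ring₂ N t L ⟩
          N * L + L * suc t             ∎)
          where
          open ≡-Reasoning
          ring₁ : ∀ n m u e → n * (m * u) + n * m * e ≡ m * (n * (u + e))
          ring₁ = solve-∀
          ring₂ : ∀ n t L → (n + suc t) * L ≡ n * L + L * suc t
          ring₂ = solve-∀

        reserve : 2 * L + q * u ≤ q * (J * ε)
        reserve = ℕ.*-cancelˡ-≤ (N * N′) {{>-nonZero (*-mono-≤ 0<N 0<N′)}} (begin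
          N * N′ * (2 * L + q * u)                   ≡⟨ ring₁ N N′ L q u ⟩
          2 * (N * N′) * L + q * N′ * (N * u)        ≡⟨ cong (λ l → 2 * (N * N′) * L + q * N′ * l) Nu≡L ⟩
          2 * (N * N′) * L + q * N′ * L              ≡⟨ sym (ℕ.*-distribʳ-+ L (2 * (N * N′)) (q * N′)) ⟩
          (2 * (N * N′) + q * N′) * L                ≤⟨ *-monoˡ-≤ L key ⟩
          q * J * suc t * L                          ≡⟨ ring₂ (q * J) (suc t) L ⟩
          q * J * (L * suc t)                        ≡⟨ cong (q * J *_) (sym NN′ε) ⟩
          q * J * (N * N′ * ε)                       ≡⟨ ring₃ q J (N * N′) ε ⟩
          N * N′ * (q * (J * ε)) ∎)
          where
          open ℕ.≤-Reasoning
          ring₁ : ∀ n m L q u → n * m * (2 * L + q * u) ≡ 2 * (n * m) * L + q * m * (n * u)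
          ring₁ = solve-∀
          ring₂ : ∀ a b c → a * b * c ≡ a * (c * b)
          ring₂ = solve-∀
          ring₃ : ∀ q j n e → q * j * (n * e) ≡ n * (q * (j * e))
          ring₃ = solve-∀
          N≤q[t+1] : N ≤ suc t * q
          N≤q[t+1] = +-monoˡ-≤ (t * q) (ℕ.<⇒≤ ρ<q)
          key : 2 * (N * N′) + q * N′ ≤ q * J * suc t
          key = begin
            2 * (N * N′) + q * (N + suc t)                               ≤⟨ +-mono-≤ (*-monoʳ-≤ 2 (*-monoˡ-≤ N′ N≤q[t+1])) (*-monoʳ-≤ q (+-monoˡ-≤ (suc t) N≤q[t+1])) ⟩
            2 * (suc t * q * N′) + q * (suc t * q + suc t)               ≡⟨ ring q N′ t ⟩
            q * J * suc t ∎
            where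
            ring : ∀ q n t → 2 * (suc t * q * n) + q * (suc t * q + suc t) ≡ q * suc (2 * n + q) * suc t
            ring = solve-∀

    -- Induction on the number k of rounds still available; the fuel condition says that k rounds
    -- leave at most q layers. At most J layers are summed independently at once, and for k = 0 the
    -- fuel gives M ≤ q < J.
    F⁺-bound : q ≤ G → ∀ k N u M → 0 < N → N ≤ B → N * u ≡ L → M * q⁻ ^ k ≤ q ^ suc k → F⁺ u M ⊑ 𝟚 ↑ potential k N
    F⁺-bound q≤G k N u M 0<N N≤B Nu≡L fuel =
      subst (λ n → F⁺ u M ⊑ 𝟚 ↑ potential k n) (sym N≡)
        (go k (N % q) (N / q) (m%n<n N q) (subst (0 <_) N≡ 0<N) (subst (_≤ B) N≡ N≤B) (subst (λ n → n * u ≡ L) N≡ Nu≡L) fuel)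
      where
      N≡ : N ≡ N % q + N / q * q
      N≡ = m≡m%n+[m/n]*n N q
      go : ∀ k ρ t → ρ < q → 0 < ρ + t * q → ρ + t * q ≤ B → (ρ + t * q) * u ≡ L → M * q⁻ ^ k ≤ q ^ suc k → F⁺ u M ⊑ 𝟚 ↑ potential k (ρ + t * q)
      go k ρ t ρ<q 0<N N≤B Nu≡L fuel with M ≤? Budget.J C e t ρ G 1≤C
      ... | yes M≤J = begin
        F⁺ u M             ≡⟨ cong (λ v → F⁺ v M) (sym u′+ε≡u) ⟩
        F⁺ (u′ + ε) M      ⊑⟨ F⁺-short {u′} {ε} M ⟩
        Z u′ ↑ M           ⊑⟨ ↑-mono M (bounded 0<N′ N′≤2B N′u′≡L) ⟩
        (𝟚 ↑ E′) ↑ M       ≡⟨ sym (↑-* 𝟚 M E′) ⟩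
        𝟚 ↑ (M * E′)       ⊑⟨ 𝟚↑-mono (≤-trans (≤-trans (*-monoˡ-≤ E′ M≤J) (m≤m+n _ _)) (≤-trans (step-cost ρ<q q≤G k) (≤-reflexive (cong (λ y → C ^ e * (40 * y ^ suc e + 8 * q * suc k * y ^ e)) Y≡)))) ⟩
        𝟚 ↑ potential k (ρ + t * q) ∎
        where
        open ⊑-Reasoning
        open Step q≤G ρ t u ρ<q 0<N N≤B Nu≡L
        open Budget C e t ρ G 1≤C using (N′; J; Y≡; step-cost)
        E′ = (C * (N′ + G)) ^ e
      go zero ρ t ρ<q 0<N N≤B Nu≡L fuel | no M≰J = contradiction
        (≤-trans (subst₂ _≤_ (ℕ.*-identityʳ M) (ℕ.*-identityʳ q) fuel) (≤-trans (m≤n+m q _) (ℕ.n≤1+n _))) M≰J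
      go (suc k) ρ t ρ<q 0<N N≤B Nu≡L fuel | no M≰J = begin
        F⁺ u M                        ≡⟨ cong₂ F⁺ (sym u′+ε≡u) (sym J+m≡M) ⟩
        F⁺ (u′ + ε) (J + m)           ⊑⟨ F⁺-step (2 + 4 * e) {u′} {ε} {δ} (2 * N′ + q) m M″
                                          (subst (q⁻ * δ ≤_) (sym u′+ε≡u) q⁻δ≤u) fits (subst (λ v → 2 * L + q * v ≤ q * (J * ε)) (sym u′+ε≡u) reserve) ⟩
        Z u′ ↑ J ⊗ (ι q ⊗ F⁺ (u′ + ε + δ) M″)  ≡⟨ cong (λ v → Z u′ ↑ J ⊗ (ι q ⊗ F⁺ v M″)) (trans (cong (_+ δ) u′+ε≡u) u+δ≡u″) ⟩
        Z u′ ↑ J ⊗ (ι q ⊗ F⁺ u″ M″)   ⊑⟨ ⊗-mono (↑-mono J (bounded 0<N′ N′≤2B N′u′≡L)) (⊗-mono (ι⊑𝟚↑ q) (F⁺-bound q≤G k N″ u″ M″ 0<N″ N″≤B N″u″≡L fuel′)) ⟩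
        (𝟚 ↑ E′) ↑ J ⊗ (𝟚 ↑ q ⊗ 𝟚 ↑ potential k N″) ≡⟨ cong₂ _⊗_ (sym (↑-* 𝟚 J E′)) (sym (↑-+ 𝟚 q _)) ⟩
        𝟚 ↑ (J * E′) ⊗ 𝟚 ↑ (q + potential k N″)     ≡⟨ sym (↑-+ 𝟚 (J * E′) _) ⟩
        𝟚 ↑ (J * E′ + (q + potential k N″))         ⊑⟨ 𝟚↑-mono cost ⟩
        𝟚 ↑ potential (suc k) (ρ + t * q) ∎
        where
        open ⊑-Reasoning
        open Step q≤G ρ t u ρ<q 0<N N≤B Nu≡L
        open Budget C e t ρ G 1≤C using (N′; J; X; Y; Y≡; step-cost)
        E′ = (C * (N′ + G)) ^ e
        m = M ∸ J
        J+m≡M : J + m ≡ M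
        J+m≡M = ℕ.m+[n∸m]≡n (ℕ.<⇒≤ (ℕ.≰⇒> M≰J))
        -- This is (m + 1) q⁻ / q rounded up. It is still at most M q⁻ / q, because J ≥ 2.
        M″ = (2 + m) * q⁻ / q
        fits : suc m * q⁻ ≤ q * M″
        fits = ℕ.+-cancelˡ-≤ q⁻ _ _ (≤-trans (≤-reflexive (m≡m%n+[m/n]*n ((2 + m) * q⁻) q))
          (+-mono-≤ (ℕ.≤-pred (m%n<n ((2 + m) * q⁻) q)) (≤-reflexive (ℕ.*-comm M″ q))))
        fuel′ : M″ * q⁻ ^ k ≤ q ^ suc k
        fuel′ = ℕ.*-cancelˡ-≤ q (≤-trans (≤-reflexive (ring q M″ (q⁻ ^ k)))
          (≤-trans (*-monoˡ-≤ (q⁻ ^ k) (≤-trans (m/n*n≤m ((2 + m) * q⁻) q) (*-monoˡ-≤ q⁻ 2+m≤M)))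
          (≤-trans (≤-reflexive (ℕ.*-assoc M q⁻ (q⁻ ^ k))) fuel)))
          where
          ring : ∀ q m x → q * (m * x) ≡ m * q * x
          ring = solve-∀
          2+m≤M : 2 + m ≤ M
          2+m≤M = ≤-trans (+-monoˡ-≤ m (s≤s (≤-trans (s≤s z≤n) (m≤n+m q (2 * N′))))) (≤-reflexive J+m≡M)
        cost : J * E′ + (q + potential k N″) ≤ potential (suc k) (ρ + t * q)
        cost = ≤-trans (+-monoʳ-≤ (J * E′) (+-monoʳ-≤ q (*-monoʳ-≤ (C ^ e) (+-monoʳ-≤ (40 * X ^ suc e) (*-monoʳ-≤ (8 * q * suc k) (^-monoˡ-≤ e (m≤m+n X t)))))))
          (≤-trans (step-cost ρ<q q≤G (suc k)) (≤-reflexive (cong (λ y → C ^ e * (40 * y ^ suc e + 8 * q * suc (suc k) * y ^ e)) Y≡)))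

    -- The size of G lets one more Y^(e+1) absorb the fixed costs of all rounds, so the potential is
    -- at most 41 C^e Y^(e+1). The next dimension brings one more factor C, and C ≥ 41 pays for this
    -- constant.
    level⁺-bounded : ∀ k M → 41 ≤ C → 8 * q * suc k ≤ G → M * q⁻ ^ k ≤ q ^ suc k → Bounded (Chains.level⁺ Λ M) W C (suc e) G B
    level⁺-bounded k M 41≤C G-large fuel {N} {u} 0<N N≤B Nu≡L =
      ⊑-trans (F⁺-bound q≤G k N u M 0<N N≤B Nu≡L fuel) (𝟚↑-mono final)
      where
      open ℕ.≤-Reasoning
      q≤G : q ≤ G
      q≤G = ≤-trans (≤-trans (m≤m+n q _) (≤-reflexive (ring q k))) G-large
        where
        ring : ∀ q k → q + (7 * q + 8 * q * k) ≡ 8 * q * suc k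
        ring = solve-∀
      Y = N + G
      final : potential k N ≤ (C * Y) ^ suc e
      final = begin
        C ^ e * (40 * Y ^ suc e + 8 * q * suc k * Y ^ e) ≤⟨ *-monoʳ-≤ (C ^ e) (+-monoʳ-≤ (40 * Y ^ suc e) (*-monoˡ-≤ (Y ^ e) (≤-trans G-large (m≤n+m G N)))) ⟩
        C ^ e * (40 * Y ^ suc e + Y * Y ^ e)             ≡⟨ ring₁ (C ^ e) Y (Y ^ e) ⟩
        41 * C ^ e * (Y * Y ^ e)                         ≤⟨ *-monoˡ-≤ (Y * Y ^ e) (*-monoˡ-≤ (C ^ e) 41≤C) ⟩
        C * C ^ e * (Y * Y ^ e)                          ≡⟨ sym (^-distrib-* C Y (suc e)) ⟩
        (C * Y) ^ suc e ∎
        where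
        ring₁ : ∀ c y z → c * (40 * (y * z) + y * z) ≡ 41 * c * (y * z)
        ring₁ = solve-∀

  -- Rational weights

  module PowerWeight (l : ℕ) where
    open ⊑-Reasoning
    private
      L = suc l
    -- A rational substitute for 2^(-1/L). Its L-th power lies between 1/4 and 1/2: the upper bound
    -- gives `w-L`, and the lower bound is used when weights are undone, at two bits instead of one.
    β : Carrier
    β = ι L ⊗ recip L

    β⊑𝟙 : β ⊑ 𝟙
    β⊑𝟙 = ⊑-trans (⊗-monoˡ (ι-mono (ℕ.n≤1+n L))) (⊑-reflexive (ι⊗recip L))

    -- β = L/(L+1), so β⁻ᵏ ≥ 1 + k/L.
    β-bernoulli : ∀ k → ι (L + k) ⊗ β ↑ k ⊑ ι L
    β-bernoulli zero    = ⊑-reflexive (trans (*-identityʳ _) (cong ι (ℕ.+-identityʳ L)))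
    β-bernoulli (suc k) = begin
      ι (L + suc k) ⊗ (ι L ⊗ recip L ⊗ β ↑ k)  ≡⟨ shuffle (ι (L + suc k)) (ι L) (recip L) (β ↑ k) ⟩
      ι (L + suc k) ⊗ ι L ⊗ (recip L ⊗ β ↑ k)  ⊑⟨ ⊗-monoˡ cross ⟩
      ι (suc L) ⊗ ι (L + k) ⊗ (recip L ⊗ β ↑ k) ≡⟨ ⊗.interchange (ι (suc L)) (ι (L + k)) (recip L) (β ↑ k) ⟩
      (ι (suc L) ⊗ recip L) ⊗ (ι (L + k) ⊗ β ↑ k) ≡⟨ trans (cong (_⊗ (ι (L + k) ⊗ β ↑ k)) (ι⊗recip L)) (*-identityˡ _) ⟩
      ι (L + k) ⊗ β ↑ k                         ⊑⟨ β-bernoulli k ⟩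
      ι L ∎
      where
      shuffle : ∀ a b c d → a ⊗ (b ⊗ c ⊗ d) ≡ a ⊗ b ⊗ (c ⊗ d)
      shuffle a b c d = trans (cong (a ⊗_) (*-assoc b c d)) (sym (*-assoc a b (c ⊗ d)))
      cross : ι (L + suc k) ⊗ ι L ⊑ ι (suc L) ⊗ ι (L + k)
      cross = begin
        ι (L + suc k) ⊗ ι L      ≡⟨ sym (ι-* (L + suc k) L) ⟩
        ι ((L + suc k) * L)      ⊑⟨ ι-mono (≤-trans (m≤m+n _ k) (≤-reflexive (ring L k))) ⟩
        ι (suc L * (L + k))      ≡⟨ ι-* (suc L) (L + k) ⟩
        ι (suc L) ⊗ ι (L + k) ∎
        where
        ring : ∀ L k → (L + suc k) * L + k ≡ suc L * (L + k)
        ring = solve-∀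

    𝟚⊗x⊑𝟙⇒x⊑½ : ∀ {x} → 𝟚 ⊗ x ⊑ 𝟙 → x ⊑ ½
    𝟚⊗x⊑𝟙⇒x⊑½ p = ⊗-cancelˡ {c = 𝟚} {½} (trans (*-comm ½ 𝟚) 𝟚⊗½) (⊑-trans p (⊑-reflexive (sym 𝟚⊗½)))

    βᴸ⊑½ : β ↑ L ⊑ ½
    βᴸ⊑½ = 𝟚⊗x⊑𝟙⇒x⊑½ (⊗-cancelˡ {c = ι L} {recip l} (trans (*-comm _ _) (ι⊗recip l)) (begin
      ι L ⊗ (𝟚 ⊗ β ↑ L)   ≡⟨ trans (sym (*-assoc _ _ _)) (cong (_⊗ β ↑ L) (trans (*-comm (ι L) 𝟚) (trans (sym (ι-* 2 L)) (cong (λ m → ι (L + m)) (ℕ.+-identityʳ L))))) ⟩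
      ι (L + L) ⊗ β ↑ L   ⊑⟨ β-bernoulli L ⟩
      ι L                 ≡⟨ sym (*-identityʳ (ι L)) ⟩
      ι L ⊗ 𝟙 ∎))

    𝟙⊑4βᴸ : 𝟙 ⊑ 𝟚 ↑ 2 ⊗ β ↑ L
    𝟙⊑4βᴸ = begin
      𝟙                                 ≡⟨ sym (𝟙↑ L) ⟩
      𝟙 ↑ L                             ≡⟨ cong (_↑ L) (sym (ι⊗recip L)) ⟩
      (ι (suc L) ⊗ recip L) ↑ L         ≡⟨ ↑-⊗ (ι (suc L)) (recip L) L ⟩
      ι (suc L) ↑ L ⊗ recip L ↑ L       ≡⟨ cong (_⊗ recip L ↑ L) (sym (ι-^ (suc L) L)) ⟩
      ι (suc L ^ L) ⊗ recip L ↑ L       ⊑⟨ ⊗-monoˡ (ι-mono (suc^≤4 L (s≤s z≤n))) ⟩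
      ι (4 * L ^ L) ⊗ recip L ↑ L       ≡⟨ cong (_⊗ recip L ↑ L) (trans (ι-* 4 (L ^ L)) (cong₂ _⊗_ (ι-^ 2 2) (ι-^ L L))) ⟩
      𝟚 ↑ 2 ⊗ ι L ↑ L ⊗ recip L ↑ L     ≡⟨ trans (*-assoc _ _ _) (cong (𝟚 ↑ 2 ⊗_) (sym (↑-⊗ (ι L) (recip L) L))) ⟩
      𝟚 ↑ 2 ⊗ β ↑ L ∎

    weight : Weight
    weight = record
      { w      = β ↑_
      ; L      = L
      ; w-0    = refl
      ; w-+    = ↑-+ β
      ; w-anti = ↑-anti β⊑𝟙
      ; w-L    = λ k → ⊑-trans (⊑-reflexive (trans (cong (β ↑_) (ℕ.*-comm L k)) (↑-* β k L))) (↑-mono k βᴸ⊑½)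
      }

    𝟙⊑4ᵏβᴸᵏ : ∀ k → 𝟙 ⊑ 𝟚 ↑ (k * 2) ⊗ β ↑ (k * L)
    𝟙⊑4ᵏβᴸᵏ k = begin
      𝟙                              ⊑⟨ 𝟙⊑↑ k 𝟙⊑4βᴸ ⟩
      (𝟚 ↑ 2 ⊗ β ↑ L) ↑ k            ≡⟨ ↑-⊗ (𝟚 ↑ 2) (β ↑ L) k ⟩
      (𝟚 ↑ 2) ↑ k ⊗ (β ↑ L) ↑ k      ≡⟨ cong₂ _⊗_ (sym (↑-* 𝟚 k 2)) (sym (↑-* β k L)) ⟩
      𝟚 ↑ (k * 2) ⊗ β ↑ (k * L) ∎

  -- The base of the induction: dimensions 1 and 2

  ≤⇒true : ∀ {m n} → m ≤ n → (m ≤ᵇ n) ≡ true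
  ≤⇒true p = Equivalence.to T-≡ (ℕ.≤⇒≤ᵇ p)

  true⇒≤ : ∀ {m n} → (m ≤ᵇ n) ≡ true → m ≤ n
  true⇒≤ {m} {n} p = ℕ.≤ᵇ⇒≤ m n (Equivalence.from T-≡ p)

  >⇒false : ∀ {m n} → n < m → (m ≤ᵇ n) ≡ false
  >⇒false {m} {n} n<m with m ≤ᵇ n in eq
  ... | false = refl
  ... | true  = contradiction (true⇒≤ eq) (ℕ.<⇒≱ n<m)

  between : ℕ → ℕ → ℕ → Carrier
  between a b y = when (a ≤ᵇ y) (when (y ≤ᵇ b) 𝟙)

  ∑-between-low : ∀ a b S → S ≤ a → ∑ (downFrom S) (between a b) ≡ 𝟘
  ∑-between-low a b zero    h = refl
  ∑-between-low a b (suc S) h rewrite >⇒false h = trans (+-identityˡ _) (∑-between-low a b S (ℕ.<⇒≤ h))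

  ∑-between : ∀ a b d S → S ≤ suc (a + d) → ∑ (downFrom S) (between a b) ⊑ 𝟚 ↑ d
  ∑-between a b d zero h = 𝟘⊑
  ∑-between a b zero (suc S) h = begin
    between a b S ⊕ ∑ (downFrom S) (between a b) ≡⟨ cong (between a b S ⊕_) (∑-between-low a b S (≤-trans (ℕ.≤-pred h) (≤-reflexive (ℕ.+-identityʳ a)))) ⟩
    between a b S ⊕ 𝟘  ≡⟨ +-identityʳ _ ⟩
    between a b S      ⊑⟨ ⊑-trans (when-⊑ (a ≤ᵇ S)) (when-⊑ (S ≤ᵇ b)) ⟩
    𝟙 ∎
    where open ⊑-Reasoning
  ∑-between a b (suc d) (suc S) h = begin
    between a b S ⊕ ∑ (downFrom S) (between a b) ⊑⟨ ⊕-mono (⊑-trans (when-⊑ (a ≤ᵇ S)) (when-⊑ (S ≤ᵇ b))) (∑-between a b d S (≤-trans (ℕ.≤-pred h) (≤-reflexive (ℕ.+-suc a d)))) ⟩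
    𝟙 ⊕ 𝟚 ↑ d          ⊑⟨ ⊕-monoˡ (𝟙⊑↑ d 𝟙⊑𝟚) ⟩
    𝟚 ↑ d ⊕ 𝟚 ↑ d      ≡⟨ sym (𝟚⊗ (𝟚 ↑ d)) ⟩
    𝟚 ⊗ 𝟚 ↑ d ∎
    where open ⊑-Reasoning

  ∑-between-high : ∀ a b S → suc b ≤ S → ∑ (downFrom S) (between a b) ≡ ∑ (downFrom (suc b)) (between a b)
  ∑-between-high a b (suc S) h with S ≤? b
  ... | yes S≤b rewrite ℕ.≤-antisym S≤b (ℕ.≤-pred h) = refl
  ... | no  S≰b rewrite >⇒false (ℕ.≰⇒> S≰b) = trans (cong (_⊕ ∑ (downFrom S) (between a b)) (zero-when (a ≤ᵇ S)))
        (trans (+-identityˡ _) (∑-between-high a b S (ℕ.≰⇒> S≰b)))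
    where
    zero-when : ∀ t → when t 𝟘 ≡ 𝟘
    zero-when true  = refl
    zero-when false = refl

  lineLevel : ℕ → Level
  lineLevel M = record
    { State     = ℕ
    ; states    = downFrom (suc M)
    ; _≼_       = _≤ᵇ_
    ; size      = λ k → k
    ; ≼-trans   = λ {a} {b} {c} p q → ≤⇒true (≤-trans (true⇒≤ {a} {b} p) (true⇒≤ {b} {c} q))
    ; size-mono = λ {a} {b} → true⇒≤ {a} {b}
    ; ⊥         = 0
    ; ⊥∈states  = ∈-downFrom⁺ (s≤s z≤n)
    ; ⊥≼        = λ _ → refl
    ; size-⊥    = refl
    ; interval  = λ {a} {b} p → count a b (true⇒≤ {a} {b} p)
    }
    where
    -- There are b - a + 1 ≤ 2^(b - a) integers from a to b; the two cases differ in whether M cuts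
    -- the interval off.
    count : ∀ a b → a ≤ b → ∑ (downFrom (suc M)) (between a b) ⊑ 𝟚 ↑ (b ∸ a)
    count a b a≤b with suc M ≤? suc b
    ... | yes h = ∑-between a b (b ∸ a) (suc M) (≤-trans h (s≤s (≤-reflexive (sym (ℕ.m+[n∸m]≡n a≤b)))))
    ... | no  h = ⊑-trans (⊑-reflexive (∑-between-high a b (suc M) (ℕ.<⇒≤ (ℕ.≰⇒> h))))
          (∑-between a b (b ∸ a) (suc b) (s≤s (≤-reflexive (sym (ℕ.m+[n∸m]≡n a≤b)))))

  ∑-downFrom-mono : ∀ {S T} → S ≤ T → ∀ h → ∑ (downFrom S) h ⊑ ∑ (downFrom T) h
  ∑-downFrom-mono {zero}  {T}     _ h = 𝟘⊑
  ∑-downFrom-mono {suc S} {suc T} p h with S ≤? T | suc S ≤? T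
  ... | _ | yes S<T = ⊑-trans (∑-downFrom-mono {suc S} {T} S<T h) x⊑y⊕x
  ... | _ | no S≮T rewrite ℕ.≤-antisym (ℕ.≤-pred p) (ℕ.≤-pred (ℕ.≰⇒> S≮T)) = ⊑-refl

  ∑-downFrom-below : ∀ S a h → ∑ (downFrom S) (λ b → when (b ≤ᵇ a) (h b)) ⊑ ∑ (downFrom (suc a)) h
  ∑-downFrom-below zero    a h = 𝟘⊑
  ∑-downFrom-below (suc S) a h with S ≤? a
  ... | yes S≤a = ⊑-trans (∑-mono (downFrom (suc S)) (λ b → when-⊑ (b ≤ᵇ a))) (∑-downFrom-mono (s≤s S≤a) h)
  ... | no  S≰a rewrite >⇒false (ℕ.≰⇒> S≰a) = ⊑-trans (⊑-reflexive (+-identityˡ _)) (∑-downFrom-below S a h)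

  Π : ℕ → Carrier
  Π zero    = 𝟙
  Π (suc n) = Π n ⊗ (𝟙 ⊕ ½ ↑ n)

  -- The extra term makes the induction work: a further factor 1 + y, with y = 2^(-2-n), adds at
  -- most 6 y to the product, and the extra term shrinks by exactly 6 y.
  Π⊑6 : ∀ n → Π (2 + n) ⊕ ι 6 ⊗ ½ ↑ (1 + n) ⊑ ι 6
  Π⊑6 zero = ⊑-reflexive (trans (cong₂ _⊕_ e₁ e₂) (sym (ι-+ 3 3)))
    where
    half+ : 𝟙 ⊕ ½ ↑ 1 ≡ 𝟙 ⊕ ½
    half+ = cong (𝟙 ⊕_) (*-identityʳ ½)
    e₁ : Π 2 ≡ ι 3
    e₁ = trans (cong₂ _⊗_ (trans (*-identityˡ _) (sym (cong (𝟙 ⊕_) ι1≡𝟙))) half+)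
      (trans (distribˡ 𝟚 𝟙 ½) (trans (cong₂ _⊕_ (*-identityʳ 𝟚) (trans 𝟚⊗½ (sym ι1≡𝟙))) (sym (ι-+ 2 1))))
    e₂ : ι 6 ⊗ ½ ↑ 1 ≡ ι 3
    e₂ = trans (cong₂ _⊗_ (ι-* 3 2) (*-identityʳ ½)) (trans (*-assoc _ _ _) (trans (cong (ι 3 ⊗_) 𝟚⊗½) (*-identityʳ _)))
  Π⊑6 (suc n) = begin
    Π (2 + n) ⊗ (𝟙 ⊕ y) ⊕ ι 6 ⊗ y          ≡⟨ cong (_⊕ ι 6 ⊗ y) (trans (distribˡ _ _ _) (cong (_⊕ Π (2 + n) ⊗ y) (*-identityʳ _))) ⟩
    Π (2 + n) ⊕ Π (2 + n) ⊗ y ⊕ ι 6 ⊗ y    ⊑⟨ ⊕-monoˡ (⊕-monoʳ (⊗-monoˡ (⊑-trans x⊑x⊕y (Π⊑6 n)))) ⟩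
    Π (2 + n) ⊕ ι 6 ⊗ y ⊕ ι 6 ⊗ y          ≡⟨ trans (+-assoc _ _ _) (cong (Π (2 + n) ⊕_) (trans (sym (𝟚⊗ _)) (trans (⊗.x∙yz≈y∙xz 𝟚 (ι 6) y) (cong (ι 6 ⊗_) (trans (sym (*-assoc 𝟚 ½ _)) (trans (cong (_⊗ ½ ↑ (1 + n)) 𝟚⊗½) (*-identityˡ _))))))) ⟩
    Π (2 + n) ⊕ ι 6 ⊗ ½ ↑ (1 + n)          ⊑⟨ Π⊑6 n ⟩
    ι 6 ∎
    where
    open ⊑-Reasoning
    y = ½ ↑ (2 + n)

  Π-step : ∀ n → Π n ⊑ Π (suc n)
  Π-step n = ⊑-trans (⊑-reflexive (sym (*-identityʳ _))) (⊗-monoʳ x⊑x⊕y)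

  Π⊑8 : ∀ n → Π n ⊑ 𝟚 ↑ 3
  Π⊑8 n = begin
    Π n        ⊑⟨ ⊑-trans (Π-step n) (Π-step (suc n)) ⟩
    Π (2 + n)  ⊑⟨ ⊑-trans x⊑x⊕y (Π⊑6 n) ⟩
    ι 6        ⊑⟨ ι-mono {6} {8} (s≤s (s≤s (s≤s (s≤s (s≤s (s≤s z≤n)))))) ⟩
    ι 8        ≡⟨ ι-^ 2 3 ⟩
    𝟚 ↑ 3 ∎
    where open ⊑-Reasoning

  -- growth k bounds the generating function ∏_{i≤k} 1/(1-xⁱ) of partitions into parts at most k:
  -- for i ≤ N use xⁱ ≤ N/(N+i), which gives a binomial coefficient, and beyond N use x^(jN) ≤ 2⁻ʲ.
  module Partitions (l n u′ : ℕ) (Nu≡L : suc n * suc u′ ≡ suc l) (M : ℕ) where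
    open PowerWeight l
    open Drop (lineLevel M) weight
    open Weight weight using (w-L; w-anti)
    open ⊑-Reasoning

    private
      N = suc n
      u = suc u′

    tail : ℕ → Carrier
    tail zero    = 𝟙
    tail (suc i) = tail i ⊗ (𝟙 ⊕ ½ ↑ (i / N))

    growth : ℕ → Carrier
    growth k = ι (pascal N (k ⊓ N)) ⊗ tail (k ∸ N)

    private
      x-small : ∀ i → ι (N + i) ⊗ β ↑ (u * i) ⊑ ι N
      x-small i = ⊗-cancelˡ {c = ι u} {recip u′} (trans (*-comm _ _) (ι⊗recip u′)) (begin
        ι u ⊗ (ι (N + i) ⊗ β ↑ (u * i))       ≡⟨ trans (sym (*-assoc _ _ _)) (cong (_⊗ β ↑ (u * i)) (sym (ι-* u (N + i)))) ⟩
        ι (u * (N + i)) ⊗ β ↑ (u * i)         ≡⟨ cong (λ m → ι m ⊗ β ↑ (u * i)) (trans (ℕ.*-distribˡ-+ u N i) (cong (_+ u * i) (trans (ℕ.*-comm u N) Nu≡L))) ⟩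
        ι (suc l + u * i) ⊗ β ↑ (u * i)       ⊑⟨ β-bernoulli (u * i) ⟩
        ι (suc l)                             ≡⟨ trans (cong ι (trans (sym Nu≡L) (ℕ.*-comm N u))) (ι-* u N) ⟩
        ι u ⊗ ι N ∎)

      x-tail : ∀ i → β ↑ (u * suc (N + i)) ⊑ ½ ↑ suc (i / N)
      x-tail i = ⊑-trans (w-anti le) (w-L (suc (i / N)))
        where
        le : suc l * suc (i / N) ≤ u * suc (N + i)
        le = ≤-trans (≤-reflexive (trans (cong (_* suc (i / N)) (trans (sym Nu≡L) (ℕ.*-comm N u))) (ℕ.*-assoc u N (suc (i / N)))))
          (*-monoʳ-≤ u (≤-trans (≤-trans (≤-reflexive (trans (ℕ.*-suc N (i / N)) (cong (N +_) (ℕ.*-comm N (i / N))))) (+-monoʳ-≤ N (m/n*n≤m i N))) (ℕ.n≤1+n (N + i))))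

      -- By `x-small` and the absorption identity, multiplication by x^(k+1) turns
      -- `pascal N (suc k)` into at most `pascal n (suc k)`, the other summand in Pascal's rule.
      step-head : ∀ k → ι (pascal N k) ⊕ β ↑ (u * suc k) ⊗ ι (pascal N (suc k)) ⊑ ι (pascal N (suc k))
      step-head k = begin
        ι (pascal N k) ⊕ x ⊗ ι (pascal N (suc k))  ⊑⟨ ⊕-monoʳ bound ⟩
        ι (pascal N k) ⊕ ι (pascal n (suc k))      ≡⟨ trans (+-comm _ _) (sym (ι-+ (pascal n (suc k)) (pascal N k))) ⟩
        ι (pascal N (suc k)) ∎
        where
        x = β ↑ (u * suc k)
        bound : x ⊗ ι (pascal N (suc k)) ⊑ ι (pascal n (suc k))
        bound = ⊗-cancelˡ {c = ι N} {recip n} (trans (*-comm _ _) (ι⊗recip n)) (begin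
          ι N ⊗ (x ⊗ ι (pascal N (suc k)))            ≡⟨ trans (⊗.x∙yz≈y∙xz (ι N) x _) (cong (x ⊗_) (trans (sym (ι-* N (pascal N (suc k)))) (trans (cong ι (pascal-sucˡ n (suc k))) (ι-* (N + suc k) (pascal n (suc k)))))) ⟩
          x ⊗ (ι (N + suc k) ⊗ ι (pascal n (suc k)))  ≡⟨ trans (sym (*-assoc _ _ _)) (cong (_⊗ ι (pascal n (suc k))) (*-comm x _)) ⟩
          ι (N + suc k) ⊗ x ⊗ ι (pascal n (suc k))    ⊑⟨ ⊗-monoˡ (x-small (suc k)) ⟩
          ι N ⊗ ι (pascal n (suc k)) ∎)

      -- This is 1/(1 - h/2) ≤ 1 + h for h ≤ 1, written without division.
      step-tail : ∀ {t x h} → x ⊑ ½ ⊗ h → h ⊑ 𝟙 → t ⊕ x ⊗ (t ⊗ (𝟙 ⊕ h)) ⊑ t ⊗ (𝟙 ⊕ h)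
      step-tail {t} {x} {h} x⊑ h⊑ = begin
        t ⊕ x ⊗ (t ⊗ (𝟙 ⊕ h))             ≡⟨ cong (t ⊕_) (⊗.x∙yz≈y∙xz x t _) ⟩
        t ⊕ t ⊗ (x ⊗ (𝟙 ⊕ h))             ⊑⟨ ⊕-monoʳ (⊗-monoʳ (⊗-mono x⊑ (⊕-monoʳ h⊑))) ⟩
        t ⊕ t ⊗ (½ ⊗ h ⊗ (𝟙 ⊕ 𝟙))         ≡⟨ cong (λ z → t ⊕ t ⊗ z) (trans (⊗.xy∙z≈xz∙y ½ h _) (trans (cong (_⊗ h) (trans (*-comm ½ _) (trans (cong (_⊗ ½) (cong (𝟙 ⊕_) (sym ι1≡𝟙))) 𝟚⊗½))) (*-identityˡ h))) ⟩
        t ⊕ t ⊗ h                         ≡⟨ trans (cong (_⊕ t ⊗ h) (sym (*-identityʳ t))) (sym (distribˡ t 𝟙 h)) ⟩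
        t ⊗ (𝟙 ⊕ h) ∎

    -- With x = β^u: the step from k to k + 1 multiplies `growth` by at least 1/(1 - x^(k+1)), the
    -- factor of the generating function, again without division.
    growth-suc : ∀ k → growth k ⊕ β ↑ (u * suc k) ⊗ growth (suc k) ⊑ growth (suc k)
    growth-suc k with suc k ≤? N
    ... | yes k<N = subst₂ (λ s t → s ⊕ β ↑ (u * suc k) ⊗ t ⊑ t) (sym (e k (ℕ.<⇒≤ k<N))) (sym (e (suc k) k<N)) (step-head k)
      where
      e : ∀ i → i ≤ N → growth i ≡ ι (pascal N i)
      e i i≤N = trans (cong₂ (λ m j → ι (pascal N m) ⊗ tail j) (ℕ.m≤n⇒m⊓n≡m i≤N) (ℕ.m≤n⇒m∸n≡0 i≤N)) (*-identityʳ _)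
    ... | no  k≮N = subst₂ (λ s t → s ⊕ β ↑ (u * suc k) ⊗ t ⊑ t) (sym e₁) (sym e₂) (step-tail x⊑ (↑-⊑𝟙 ((k ∸ N) / N) ½⊑𝟙))
      where
      N≤k : N ≤ k
      N≤k = ℕ.≤-pred (ℕ.≰⇒> k≮N)
      P = ι (pascal N N)
      e₁ : growth k ≡ P ⊗ tail (k ∸ N)
      e₁ = cong (λ m → ι (pascal N m) ⊗ tail (k ∸ N)) (ℕ.m≥n⇒m⊓n≡n N≤k)
      e₂ : growth (suc k) ≡ P ⊗ tail (k ∸ N) ⊗ (𝟙 ⊕ ½ ↑ ((k ∸ N) / N))
      e₂ = trans (cong₂ (λ m i → ι (pascal N m) ⊗ tail i) (ℕ.m≥n⇒m⊓n≡n (≤-trans N≤k (ℕ.n≤1+n k))) (ℕ.+-∸-assoc 1 N≤k)) (sym (*-assoc _ _ _))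
      x⊑ : β ↑ (u * suc k) ⊑ ½ ⊗ ½ ↑ ((k ∸ N) / N)
      x⊑ = subst (λ m → β ↑ (u * suc m) ⊑ ½ ⊗ ½ ↑ ((k ∸ N) / N)) (ℕ.m+[n∸m]≡n N≤k) (x-tail (k ∸ N))

    growth-mono : ∀ {k m} → k ≤ m → growth k ⊑ growth m
    growth-mono {k} {m} k≤m = subst (λ z → growth k ⊑ growth z) (ℕ.m∸n+n≡m k≤m) (go (m ∸ k))
      where
      go : ∀ i → growth k ⊑ growth (i + k)
      go zero    = ⊑-refl
      go (suc i) = ⊑-trans (go i) (⊑-trans x⊑x⊕y (growth-suc (i + k)))

    growth-0 : growth 0 ≡ 𝟙
    growth-0 = trans (*-identityʳ _) ι1≡𝟙

    ∑-growth : ∀ a → ∑ (downFrom (suc a)) (λ b → β ↑ (u * b) ⊗ growth b) ⊑ growth a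
    ∑-growth zero = ⊑-reflexive (trans (+-identityʳ _) (trans (cong (λ i → β ↑ i ⊗ growth 0) (ℕ.*-zeroʳ u)) (*-identityˡ _)))
    ∑-growth (suc a) = ⊑-trans (⊕-monoʳ (∑-growth a)) (⊑-trans (⊑-reflexive (+-comm _ _)) (growth-suc a))

    F⊑growth : ∀ m a → F u m a ⊑ growth a
    F⊑growth zero a = ⊑-trans (⊑-reflexive (trans (F-zero u a) (sym growth-0))) (growth-mono {0} {a} z≤n)
    F⊑growth (suc m) a = begin
      F u (suc m) a                                                             ≡⟨ F-suc u m a ⟩
      ∑ (downFrom (suc M)) (λ b → when (b ≤ᵇ a) (β ↑ (u * b) ⊗ F u m b))        ⊑⟨ ∑-downFrom-below (suc M) a _ ⟩
      ∑ (downFrom (suc a)) (λ b → β ↑ (u * b) ⊗ F u m b)                        ⊑⟨ ∑-mono (downFrom (suc a)) (λ b → ⊗-monoʳ (F⊑growth m b)) ⟩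
      ∑ (downFrom (suc a)) (λ b → β ↑ (u * b) ⊗ growth b)                       ⊑⟨ ∑-growth a ⟩
      growth a ∎

    private
      block : ∀ j r → r < N → (j * N + r) / N ≡ j
      block j r r<N = trans (+-distrib-/-∣ˡ r (n∣m*n j)) (trans (cong₂ _+_ (m*n/n≡m j N) (m<n⇒m/n≡0 r<N)) (ℕ.+-identityʳ j))

      tail-block : ∀ j r → r ≤ N → tail (j * N + r) ≡ tail (j * N) ⊗ (𝟙 ⊕ ½ ↑ j) ↑ r
      tail-block j zero    _ = trans (cong tail (ℕ.+-identityʳ (j * N))) (sym (*-identityʳ _))
      tail-block j (suc r) h = trans (cong tail (ℕ.+-suc (j * N) r))
        (trans (cong₂ (λ t i → t ⊗ (𝟙 ⊕ ½ ↑ i)) (tail-block j r (ℕ.<⇒≤ h)) (block j r h))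
        (trans (*-assoc _ _ _) (cong (tail (j * N) ⊗_) (*-comm _ _))))

      tail-Π : ∀ j → tail (j * N) ≡ Π j ↑ N
      tail-Π zero    = sym (𝟙↑ N)
      tail-Π (suc j) = trans (cong tail (ℕ.+-comm N (j * N))) (trans (tail-block j N ≤-refl)
        (trans (cong (_⊗ (𝟙 ⊕ ½ ↑ j) ↑ N) (tail-Π j)) (sym (↑-⊗ (Π j) (𝟙 ⊕ ½ ↑ j) N))))

    -- Two bits per unit of N come from the central binomial coefficient and three from the tail,
    -- whose blocks of N equal factors form the N-th power of a product that is at most 8.
    growth-bound : ∀ k → growth k ⊑ 𝟚 ↑ (5 * N)
    growth-bound k = begin
      growth k                        ⊑⟨ growth-mono (≤-trans (≤-trans (≤-reflexive (sym (ℕ.*-identityʳ k))) (*-monoʳ-≤ k (s≤s z≤n))) (m≤n+m (k * N) N)) ⟩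
      growth (N + k * N)              ≡⟨ cong₂ (λ m i → ι (pascal N m) ⊗ tail i) (ℕ.m≥n⇒m⊓n≡n (m≤m+n N (k * N))) (ℕ.m+n∸m≡n N (k * N)) ⟩
      ι (pascal N N) ⊗ tail (k * N)   ≡⟨ cong (ι (pascal N N) ⊗_) (tail-Π k) ⟩
      ι (pascal N N) ⊗ Π k ↑ N        ⊑⟨ ⊗-mono (⊑-trans (ι-mono (pascal≤2^ N N)) (⊑-reflexive (ι-^ 2 (N + N)))) (↑-mono N (Π⊑8 k)) ⟩
      𝟚 ↑ (N + N) ⊗ (𝟚 ↑ 3) ↑ N       ≡⟨ trans (cong (𝟚 ↑ (N + N) ⊗_) (sym (↑-* 𝟚 N 3))) (sym (↑-+ 𝟚 (N + N) (N * 3))) ⟩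
      𝟚 ↑ (N + N + N * 3)             ≡⟨ cong (𝟚 ↑_) (ring N) ⟩
      𝟚 ↑ (5 * N) ∎
      where
      ring : ∀ N → N + N + N * 3 ≡ 5 * N
      ring = solve-∀

    F⁺⊑ : ∀ m → F⁺ u m ⊑ 𝟚 ↑ (5 * N)
    F⁺⊑ zero    = ⊑-trans (⊑-reflexive (F-zero u 0)) (𝟙⊑↑ (5 * N) 𝟙⊑𝟚)
    F⁺⊑ (suc m) = begin
      F⁺ u (suc m)                                              ≡⟨ F⁺-suc u m ⟩
      ∑ (downFrom (suc M)) (λ b → β ↑ (u * b) ⊗ F u m b)        ⊑⟨ ∑-mono (downFrom (suc M)) (λ b → ⊗-monoʳ (F⊑growth m b)) ⟩
      ∑ (downFrom (suc M)) (λ b → β ↑ (u * b) ⊗ growth b)       ⊑⟨ ∑-growth M ⟩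
      growth M                                                  ⊑⟨ growth-bound M ⟩
      𝟚 ↑ (5 * N) ∎

  planeLevel-bounded : ∀ l M m C G B → 5 ≤ C → Bounded (Chains.level⁺ (lineLevel M) m) (PowerWeight.weight l) C 1 G B
  planeLevel-bounded l M m C G B 5≤C {suc n} {zero} 0<N N≤B Nu≡L = contradiction (trans (sym (ℕ.*-zeroʳ n)) Nu≡L) λ ()
  planeLevel-bounded l M m C G B 5≤C {suc n} {suc u′} 0<N N≤B Nu≡L = ⊑-trans (Partitions.F⁺⊑ l n u′ Nu≡L M m)
    (𝟚↑-mono (≤-trans (*-mono-≤ 5≤C (m≤m+n (suc n) G)) (≤-reflexive (sym (ℕ.*-identityʳ _)))))

  -- Induction on the dimension

  levels : ℕ → ℕ → Level
  levels M zero    = lineLevel M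
  levels M (suc e) = Chains.level⁺ (levels M e) M

  -- Each dimension down doubles the range of N, so T leaves room for e doublings of B. G is the
  -- same in all dimensions; the requirement on it increases with e, so the highest dimension
  -- decides.
  levels-bounded : ∀ l M ℓ T G → M ≤ 2 ^ ℓ → (∀ N → 0 < N → N ≤ T → ∃ λ u → N * u ≡ suc l) →
                   ∀ e B → 2 ^ e * B ≤ T → 8 * (4 + 4 * e) * suc ((4 + 4 * e) * ℓ) ≤ G →
                   Bounded (levels M (suc e)) (PowerWeight.weight l) 41 (suc e) G B
  levels-bounded l M ℓ T G M≤ divisible zero B _ _ {N} {u} = planeLevel-bounded l M M 41 G B (s≤s (s≤s (s≤s (s≤s (s≤s z≤n))))) {N} {u}
  levels-bounded l M ℓ T G M≤ divisible (suc e) B B≤ G≥ {N} {u} =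
    level⁺-bounded (levels M (suc e)) (PowerWeight.weight l) 41 (suc e) G B (s≤s z≤n)
      (λ N 0<N N≤ → divisible N 0<N (≤-trans N≤ (≤-trans (ℕ.m≤n*m (2 * B) (2 ^ e) {{ℕ.m^n≢0 2 e}}) B≤′)))
      (λ {N} {u} → levels-bounded l M ℓ T G M≤ divisible e (2 * B) B≤′
        (≤-trans (*-mono-≤ (*-monoʳ-≤ 8 q≤) (s≤s (*-monoˡ-≤ ℓ q≤))) G≥) {N} {u})
      ((4 + 4 * suc e) * ℓ) M ≤-refl G≥ (enough-fuel (3 + 4 * suc e) ℓ M≤) {N} {u}
    where
    q≤ : 4 + 4 * e ≤ 4 + 4 * suc e
    q≤ = +-monoʳ-≤ 4 (*-monoʳ-≤ 4 (ℕ.n≤1+n e))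
    B≤′ : 2 ^ e * (2 * B) ≤ T
    B≤′ = ≤-trans (≤-reflexive (ring (2 ^ e) B)) B≤
      where
      ring : ∀ x b → x * (2 * b) ≡ 2 * x * b
      ring = solve-∀

  ∑-filter : ∀ {A : Set} {P : A → Set} (P? : ∀ x → Dec (P x)) (xs : List A) {f c} → (∀ {x} → P x → c ⊑ f x) →
             ι (length (filter P? xs)) ⊗ c ⊑ ∑ xs f
  ∑-filter P? []       {f} {c} h = ⊑-reflexive (zeroˡ c)
  ∑-filter P? (x ∷ xs) {f} {c} h with P? x
  ... | yes Px = ⊑-trans (⊑-reflexive (trans (distribʳ c 𝟙 _) (cong (_⊕ ι (length (filter P? xs)) ⊗ c) (*-identityˡ c)))) (⊕-mono (h Px) (∑-filter P? xs h))
  ... | no  _  = ⊑-trans (∑-filter P? xs h) x⊑y⊕x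

  -- With a common multiple as L, every unit L/N is an integer, so that each N gives an integral
  -- power of β.
  factorial-divisible : ∀ T → ∃ λ l → ∀ N → 0 < N → N ≤ T → ∃ λ u → N * u ≡ suc l
  factorial-divisible T = pred (T !) , λ { (suc N) 0<N N≤T → quotient-of N N≤T }
    where
    T!≡ : suc (pred (T !)) ≡ T !
    T!≡ = ℕ.suc-pred (T !) {{ℕ._!≢0 T}}
    quotient-of : ∀ N → suc N ≤ T → ∃ λ u → suc N * u ≡ suc (pred (T !))
    quotient-of N N≤T with ∣-trans (m∣m*n (N !)) (m≤n⇒m!∣n! N≤T)
    ... | divides k eq = k , trans (ℕ.*-comm (suc N) k) (trans (sym eq) (sym T!≡))

  -- Since u n ≤ k L, a state with at most n points has weight at least β^(kL), which is at least
  -- 4^(-k). The number of such states is therefore at most 4^k times the partition function.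
  states-count : ∀ e n N G ℓ (xs : List (Level.State (levels n (suc e)))) → 0 < N → n ≤ 2 ^ ℓ →
                 8 * (4 + 4 * e) * suc ((4 + 4 * e) * ℓ) ≤ G → Unique xs →
                 (∀ {x} → x ∈ xs → x ∈ Level.states (levels n (suc e)) × Level.size (levels n (suc e)) x ≤ n) →
                 ∀ k → n ≤ N * k → length xs ≤ 2 ^ (k * 2 + (41 * (N + G)) ^ suc e)
  states-count e n N G ℓ xs 0<N n≤ G≥ xs! xs⊆ k n≤Nk = ι-cancel-⊑ (begin
    ι (length xs)                                                ≡⟨ sym (*-identityʳ _) ⟩
    ι (length xs) ⊗ 𝟙                                            ⊑⟨ ⊗-mono (ι-mono (unique-⊆⇒length-≤ xs! (λ x∈ → let (x∈s , small) = xs⊆ x∈ in ∈-filter⁺ P? x∈s small))) (𝟙⊑4ᵏβᴸᵏ k) ⟩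
    ι (length ys) ⊗ (𝟚 ↑ (k * 2) ⊗ β ↑ (k * suc l))              ≡⟨ ⊗.x∙yz≈y∙xz _ _ _ ⟩
    𝟚 ↑ (k * 2) ⊗ (ι (length ys) ⊗ β ↑ (k * suc l))              ⊑⟨ ⊗-monoʳ (∑-filter P? states λ {x} small → ↑-anti β⊑𝟙 (light x small)) ⟩
    𝟚 ↑ (k * 2) ⊗ Drop.Z Λ weight u                              ⊑⟨ ⊗-monoʳ (levels-bounded l n ℓ (2 ^ e * N) G n≤ divisible e N ≤-refl G≥ 0<N ≤-refl Nu≡) ⟩
    𝟚 ↑ (k * 2) ⊗ 𝟚 ↑ ((41 * (N + G)) ^ suc e)                   ≡⟨ trans (sym (↑-+ 𝟚 (k * 2) _)) (sym (ι-^ 2 (k * 2 + (41 * (N + G)) ^ suc e))) ⟩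
    ι (2 ^ (k * 2 + (41 * (N + G)) ^ suc e)) ∎)
    where
    open ⊑-Reasoning
    Λ = levels n (suc e)
    open Level Λ using (states; size)
    l = proj₁ (factorial-divisible (2 ^ e * N))
    divisible = proj₂ (factorial-divisible (2 ^ e * N))
    open PowerWeight l
    unit = divisible N 0<N (ℕ.m≤n*m N (2 ^ e) {{ℕ.m^n≢0 2 e}})
    u = proj₁ unit
    Nu≡ : N * u ≡ suc l
    Nu≡ = proj₂ unit
    P? = λ x → size x ≤? n
    ys = filter P? states
    light : ∀ x → size x ≤ n → u * size x ≤ k * suc l
    light x small = ≤-trans (*-monoʳ-≤ u (≤-trans small n≤Nk)) (≤-reflexive (trans (ring u N k) (cong (k *_) Nu≡)))
      where
      ring : ∀ u N k → u * (N * k) ≡ k * (N * u)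
      ring = solve-∀

  -- Lower sets as states

  Subset : ℕ → Set
  Subset d = Vec ℕ d → Bool

  infix 4 _≤ᵥ_
  _≤ᵥ_ : ∀ {d} → Vec ℕ d → Vec ℕ d → Set
  _≤ᵥ_ {d} y x = ∀ (i : Fin d) → Vec.lookup y i ≤ Vec.lookup x i

  Lower : ∀ {d} → Subset d → Set
  Lower f = ∀ x y → y ≤ᵥ x → f x ≡ true → f y ≡ true

  slice : ∀ {d} → Subset (suc d) → ℕ → Subset d
  slice f j x = f (j ∷ x)

  slice-lower : ∀ {d} {f : Subset (suc d)} → Lower f → ∀ j → Lower (slice f j)
  slice-lower low j x y y≤x = low (j ∷ x) (j ∷ y) λ { Fin.zero → ≤-refl ; (Fin.suc i) → y≤x i }

  slice-decreasing : ∀ {d} {f : Subset (suc d)} → Lower f → ∀ j x → slice f (suc j) x ≡ true → slice f j x ≡ true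
  slice-decreasing low j x = low (suc j ∷ x) (j ∷ x) λ { Fin.zero → ℕ.n≤1+n j ; (Fin.suc i) → ≤-refl }

  module Encoding (M : ℕ) where

    pts : ∀ {d} → Subset d → List (Vec ℕ d)
    slicePts : ∀ {d} → Subset (suc d) → ℕ → ℕ → List (Vec ℕ (suc d))
    pts {zero}  f = if f [] then [] ∷ [] else []
    pts {suc d} f = slicePts f M 0
    slicePts f zero    j = []
    slicePts f (suc m) j = map (j ∷_) (pts (slice f j)) ++ slicePts f m (suc j)

    pts-sound : ∀ {d} (f : Subset d) {x} → x ∈ pts f → f x ≡ true
    slicePts-sound : ∀ {d} (f : Subset (suc d)) m j {x} → x ∈ slicePts f m j → f x ≡ true × j ≤ Vec.head x
    pts-sound {zero}  f x∈ with f [] in eq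
    pts-sound {zero}  f (here refl) | true = eq
    pts-sound {suc d} f x∈ = proj₁ (slicePts-sound f M 0 x∈)
    slicePts-sound f (suc m) j x∈ with ∈-++⁻ (map (j ∷_) (pts (slice f j))) x∈
    ... | inj₂ x∈′ = let (fx , j<) = slicePts-sound f m (suc j) x∈′ in fx , ℕ.<⇒≤ j<
    ... | inj₁ x∈′ with ∈-map⁻ (j ∷_) x∈′
    ...   | y , y∈ , refl = pts-sound (slice f j) y∈ , ≤-refl

    pts-complete : ∀ {d} (f : Subset d) x → (∀ i → Vec.lookup x i < M) → f x ≡ true → x ∈ pts f
    slicePts-complete : ∀ {d} (f : Subset (suc d)) m j i x → i < m → (∀ k → Vec.lookup x k < M) → f (j + i ∷ x) ≡ true → (j + i ∷ x) ∈ slicePts f m j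
    pts-complete {zero}  f []      _  fx rewrite fx = here refl
    pts-complete {suc d} f (a ∷ x) x< fx = slicePts-complete f M 0 a x (x< Fin.zero) (λ k → x< (Fin.suc k)) fx
    slicePts-complete f (suc m) j zero x _ x< fx rewrite ℕ.+-identityʳ j = ∈-++⁺ˡ (∈-map⁺ (j ∷_) (pts-complete (slice f j) x x< fx))
    slicePts-complete f (suc m) j (suc i) x (s≤s i<m) x< fx rewrite ℕ.+-suc j i = ∈-++⁺ʳ _ (slicePts-complete f m (suc j) i x i<m x< fx)

    pts! : ∀ {d} (f : Subset d) → Unique (pts f)
    slicePts! : ∀ {d} (f : Subset (suc d)) m j → Unique (slicePts f m j)
    pts! {zero} f with f []
    ... | true  = [] ∷ []
    ... | false = []
    pts! {suc d} f = slicePts! f M 0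
    slicePts! f zero    j = []
    slicePts! f (suc m) j = Unique.++⁺ (Unique.map⁺ (λ { refl → refl }) (pts! (slice f j))) (slicePts! f m (suc j)) disjoint
      where
      disjoint : ∀ {x} → ¬ (x ∈ map (j ∷_) (pts (slice f j)) × x ∈ slicePts f m (suc j))
      disjoint (x∈ , x∈′) with ∈-map⁻ (j ∷_) x∈
      ... | _ , _ , refl = ℕ.1+n≰n (proj₂ (slicePts-sound f m (suc j) x∈′))

    pts-mono : ∀ {d} {f g : Subset d} → (∀ {x} → f x ≡ true → g x ≡ true) → length (pts f) ≤ length (pts g)
    pts-mono {zero}  {f} {g} f⊆g with f [] in eq
    ... | false = z≤n
    ... | true rewrite f⊆g eq = ≤-refl
    pts-mono {suc d} {f} {g} f⊆g = go M 0
      where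
      go : ∀ m j → length (slicePts f m j) ≤ length (slicePts g m j)
      go zero    j = z≤n
      go (suc m) j = subst₂ _≤_ (sym (eq f)) (sym (eq g)) (ℕ.+-mono-≤ (pts-mono {f = slice f j} {slice g j} f⊆g) (go m (suc j)))
        where
        eq : ∀ h → length (slicePts h (suc m) j) ≡ length (pts (slice h j)) + length (slicePts h m (suc j))
        eq h = trans (length-++ (map (j ∷_) (pts (slice h j)))) (cong (_+ length (slicePts h m (suc j))) (length-map (j ∷_) (pts (slice h j))))

    layers : ∀ {A : Set} → (ℕ → A) → ∀ m → ℕ → Vec A m
    layers s zero    j = []
    layers s (suc m) j = s j ∷ layers s m (suc j)

    -- In dimension 1 a lower set is known by its number of points; above that, the first coordinate
    -- numbers the layers of the chain.
    encode : ∀ e → Subset (suc e) → Level.State (levels M e)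
    encode zero    f = length (pts f)
    encode (suc e) f = layers (λ j → encode e (slice f j)) M 0

    encode-mono : ∀ e {f g} → (∀ {x} → f x ≡ true → g x ≡ true) → Level._≼_ (levels M e) (encode e f) (encode e g) ≡ true
    encode-mono zero    {f} {g} f⊆g = ≤⇒true (pts-mono {f = f} {g} f⊆g)
    encode-mono (suc e) {f} {g} f⊆g = go M 0
      where
      open Chains (levels M e)
      go : ∀ m j → (layers (λ j → encode e (slice f j)) m j ≼ᵛ layers (λ j → encode e (slice g j)) m j) ≡ true
      go zero    j = refl
      go (suc m) j = cong₂ _∧_ (encode-mono e {slice f j} {slice g j} f⊆g) (go m (suc j))

    encode∈states : ∀ e {f} → Lower f → encode e f ∈ Level.states (levels M e)
    encode∈states zero    {f} low = ∈-downFrom⁺ (s≤s (go M 0))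
      where
      one : ∀ (g : Subset 0) → length (pts g) ≤ 1
      one g with g []
      ... | true  = ≤-refl
      ... | false = z≤n
      go : ∀ m j → length (slicePts f m j) ≤ m
      go zero    j = z≤n
      go (suc m) j = ≤-trans (≤-reflexive (trans (length-++ (map (j ∷_) (pts (slice f j)))) (cong (_+ length (slicePts f m (suc j))) (length-map (j ∷_) (pts (slice f j))))))
        (ℕ.+-mono-≤ (one (slice f j)) (go m (suc j)))
    encode∈states (suc e) {f} low = start M
      where
      open Chains (levels M e)
      s : ℕ → State
      s j = encode e (slice f j)
      s∈ : ∀ j → s j ∈ states
      s∈ j = encode∈states e (slice-lower low j)
      go : ∀ m j → layers s m (suc j) ∈ chains m (s j)
      go zero    j = here refl
      go (suc m) j = ∈-chains (s∈ (suc j)) (encode-mono e {slice f (suc j)} {slice f j} (λ {x} → slice-decreasing low j x)) (go m (suc j))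
      start : ∀ m → layers s m 0 ∈ chains⁺ m
      start zero    = here refl
      start (suc m) = ∈-chains⁺ (s∈ 0) (go m 0)

    size-encode : ∀ e f → Level.size (levels M e) (encode e f) ≡ length (pts f)
    size-encode zero    f = refl
    size-encode (suc e) f = go M 0
      where
      open Chains (levels M e)
      go : ∀ m j → sizes (layers (λ j → encode e (slice f j)) m j) ≡ length (slicePts f m j)
      go zero    j = refl
      go (suc m) j = trans (cong₂ _+_ (trans (size-encode e (slice f j)) (sym (length-map (j ∷_) (pts (slice f j))))) (go m (suc j)))
        (sym (length-++ (map (j ∷_) (pts (slice f j)))))

    -- Where f has become false it stays false, so the points from j on form an initial segment, and
    -- its length decides membership.
    line-value : ∀ {f : Subset 1} → Lower f → ∀ m j i → i < m → f (j + i ∷ []) ≡ (i <ᵇ length (slicePts f m j))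
    line-value {f} low (suc m) j i i<m with f (j ∷ []) in fj
    line-value {f} low (suc m) j zero    i<m | true  = trans (cong (λ k → f (k ∷ [])) (ℕ.+-identityʳ j)) fj
    line-value {f} low (suc m) j (suc i) (s≤s i<m) | true = trans (cong (λ k → f (k ∷ [])) (ℕ.+-suc j i)) (line-value low m (suc j) i i<m)
    line-value {f} low (suc m) j i i<m | false = trans (none j i fj) (sym (cong (λ xs → i <ᵇ length xs) (empty m (suc j) (subst (λ k → f (k ∷ []) ≡ false) (ℕ.+-comm j 1) (none j 1 fj)))))
      where
      none : ∀ j i → f (j ∷ []) ≡ false → f (j + i ∷ []) ≡ false
      none j i fj with f (j + i ∷ []) in eq
      ... | false = refl
      ... | true  = contradiction (trans (sym fj) (low (j + i ∷ []) (j ∷ []) (λ { Fin.zero → ℕ.m≤m+n j i }) eq)) λ ()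
      empty : ∀ m j → f (j ∷ []) ≡ false → slicePts f m j ≡ []
      empty zero    j fj = refl
      empty (suc m) j fj rewrite fj = empty m (suc j) (subst (λ k → f (k ∷ []) ≡ false) (ℕ.+-comm j 1) (none j 1 fj))

    encode-injective : ∀ e {f g} → Lower f → Lower g → encode e f ≡ encode e g →
                       ∀ x → (∀ i → Vec.lookup x i < M) → f x ≡ g x
    encode-injective zero    lowf lowg eq (a ∷ []) x< =
      trans (line-value lowf M 0 a (x< Fin.zero)) (trans (cong (a <ᵇ_) eq) (sym (line-value lowg M 0 a (x< Fin.zero))))
    encode-injective (suc e) {f} {g} lowf lowg eq (a ∷ x) x< =
      encode-injective e (slice-lower lowf a) (slice-lower lowg a) (go M 0 a (x< Fin.zero) eq) x (λ i → x< (Fin.suc i))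
      where
      go : ∀ m j i → i < m → layers (λ j → encode e (slice f j)) m j ≡ layers (λ j → encode e (slice g j)) m j →
           encode e (slice f (j + i)) ≡ encode e (slice g (j + i))
      go (suc m) j zero    _         eq rewrite ℕ.+-identityʳ j = cong Vec.head eq
      go (suc m) j (suc i) (s≤s i<m) eq rewrite ℕ.+-suc j i = go m (suc j) i i<m (cong Vec.tail eq)

  module _ {e n : ℕ} where
    open Encoding n
    open LowerSet

    -- The predicate `points` carries no decision procedure, but membership in the list of its
    -- elements is decidable.
    indicator : LowerSet (suc e) n → Subset (suc e)
    indicator S x = does (x ∈? elements S)

    indicator⁺ : ∀ S {x} → points S x → indicator S x ≡ true
    indicator⁺ S {x} x∈S = dec-true (x ∈? elements S) (points⇒elements S x∈S)

    indicator⁻ : ∀ S {x} → indicator S x ≡ true → x ∈ elements S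
    indicator⁻ S {x} eq with x ∈? elements S
    ... | yes x∈ = x∈

    indicator-lower : ∀ S → Lower (indicator S)
    indicator-lower S x y y≤x eq = indicator⁺ S (isLower S (elements⇒points S (indicator⁻ S eq)) y≤x)

    code : LowerSet (suc e) n → Level.State (levels n e)
    code S = encode e (indicator S)

    code-reflects : ∀ S T → code S ≡ code T → ∀ {x} → points S x → points T x
    code-reflects S T eq {x} x∈S = elements⇒points T (indicator⁻ T (trans (sym
      (encode-injective e (indicator-lower S) (indicator-lower T) eq x (coordinate<size S x∈S))) (indicator⁺ S x∈S)))

    size-code : ∀ S → Level.size (levels n e) (code S) ≤ n
    size-code S = ≤-trans (≤-reflexive (size-encode e (indicator S)))
      (≤-trans (unique-⊆⇒length-≤ (pts! (indicator S)) (λ x∈ → indicator⁻ S (pts-sound (indicator S) x∈)))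
        (≤-reflexive (proj₁ (proj₂ (proj₂ (size S))))))

  -- In a lower set with n points all coordinates are below n, so the box of side n loses nothing
  -- and different lower sets have different codes.
  p-upper : ∀ e n N G ℓ k → 0 < N → n ≤ 2 ^ ℓ → 8 * (4 + 4 * e) * suc ((4 + 4 * e) * ℓ) ≤ G → n ≤ N * k →
            p (2 + e) n ≤ 2 ^ (k * 2 + (41 * (N + G)) ^ suc e)
  p-upper e n N G ℓ k 0<N n≤ G≥ n≤Nk = subst (_≤ 2 ^ (k * 2 + (41 * (N + G)) ^ suc e)) (length-map code sets)
    (states-count e n N G ℓ (map code sets) 0<N n≤ G≥ codes! member k n≤Nk)
    where
    sets = allLowerSets (2 + e) n
    codes! : Unique (map code sets)
    codes! = AllPairs.map⁺ (AllPairs.map (λ {S} {T} S≢T eq → S≢T ((λ {x} → code-reflects S T eq {x}) , (λ {x} → code-reflects T S (sym eq) {x})))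
      (UniqueDec.deduplicate-! (lowerSets? (2 + e) n) (concatMap fromList (lists (box (2 + e) n) n))))
    member : ∀ {x} → x ∈ map code sets → x ∈ Level.states (levels n (suc e)) × Level.size (levels n (suc e)) x ≤ n
    member x∈ with ∈-map⁻ code x∈
    ... | S , _ , refl = Encoding.encode∈states n (suc e) (indicator-lower S) , size-code S

-- Rational and real bounds

open import Algebra.Properties.Semiring.Exp (CommutativeRing.semiring ℚ.+-*-commutativeRing) using () renaming (_^_ to _^ℚ_)
open import Defs using (ℝ; fromℕ; _<ʳ_; log; _^[_/_]; ^[/]-positive; _÷_⟨_⟩; module Division; L<U; lowerSum; upperSum; ∑1/; ∑-split; ∑-upper; refine-lower; 1/1+; 0≤1/1+; suc*p; suc*1/1+; ℕ*1/1+; ℕ→ℚ; ℕ→ℚ-suc; 0≤ℕ→ℚ; frac-mono-≤; frac-mono-<)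
open ℝ using (L; U; U-inhabited)

ℕ→ℚ-mono-≤ : ∀ {a b} → a ≤ b → ℕ→ℚ a ℚ.≤ ℕ→ℚ b
ℕ→ℚ-mono-≤ {a} {b} h = frac-mono-≤ {a} {0} {b} {0} (ℕ.*-monoˡ-≤ 1 h)

ℕ→ℚ-mono-< : ∀ {a b} → a < b → ℕ→ℚ a ℚ.< ℕ→ℚ b
ℕ→ℚ-mono-< {a} {b} h = frac-mono-< {a} {0} {b} {0} (ℕ.*-monoˡ-< 1 h)

ℕ→ℚ-+ : ∀ a b → ℕ→ℚ (a + b) ≡ ℕ→ℚ a ℚ.+ ℕ→ℚ b
ℕ→ℚ-+ zero    b = sym (ℚ.+-identityˡ (ℕ→ℚ b))
ℕ→ℚ-+ (suc a) b = trans (ℕ→ℚ-suc (a + b)) (trans (cong (1ℚ ℚ.+_) (ℕ→ℚ-+ a b))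
  (trans (sym (ℚ.+-assoc 1ℚ (ℕ→ℚ a) (ℕ→ℚ b))) (cong (ℚ._+ ℕ→ℚ b) (sym (ℕ→ℚ-suc a)))))

ℕ→ℚ-* : ∀ a b → ℕ→ℚ (a * b) ≡ ℕ→ℚ a ℚ.* ℕ→ℚ b
ℕ→ℚ-* zero    b = sym (ℚ.*-zeroˡ (ℕ→ℚ b))
ℕ→ℚ-* (suc a) b = trans (ℕ→ℚ-+ b (a * b)) (trans (cong (ℕ→ℚ b ℚ.+_) (ℕ→ℚ-* a b)) (sym (suc*p a (ℕ→ℚ b))))

ℕ→ℚ-^ : ∀ a b → ℕ→ℚ (a ^ b) ≡ ℕ→ℚ a ^ℚ b
ℕ→ℚ-^ a zero    = refl
ℕ→ℚ-^ a (suc b) = trans (ℕ→ℚ-* a (a ^ b)) (cong (ℕ→ℚ a ℚ.*_) (ℕ→ℚ-^ a b))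

suc*1/1+≡1 : ∀ n → ℕ→ℚ (suc n) ℚ.* 1/1+ n ≡ 1ℚ
suc*1/1+≡1 n = subst (λ m → ℕ→ℚ (suc n) ℚ.* 1/1+ m ≡ 1ℚ) (ℕ.+-identityʳ n) (suc*1/1+ n 0)

-- The proof of nonnegativity is irrelevant, so equality of values is equality, and the semiring
-- laws hold for `_≡_`. It can be recovered by `recompute` because the order is decidable.
record ℚ₊ : Set where
  constructor _,_
  field
    value     : ℚ
    .nonNeg   : 0ℚ ℚ.≤ value
open ℚ₊

≡₊ : ∀ {x y} → value x ≡ value y → x ≡ y
≡₊ {_ , _} {_ , _} refl = refl

*-mono-≤-nonNeg : ∀ {a b c d} → 0ℚ ℚ.≤ a → 0ℚ ℚ.≤ d → a ℚ.≤ b → c ℚ.≤ d → a ℚ.* c ℚ.≤ b ℚ.* d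
*-mono-≤-nonNeg {a} {b} {c} {d} 0≤a 0≤d a≤b c≤d = ℚ.≤-trans (ℚ.*-monoˡ-≤-nonNeg a {{ℚ.nonNegative 0≤a}} c≤d)
  (ℚ.*-monoʳ-≤-nonNeg d {{ℚ.nonNegative 0≤d}} a≤b)

ℚ₊-semifield : Semifield⁺
ℚ₊-semifield = record
  { Carrier = ℚ₊
  ; _⊕_ = _+₊_
  ; _⊗_ = _*₊_
  ; 𝟘 = 0₊
  ; 𝟙 = 1₊
  ; _⊑_ = λ x y → value x ℚ.≤ value y
  ; isCommutativeSemiring = record
    { isSemiring = record
      { isSemiringWithoutAnnihilatingZero = record
        { +-isCommutativeMonoid = record
          { isMonoid = record
            { isSemigroup = record
              { isMagma = record { isEquivalence = isEquivalence ; ∙-cong = cong₂ _+₊_ }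
              ; assoc = λ x y z → ≡₊ (ℚ.+-assoc (value x) (value y) (value z)) }
            ; identity = (λ x → ≡₊ (ℚ.+-identityˡ (value x))) , (λ x → ≡₊ (ℚ.+-identityʳ (value x))) }
          ; comm = λ x y → ≡₊ (ℚ.+-comm (value x) (value y)) }
        ; *-cong = cong₂ _*₊_
        ; *-assoc = λ x y z → ≡₊ (ℚ.*-assoc (value x) (value y) (value z))
        ; *-identity = (λ x → ≡₊ (ℚ.*-identityˡ (value x))) , (λ x → ≡₊ (ℚ.*-identityʳ (value x)))
        ; distrib = (λ x y z → ≡₊ (ℚ.*-distribˡ-+ (value x) (value y) (value z)))
                  , (λ x y z → ≡₊ (ℚ.*-distribʳ-+ (value x) (value y) (value z))) }
      ; zero = (λ x → ≡₊ (ℚ.*-zeroˡ (value x))) , (λ x → ≡₊ (ℚ.*-zeroʳ (value x))) }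
    ; *-comm = λ x y → ≡₊ (ℚ.*-comm (value x) (value y)) }
  ; ⊑-refl = ℚ.≤-refl
  ; ⊑-trans = ℚ.≤-trans
  ; 𝟘⊑ = λ {x} → 0≤value x
  ; ⊕-mono = ℚ.+-mono-≤
  ; ⊗-mono = λ {x} {y} {u} {v} → *-mono-≤-nonNeg (0≤value x) (0≤value v)
  ; recip = λ n → 1/1+ n , 0≤1/1+ n
  ; ι⊗recip = λ n → ≡₊ (trans (cong (ℚ._* 1/1+ n) (value-multiple (suc n))) (suc*1/1+≡1 n))
  ; ι-cancel-⊑ = λ {m} {n} p → cancel m n (subst₂ ℚ._≤_ (value-multiple m) (value-multiple n) p)
  }
  where
  0≤value : ∀ x → 0ℚ ℚ.≤ value x
  0≤value (v , 0≤v) = recompute (0ℚ ℚ.≤? v) 0≤v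
  0₊ 1₊ : ℚ₊
  0₊ = 0ℚ , ℚ.≤-refl
  1₊ = 1ℚ , ℚ.<⇒≤ (ℚ.positive⁻¹ 1ℚ)
  _+₊_ _*₊_ : ℚ₊ → ℚ₊ → ℚ₊
  x +₊ y = (value x ℚ.+ value y) , ℚ.+-mono-≤ (0≤value x) (0≤value y)
  x *₊ y = (value x ℚ.* value y) , *-mono-≤-nonNeg ℚ.≤-refl (0≤value y) (0≤value x) (0≤value y)
  value-multiple : ∀ n → value (multiple _+₊_ 0₊ 1₊ n) ≡ ℕ→ℚ n
  value-multiple zero    = refl
  value-multiple (suc n) = trans (cong (1ℚ ℚ.+_) (value-multiple n)) (sym (ℕ→ℚ-suc n))
  cancel : ∀ m n → ℕ→ℚ m ℚ.≤ ℕ→ℚ n → m ≤ n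
  cancel m n p = ℕ.≮⇒≥ λ n<m → ℚ.<-irrefl refl (ℚ.<-≤-trans (ℕ→ℚ-mono-< n<m) p)

-- Bounds for the logarithm and for the quotient

0≤∑1/ : ∀ k l → 0ℚ ℚ.≤ ∑1/ k l
0≤∑1/ k zero    = ℚ.≤-refl
0≤∑1/ k (suc l) = ℚ.+-mono-≤ (0≤1/1+ k) (0≤∑1/ (suc k) l)

∑1/-mono : ∀ k {l m} → l ≤ m → ∑1/ k l ℚ.≤ ∑1/ k m
∑1/-mono k {l} {m} l≤m = subst₂ ℚ._≤_ (ℚ.+-identityʳ (∑1/ k l))
  (trans (sym (∑-split k l (m ∸ l))) (cong (∑1/ k) (ℕ.m+[n∸m]≡n l≤m)))
  (ℚ.+-monoʳ-≤ (∑1/ k l) (0≤∑1/ (k + l) (m ∸ l)))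

suc-pred-^ : ∀ b e .{{_ : NonZero b}} → suc (pred (b ^ e)) ≡ b ^ e
suc-pred-^ b e = ℕ.suc-pred (b ^ e) {{ℕ.m^n≢0 b e}}

-- The 2^e terms from 1/2^e to 1/(2^(e+1) - 1) add up to at most 1. These are the upper Riemann sums
-- of mesh 1.
harmonic-≤ : ∀ e → ∑1/ 0 (pred (2 ^ e)) ℚ.≤ ℕ→ℚ e
harmonic-≤ zero    = ℚ.≤-refl
harmonic-≤ (suc e) = begin
  ∑1/ 0 (pred (2 ^ suc e))           ≡⟨ cong (∑1/ 0) split ⟩
  ∑1/ 0 (a + suc a)                  ≡⟨ ∑-split 0 a (suc a) ⟩
  ∑1/ 0 a ℚ.+ ∑1/ a (suc a)          ≤⟨ ℚ.+-mono-≤ (harmonic-≤ e) (∑-upper a (suc a) a ℕ.≤-refl) ⟩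
  ℕ→ℚ e ℚ.+ ℕ→ℚ (suc a) ℚ.* 1/1+ a   ≡⟨ cong (ℕ→ℚ e ℚ.+_) (suc*1/1+≡1 a) ⟩
  ℕ→ℚ e ℚ.+ 1ℚ                       ≡⟨ trans (ℚ.+-comm (ℕ→ℚ e) 1ℚ) (sym (ℕ→ℚ-suc e)) ⟩
  ℕ→ℚ (suc e) ∎
  where
  open ℚ.≤-Reasoning
  a = pred (2 ^ e)
  split : pred (2 ^ suc e) ≡ a + suc a
  split = cong pred (trans (cong (λ x → 2 * x) (sym (suc-pred-^ 2 e))) (cong (suc a +_) (ℕ.+-identityʳ (suc a))))

log-≤ : ∀ {m e} → m ≤ 2 ^ e → U (log m) (ℕ→ℚ (suc e))
log-≤ {m} {e} m≤ = upperSum m 0 , ℚ.≤-<-trans (ℚ.≤-trans (∑1/-mono 0 len) (harmonic-≤ e)) (ℕ→ℚ-mono-< (ℕ.n<1+n e)) , 0 , refl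
  where
  len : (m ∸ 1) * 1 ≤ pred (2 ^ e)
  len = ℕ.≤-trans (ℕ.≤-reflexive (ℕ.*-identityʳ (m ∸ 1))) (ℕ.≤-trans (ℕ.∸-monoˡ-≤ 1 m≤) (ℕ.≤-reflexive (ℕ.pred[m∸n]≡m∸[1+n] (2 ^ e) 0)))

-- ∑_{i=11}^{30} 1/i, a lower Riemann sum for log 3
log3 : ℚ
log3 = ∑1/ 10 20

log3-≥ : ℕ→ℚ 53 ℚ.≤ ℕ→ℚ 50 ℚ.* log3
log3-≥ = toWitness {a? = ℕ→ℚ 53 ℚ.≤? ℕ→ℚ 50 ℚ.* log3} _

-- The integral of 1/t is invariant under scaling: stretching the twenty cells of [1, 3] by 3^e and
-- cutting them back to mesh 1/10 can only raise the lower sum.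
lowerSum-3^ : ∀ e → ℕ→ℚ e ℚ.* log3 ℚ.≤ ∑1/ 10 (pred (3 ^ e) * 10)
lowerSum-3^ zero    = ℚ.≤-reflexive (ℚ.*-zeroˡ log3)
lowerSum-3^ (suc e) = begin
  ℕ→ℚ (suc e) ℚ.* log3                                  ≡⟨ trans (suc*p e log3) (ℚ.+-comm log3 (ℕ→ℚ e ℚ.* log3)) ⟩
  ℕ→ℚ e ℚ.* log3 ℚ.+ log3                               ≤⟨ ℚ.+-mono-≤ (lowerSum-3^ e) (refine-lower 10 a 20) ⟩
  ∑1/ 10 (a * 10) ℚ.+ ∑1/ (10 * suc a) (20 * suc a)     ≡⟨ cong (λ k → ∑1/ 10 (a * 10) ℚ.+ ∑1/ k (20 * suc a)) (ℕ.*-comm 10 (suc a)) ⟩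
  ∑1/ 10 (a * 10) ℚ.+ ∑1/ (10 + a * 10) (20 * suc a)    ≡⟨ sym (∑-split 10 (a * 10) (20 * suc a)) ⟩
  ∑1/ 10 (a * 10 + 20 * suc a)                          ≡⟨ cong (∑1/ 10) (sym split) ⟩
  ∑1/ 10 (pred (3 ^ suc e) * 10) ∎
  where
  open ℚ.≤-Reasoning
  a = pred (3 ^ e)
  ring : ∀ a → (a + (suc a + (suc a + 0))) * 10 ≡ a * 10 + 20 * suc a
  ring = solve-∀
  split : pred (3 ^ suc e) * 10 ≡ a * 10 + 20 * suc a
  split = trans (cong (λ x → pred (3 * x) * 10) (sym (suc-pred-^ 3 e))) (ring a)

log-≥ : ∀ {m e t} → 3 ^ e ≤ m → 50 * t < 53 * e → L (log m) (ℕ→ℚ t)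
log-≥ {m} {e} {t} 3^e≤m h = lowerSum m 9 , ℚ.<-≤-trans small (ℚ.≤-trans (lowerSum-3^ e) (∑1/-mono 10 len)) , 9 , refl
  where
  len : pred (3 ^ e) * 10 ≤ (m ∸ 1) * 10
  len = ℕ.*-monoˡ-≤ 10 (ℕ.≤-trans (ℕ.≤-reflexive (sym (ℕ.pred[m∸n]≡m∸[1+n] (3 ^ e) 0))) (ℕ.∸-monoˡ-≤ 1 3^e≤m))
  small : ℕ→ℚ t ℚ.< ℕ→ℚ e ℚ.* log3
  small = ℚ.*-cancelˡ-<-nonNeg (ℕ→ℚ 50) (begin-strict
    ℕ→ℚ 50 ℚ.* ℕ→ℚ t              ≡⟨ sym (ℕ→ℚ-* 50 t) ⟩
    ℕ→ℚ (50 * t)                  <⟨ ℕ→ℚ-mono-< h ⟩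
    ℕ→ℚ (53 * e)                  ≡⟨ trans (cong ℕ→ℚ (ℕ.*-comm 53 e)) (ℕ→ℚ-* e 53) ⟩
    ℕ→ℚ e ℚ.* ℕ→ℚ 53              ≤⟨ ℚ.*-monoˡ-≤-nonNeg (ℕ→ℚ e) {{ℚ.nonNegative (0≤ℕ→ℚ e)}} log3-≥ ⟩
    ℕ→ℚ e ℚ.* (ℕ→ℚ 50 ℚ.* log3)   ≡⟨ trans (sym (ℚ.*-assoc (ℕ→ℚ e) (ℕ→ℚ 50) log3)) (trans (cong (ℚ._* log3) (ℚ.*-comm (ℕ→ℚ e) (ℕ→ℚ 50))) (ℚ.*-assoc (ℕ→ℚ 50) (ℕ→ℚ e) log3)) ⟩
    ℕ→ℚ 50 ℚ.* (ℕ→ℚ e ℚ.* log3) ∎)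
    where open ℚ.≤-Reasoning

-- The order of cuts asks for a separating rational, and membership in a cut for a strict neighbour;
-- 7000 < 7100 < 7200 leaves room for both. Likewise `suc t` in the hypothesis puts t strictly below
-- the power.
ratio-< : ∀ n a b m .{{_ : NonZero b}} (0<y : fromℕ 0 <ʳ n ^[ a / b ]) {e t} → m ≤ 2 ^ e → suc t ^ b ≤ n ^ a → 0 < t → suc e ≤ 7000 * t →
          log m ÷ n ^[ a / b ] ⟨ 0<y ⟩ <ʳ fromℕ 7200
ratio-< n a b m 0<y {e} {t} m≤ root 0<t h = ℕ→ℚ 7100 , (ℕ→ℚ 7000 , ℕ→ℚ-mono-< (toWitness {a? = 7000 ℕ.<? 7100} _) , ℕ→ℚ (suc e) , ℕ→ℚ t , d ,
    log-≤ {m} {e} m≤ , Lt , Ud , ℕ→ℚ-mono-< 0<t , bound ℚ.≤-refl , bound (ℚ.<⇒≤ (L<U y Lt Ud)))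
  , ℕ→ℚ 7200 , ℕ→ℚ-mono-< (toWitness {a? = 7100 ℕ.<? 7200} _) , refl
  where
  y = n ^[ a / b ]
  d = proj₁ (U-inhabited y)
  Ud = proj₂ (U-inhabited y)
  Lt : L y (ℕ→ℚ t)
  Lt = ℕ→ℚ (suc t) , ℕ→ℚ-mono-< (ℕ.n<1+n t) , 0≤ℕ→ℚ (suc t) , subst (ℚ._≤ ℕ→ℚ (n ^ a)) (ℕ→ℚ-^ (suc t) b) (ℕ→ℚ-mono-≤ root)
  bound : ∀ {d} → ℕ→ℚ t ℚ.≤ d → ℕ→ℚ (suc e) ℚ.≤ ℕ→ℚ 7000 ℚ.* d
  bound t≤d = ℚ.≤-trans (ℚ.≤-trans (ℕ→ℚ-mono-≤ h) (ℚ.≤-reflexive (ℕ→ℚ-* 7000 t))) (ℚ.*-monoˡ-≤-nonNeg (ℕ→ℚ 7000) t≤d)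

ratio-> : ∀ n a b m .{{_ : NonZero b}} (0<y : fromℕ 0 <ʳ n ^[ a / b ]) {e t} → 3 ^ e ≤ m → n ^ a ≤ t ^ b → 50 * (2 + t) < 53 * e →
          fromℕ 1 <ʳ log m ÷ n ^[ a / b ] ⟨ 0<y ⟩
ratio-> n a b m 0<y {e} {t} 3^e≤m root h = proj₁ between , (1ℚ , proj₁ (proj₂ between) , refl) , s , proj₂ (proj₂ between) ,
    ℕ→ℚ (2 + t) , c₀ , ℕ→ℚ (suc t) , log-≥ {m} {e} {2 + t} 3^e≤m h , Lc₀ , Ut , 0<c₀ ,
    ℚ.≤-trans (ℚ.*-monoˡ-≤-nonNeg s {{ℚ.nonNegative (ℚ.<⇒≤ (ℚ.<-trans (ℚ.positive⁻¹ 1ℚ) 1<s))}} (ℚ.<⇒≤ (L<U y Lc₀ Ut))) (ℚ.≤-reflexive s*) , ℚ.≤-reflexive s*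
  where
  y = n ^[ a / b ]
  open Division (log m) y 0<y using (c₀; 0<c₀; Lc₀)
  s : ℚ
  -- The logarithm lies above t + 2 and the power below t + 1, so (t + 2)/(t + 1) bounds the ratio
  -- from below, and it exceeds 1.
  s = ℕ→ℚ (2 + t) ℚ.* 1/1+ t
  1<s : 1ℚ ℚ.< s
  1<s = subst (1ℚ ℚ.<_) (sym (ℕ*1/1+ (2 + t) t)) (frac-mono-< {1} {0} {2 + t} {t} (ℕ.≤-reflexive (trans (cong suc (ℕ.*-identityˡ (suc t))) (sym (ℕ.*-identityʳ (2 + t))))))
  between = ℚ.<-dense 1<s
  s* : s ℚ.* ℕ→ℚ (suc t) ≡ ℕ→ℚ (2 + t)
  s* = trans (ℚ.*-assoc (ℕ→ℚ (2 + t)) (1/1+ t) (ℕ→ℚ (suc t)))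
    (trans (cong (ℕ→ℚ (2 + t) ℚ.*_) (trans (ℚ.*-comm (1/1+ t) (ℕ→ℚ (suc t))) (suc*1/1+≡1 t))) (ℚ.*-identityʳ _))
  Ut : U y (ℕ→ℚ (suc t))
  Ut = ℕ→ℚ t , ℕ→ℚ-mono-< (ℕ.n<1+n t) , 0≤ℕ→ℚ t , subst (ℕ→ℚ (n ^ a) ℚ.≤_) (ℕ→ℚ-^ t b) (ℕ→ℚ-mono-≤ root)

-- Upper bound

open WeightedCounting ℚ₊-semifield using (p-upper)

p≤2^ : ∀ d {n r} → 2 ≤ d → (30 * d) ^ (2 * d) ≤ r → n < suc r ^ d → p d n ≤ 2 ^ (657 * r ^ (d ∸ 1))
p≤2^ d@(suc (suc e)) {n} {r} 2≤d large n< = ≤-trans (p-upper e n N G ℓ k 0<N n≤2^ℓ ≤-refl n≤Nk) (^-monoʳ-≤ 2 total)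
  where
  open ℕ.≤-Reasoning
  lb = log-bound 2≤d large
  s = proj₁ lb
  -- 82 = 2 * 41: together with G ≤ N this gives 41 (N + G) ≤ r.
  N = r / 82
  ℓ = 4 * suc s * d
  G = 8 * (4 + 4 * e) * suc ((4 + 4 * e) * ℓ)
  -- From n ≤ 2 r^d and r ≤ 164 N, with 328 = 2 * 164. The total is then 2 * 328 + 1 = 657 times
  -- r^(d-1).
  k = 328 * r ^ suc e
  big : 54000 * (d ^ 3 * suc s) ≤ r
  big = proj₂ (proj₂ lb)
  n≤2^ℓ : n ≤ 2 ^ ℓ
  n≤2^ℓ = begin
    n                         ≤⟨ ℕ.<⇒≤ n< ⟩
    suc r ^ d                 ≤⟨ ^-monoˡ-≤ d (proj₁ (proj₂ lb)) ⟩
    (2 ^ (4 * suc s)) ^ d     ≡⟨ ℕ.^-*-assoc 2 (4 * suc s) d ⟩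
    2 ^ ℓ ∎
  -- 82 G ≤ 82 · 32 d (16 d² (s+1) + 1) ≤ 54000 d³ (s+1)
  82G≤r : 82 * G ≤ r
  82G≤r = begin
    82 * G                                ≤⟨ *-monoʳ-≤ 82 (*-mono-≤ (*-monoʳ-≤ 8 q≤) (s≤s (*-monoˡ-≤ ℓ q≤))) ⟩
    82 * (8 * (4 * d) * suc (4 * d * ℓ))  ≡⟨ ring₁ 82 8 4 d (suc s) ⟩
    41984 * (d ^ 3 * suc s) + 2624 * (d * 1)    ≤⟨ +-monoʳ-≤ (41984 * (d ^ 3 * suc s)) (*-mono-≤ (toWitness {a? = 2624 ≤? 12016} _) (*-monoʳ-≤ d (*-mono-≤ (s≤s (z≤n {suc e})) (*-mono-≤ (s≤s (z≤n {suc e})) (s≤s (z≤n {s})))))) ⟩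
    41984 * (d ^ 3 * suc s) + 12016 * (d * (d * (d * suc s)))   ≡⟨ ring₂ 41984 12016 d (suc s) ⟩
    54000 * (d ^ 3 * suc s)               ≤⟨ big ⟩
    r ∎
    where
    q≤ : 4 + 4 * e ≤ 4 * d
    q≤ = ≤-trans (m≤n+m (4 + 4 * e) 4) (≤-reflexive (ring e))
      where
      ring : ∀ e → 4 + (4 + 4 * e) ≡ 4 * (2 + e)
      ring = solve-∀
    ring₁ : ∀ a b c d s → a * (b * (c * d) * suc (c * d * (c * s * d))) ≡ a * b * c * c * c * ((d * (d * (d * 1))) * s) + a * b * c * (d * 1)
    ring₁ = solve-∀
    ring₂ : ∀ a b d s → a * ((d * (d * (d * 1))) * s) + b * (d * (d * (d * s))) ≡ (a + b) * ((d * (d * (d * 1))) * s)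
    ring₂ = solve-∀
  r≡ : r ≡ r % 82 + N * 82
  r≡ = m≡m%n+[m/n]*n r 82
  G≤N : G ≤ N
  G≤N = ℕ.≤-pred (ℕ.*-cancelˡ-< 82 G (suc N) (begin-strict
    82 * G           ≤⟨ 82G≤r ⟩
    r                ≡⟨ r≡ ⟩
    r % 82 + N * 82  <⟨ ℕ.+-monoˡ-< (N * 82) (m%n<n r 82) ⟩
    82 + N * 82      ≡⟨ ℕ.*-comm (suc N) 82 ⟩
    82 * suc N ∎))
  0<N : 0 < N
  0<N = ≤-trans (s≤s z≤n) G≤N
  41[N+G]≤r : 41 * (N + G) ≤ r
  41[N+G]≤r = begin
    41 * (N + G)  ≤⟨ *-monoʳ-≤ 41 (+-monoʳ-≤ N G≤N) ⟩
    41 * (N + N)  ≡⟨ ring N ⟩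
    N * 82        ≤⟨ m/n*n≤m r 82 ⟩
    r ∎
    where
    ring : ∀ N → 41 * (N + N) ≡ N * 82
    ring = solve-∀
  r≤164N : r ≤ 164 * N
  r≤164N = begin
    r                ≡⟨ r≡ ⟩
    r % 82 + N * 82  ≤⟨ +-monoˡ-≤ (N * 82) (ℕ.<⇒≤ (m%n<n r 82)) ⟩
    82 + N * 82      ≤⟨ +-monoˡ-≤ (N * 82) (*-monoʳ-≤ 82 0<N) ⟩
    82 * N + N * 82  ≡⟨ ring N ⟩
    164 * N ∎
    where
    ring : ∀ N → 82 * N + N * 82 ≡ 164 * N
    ring = solve-∀
  2d≤ : 2 * (1 * d) ≤ r + 1
  2d≤ = ≤-trans (≤-trans (*-mono-≤ (toWitness {a? = 2 ≤? 54000} _) (*-monoʳ-≤ 1 (≤-trans (≤-reflexive (sym (ℕ.*-identityʳ d))) (*-monoʳ-≤ d (*-mono-≤ (s≤s (z≤n {suc e})) (*-mono-≤ (s≤s (z≤n {suc e})) (s≤s (z≤n {s}))))))))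
    (≤-trans (≤-reflexive (ring 54000 d (suc s))) big)) (m≤m+n r 1)
    where
    ring : ∀ c d s → c * (1 * (d * (d * (d * s)))) ≡ c * ((d * (d * (d * 1))) * s)
    ring = solve-∀
  n≤Nk : n ≤ N * k
  n≤Nk = begin
    n                      ≤⟨ ℕ.<⇒≤ n< ⟩
    suc r ^ d              ≡⟨ cong (_^ d) (ℕ.+-comm 1 r) ⟩
    (r + 1) ^ d            ≤⟨ bernoulli-2 r 1 d (m≤n+m 1 r) 2d≤ ⟩
    2 * (r * r ^ suc e)    ≤⟨ *-monoʳ-≤ 2 (*-monoˡ-≤ (r ^ suc e) r≤164N) ⟩
    2 * (164 * N * r ^ suc e) ≡⟨ ring N (r ^ suc e) ⟩
    N * k ∎
    where
    ring : ∀ N x → 2 * (164 * N * x) ≡ N * (328 * x)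
    ring = solve-∀
  total : k * 2 + (41 * (N + G)) ^ suc e ≤ 657 * r ^ suc e
  total = begin
    k * 2 + (41 * (N + G)) ^ suc e       ≤⟨ +-monoʳ-≤ (k * 2) (^-monoˡ-≤ (suc e) 41[N+G]≤r) ⟩
    328 * r ^ suc e * 2 + r ^ suc e      ≡⟨ ring (r ^ suc e) ⟩
    657 * r ^ suc e ∎
    where
    ring : ∀ x → 328 * x * 2 + x ≡ 657 * x
    ring = solve-∀
p≤2^ (suc zero) (s≤s ())

-- Lower bound

norm : ∀ {k} → Vec ℕ k → ℕ
norm []      = 0
norm (a ∷ y) = a + norm y

-- simplex k m lists the y with norm y < m; simplexFrom k r z lists the z′ ∷ y with z ≤ z′
-- and norm (z′ ∷ y) < z + r.
simplex : ∀ k → ℕ → List (Vec ℕ k)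
simplexFrom : ∀ k → ℕ → ℕ → List (Vec ℕ (suc k))
simplex zero    zero    = []
simplex zero    (suc m) = [] ∷ []
simplex (suc k) m       = simplexFrom k m 0
simplexFrom k zero    z = []
simplexFrom k (suc r) z = map (z ∷_) (simplex k (suc r)) ++ simplexFrom k r (suc z)

∈-simplex⁺ : ∀ {k m} (y : Vec ℕ k) → norm y < m → y ∈ simplex k m
∈-simplexFrom⁺ : ∀ {k} r z i (y : Vec ℕ k) → i + norm y < r → (z + i ∷ y) ∈ simplexFrom k r z
∈-simplex⁺ {zero}  []      (s≤s _) = here refl
∈-simplex⁺ {suc k} {m} (a ∷ y) h = ∈-simplexFrom⁺ m 0 a y h
∈-simplexFrom⁺ (suc r) z zero    y h rewrite ℕ.+-identityʳ z = ∈-++⁺ˡ (∈-map⁺ (z ∷_) (∈-simplex⁺ y h))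
∈-simplexFrom⁺ (suc r) z (suc i) y (s≤s h) rewrite ℕ.+-suc z i = ∈-++⁺ʳ _ (∈-simplexFrom⁺ r (suc z) i y h)

∈-simplex⁻ : ∀ {k m} (y : Vec ℕ k) → y ∈ simplex k m → norm y < m
∈-simplexFrom⁻ : ∀ {k} r z (y : Vec ℕ (suc k)) → y ∈ simplexFrom k r z → z ≤ Vec.head y × norm y < z + r
∈-simplex⁻ {zero}  {suc m} [] _ = s≤s z≤n
∈-simplex⁻ {suc k} {m} y y∈ = proj₂ (∈-simplexFrom⁻ m 0 y y∈)
∈-simplexFrom⁻ {k} (suc r) z y y∈ with ∈-++⁻ (map (z ∷_) (simplex k (suc r))) y∈
... | inj₂ y∈′ = let (z< , h) = ∈-simplexFrom⁻ r (suc z) y y∈′ in ℕ.<⇒≤ z< , ≤-trans h (≤-reflexive (sym (ℕ.+-suc z r)))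
... | inj₁ y∈′ with ∈-map⁻ (z ∷_) y∈′
...   | y′ , y′∈ , refl = ≤-refl , ℕ.+-monoʳ-< z (∈-simplex⁻ y′ y′∈)

simplex! : ∀ k m → Unique (simplex k m)
simplexFrom! : ∀ k r z → Unique (simplexFrom k r z)
simplex! zero    zero    = []
simplex! zero    (suc m) = [] ∷ []
simplex! (suc k) m       = simplexFrom! k m 0
simplexFrom! k zero    z = []
simplexFrom! k (suc r) z = Unique.++⁺ (Unique.map⁺ (λ { refl → refl }) (simplex! k (suc r))) (simplexFrom! k r (suc z)) disjoint
  where
  disjoint : ∀ {x} → ¬ (x ∈ map (z ∷_) (simplex k (suc r)) × x ∈ simplexFrom k r (suc z))
  disjoint (x∈ , x∈′) with ∈-map⁻ (z ∷_) x∈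
  ... | _ , _ , refl = ℕ.1+n≰n (proj₁ (∈-simplexFrom⁻ r (suc z) _ x∈′))

length-simplex : ∀ k m → length (simplex k (suc m)) ≡ pascal m k
length-simplexFrom : ∀ k r z → length (simplexFrom k (suc r) z) ≡ pascal r (suc k)
length-simplex zero    m = sym (pascal-0 m)
length-simplex (suc k) m = length-simplexFrom k m 0
length-simplexFrom k r z = trans (length-++ (map (z ∷_) (simplex k (suc r))))
  (trans (cong₂ _+_ (trans (length-map (z ∷_) (simplex k (suc r))) (length-simplex k r)) refl) (rest r))
  where
  rest : ∀ r → pascal r k + length (simplexFrom k r (suc z)) ≡ pascal r (suc k)
  rest zero    = refl
  rest (suc r) = trans (ℕ.+-comm (pascal (suc r) k) _) (cong (_+ pascal (suc r) k) (length-simplexFrom k r (suc z)))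

sum-map-mono : ∀ {A : Set} (xs : List A) {f g : A → ℕ} → (∀ {x} → x ∈ xs → f x ≤ g x) → sum (map f xs) ≤ sum (map g xs)
sum-map-mono []       h = z≤n
sum-map-mono (x ∷ xs) h = +-mono-≤ (h (here refl)) (sum-map-mono xs λ x∈ → h (there x∈))

sum-map-* : ∀ {A : Set} c (xs : List A) (f : A → ℕ) → sum (map (λ x → c * f x) xs) ≡ c * sum (map f xs)
sum-map-* c []       f = sym (ℕ.*-zeroʳ c)
sum-map-* c (x ∷ xs) f = trans (cong (c * f x +_) (sum-map-* c xs f)) (sym (ℕ.*-distribˡ-+ c (f x) _))

-- Summing the gaps m + 1 - norm y counts the simplex one dimension up.
sum-gaps : ∀ k m → sum (map (λ y → suc m ∸ norm y) (simplex k (suc m))) ≡ pascal m (suc k)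
sum-gapsFrom : ∀ k r z → sum (map (λ y → z + suc r ∸ norm y) (simplexFrom k (suc r) z)) ≡ pascal r (suc (suc k))
sum-gaps zero    m = trans (ℕ.+-identityʳ (suc m)) (line m)
  where
  line : ∀ m → suc m ≡ pascal m 1
  line zero    = refl
  line (suc m) = trans (ℕ.+-comm 1 (suc m)) (cong (_+ 1) (line m))
sum-gaps (suc k) m = sum-gapsFrom k m 0
sum-gapsFrom k r z = trans (cong sum (map-++ gap (map (z ∷_) (simplex k (suc r))) (simplexFrom k r (suc z))))
  (trans (sum-++ (map gap (map (z ∷_) (simplex k (suc r)))) (map gap (simplexFrom k r (suc z))))
  (trans (cong₂ _+_ head refl) (rest r)))
  where
  gap : Vec ℕ (suc k) → ℕ
  gap y = z + suc r ∸ norm y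
  head : sum (map gap (map (z ∷_) (simplex k (suc r)))) ≡ pascal r (suc k)
  head = trans (cong sum (trans (sym (map-∘ (simplex k (suc r)))) (map-cong (λ y → ℕ.[m+n]∸[m+o]≡n∸o z (suc r) (norm y)) (simplex k (suc r))))) (sum-gaps k r)
  rest : ∀ r → pascal r (suc k) + sum (map (λ y → z + suc r ∸ norm y) (simplexFrom k r (suc z))) ≡ pascal r (suc (suc k))
  rest zero    = refl
  rest (suc r) = trans (ℕ.+-comm (pascal (suc r) (suc k)) _) (cong (_+ pascal (suc r) (suc k))
    (trans (cong (λ s → sum (map (λ y → s ∸ norm y) (simplexFrom k (suc r) (suc z)))) (ℕ.+-suc z (suc r))) (sum-gapsFrom k r (suc z))))

zeros : ∀ k → Vec ℕ k
zeros k = replicate k 0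

simplex-head : ∀ k m → ∃ λ ys → simplex k (suc m) ≡ zeros k ∷ ys
simplex-head zero    m = [] , refl
simplex-head (suc k) m with simplex k (suc m) | simplex-head k m
... | _ | ys , refl = map (0 ∷_) ys ++ simplexFrom k m 1 , refl

norm-mono : ∀ {k} (y y′ : Vec ℕ k) → (∀ i → Vec.lookup y i ≤ Vec.lookup y′ i) → norm y ≤ norm y′
norm-mono []      []        h = z≤n
norm-mono (a ∷ y) (a′ ∷ y′) h = +-mono-≤ (h Fin.zero) (norm-mono y y′ λ i → h (Fin.suc i))

norm-strict : ∀ {k} (y y′ : Vec ℕ k) → (∀ i → Vec.lookup y i ≤ Vec.lookup y′ i) → norm y ≡ norm y′ → y ≡ y′
norm-strict []      []        h e = refl
norm-strict (a ∷ y) (a′ ∷ y′) h e = cong₂ _∷_ a≡a′ (norm-strict y y′ (λ i → h (Fin.suc i)) (ℕ.+-cancelˡ-≡ a′ _ _ (trans (cong (_+ norm y) (sym a≡a′)) e)))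
  where
  a≡a′ : a ≡ a′
  a≡a′ = ℕ.≤-antisym (h Fin.zero) (ℕ.+-cancelʳ-≤ (norm y) a′ a (≤-trans (+-monoʳ-≤ a′ (norm-mono y y′ λ i → h (Fin.suc i))) (≤-reflexive (sym e))))

norm-0 : ∀ {k} (y : Vec ℕ k) → norm y ≡ 0 → y ≡ zeros k
norm-0 []         e = refl
norm-0 (zero ∷ y) e = cong (0 ∷_) (norm-0 y e)

norm-zeros : ∀ k → norm (zeros k) ≡ 0
norm-zeros zero    = refl
norm-zeros (suc k) = norm-zeros k

-- Lower sets below a decreasing height function

module Hypograph {k} (f : Vec ℕ k → ℕ) (ys : List (Vec ℕ k)) (ys! : Unique ys)
                 (antitone : ∀ y y′ → (∀ i → Vec.lookup y i ≤ Vec.lookup y′ i) → f y′ ≤ f y)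
                 (support : ∀ y → 0 < f y → y ∈ ys) where

  column : Vec ℕ k → List (Vec ℕ (suc k))
  column y = map (_∷ y) (upTo (f y))

  columns : List (Vec ℕ k) → List (Vec ℕ (suc k))
  columns []       = []
  columns (y ∷ ys) = column y ++ columns ys

  length-columns : ∀ ys → length (columns ys) ≡ sum (map f ys)
  length-columns []       = refl
  length-columns (y ∷ ys) = trans (length-++ (column y)) (cong₂ _+_ (trans (length-map (_∷ y) (upTo (f y))) (length-upTo (f y))) (length-columns ys))

  ∈-columns⁺ : ∀ {ys y z} → y ∈ ys → z < f y → (z ∷ y) ∈ columns ys
  ∈-columns⁺ {y = y} (here refl) h = ∈-++⁺ˡ (∈-map⁺ (_∷ y) (∈-upTo⁺ h))
  ∈-columns⁺ (there y∈)  h = ∈-++⁺ʳ _ (∈-columns⁺ y∈ h)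

  ∈-columns⁻ : ∀ ys {z y} → (z ∷ y) ∈ columns ys → y ∈ ys × z < f y
  ∈-columns⁻ (y₀ ∷ ys) x∈ with ∈-++⁻ (column y₀) x∈
  ... | inj₂ x∈′ = let (y∈ , h) = ∈-columns⁻ ys x∈′ in there y∈ , h
  ... | inj₁ x∈′ with ∈-map⁻ (_∷ y₀) x∈′
  ...   | z , z∈ , refl = here refl , ∈-upTo⁻ z∈

  columns! : ∀ {ys} → Unique ys → Unique (columns ys)
  columns! []                    = []
  columns! {y ∷ ys} (y∉ ∷ ys!) = Unique.++⁺ (Unique.map⁺ (λ { refl → refl }) (Unique.upTo⁺ (f y))) (columns! ys!) disjoint
    where
    disjoint : ∀ {x} → ¬ (x ∈ column y × x ∈ columns ys)
    disjoint (x∈ , x∈′) with ∈-map⁻ (_∷ y) x∈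
    ... | _ , _ , refl = All.lookup y∉ (proj₁ (∈-columns⁻ ys x∈′)) refl

  hypograph : LowerSet (suc k) (sum (map f ys))
  hypograph = record
    { points  = λ x → Vec.head x < f (Vec.tail x)
    ; isLower = λ { {_ ∷ y} {_ ∷ y′} h x′≤x → ℕ.<-≤-trans (ℕ.≤-<-trans (x′≤x Fin.zero) h) (antitone y′ y λ i → x′≤x (Fin.suc i)) }
    ; size    = columns ys , columns! ys! , length-columns ys ,
                λ { (z ∷ y) → mk⇔ (λ h → ∈-columns⁺ (support y (≤-trans (s≤s z≤n) h)) h) (λ x∈ → proj₂ (∈-columns⁻ ys x∈)) }
    }

funToFin-cong : ∀ {m n} {f g : Fin m → Fin n} → (∀ i → f i ≡ g i) → funToFin f ≡ funToFin g
funToFin-cong {zero}  h = refl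
funToFin-cong {suc m} h = cong₂ combine (h Fin.zero) (funToFin-cong λ i → h (Fin.suc i))

finToFun-injective : ∀ {m n} {i j : Fin (n ^ m)} → (∀ t → finToFun {n} {m} i t ≡ finToFun {n} {m} j t) → i ≡ j
finToFun-injective {m} {n} {i} {j} h = trans (sym (Fin.funToFin-finToFin {m} {n} i)) (trans (funToFin-cong h) (Fin.funToFin-finToFin {m} {n} j))

-- The column over y ≠ 0 has height 2(m - |y|) + c(y) with c(y) ∈ {0,1,2} free, and the column
-- over 0 takes up the remaining points.
module Family (k m n : ℕ) (fits : 2 * pascal m (suc k) ≤ n) where
  private
    𝟎 = zeros k

  ys : List (Vec ℕ k)
  ys = proj₁ (simplex-head k m)

  simplex≡ : simplex k (suc m) ≡ 𝟎 ∷ ys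
  simplex≡ = proj₂ (simplex-head k m)

  free : ℕ
  free = length ys

  free≡ : suc free ≡ pascal m k
  free≡ = trans (cong length (sym simplex≡)) (length-simplex k m)

  all! : Unique (𝟎 ∷ ys)
  all! = subst Unique simplex≡ (simplex! k (suc m))

  ys! : Unique ys
  ys! = AllPairs.tail all!

  𝟎∉ys : 𝟎 ∉ ys
  𝟎∉ys 𝟎∈ = All.lookup (AllPairs.head all!) 𝟎∈ refl

  norm-ys : ∀ {y} → y ∈ ys → norm y ≤ m
  norm-ys {y} y∈ = ℕ.≤-pred (∈-simplex⁻ y (subst (y ∈_) (sym simplex≡) (there y∈)))

  ∈-ys : ∀ {y} → y ≢ 𝟎 → norm y ≤ m → y ∈ ys
  ∈-ys {y} y≢𝟎 h with subst (y ∈_) simplex≡ (∈-simplex⁺ {k} {suc m} y (s≤s h))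
  ... | here y≡𝟎 = contradiction y≡𝟎 y≢𝟎
  ... | there y∈ = y∈

  module Member (i : Fin (3 ^ free)) where

    -- The index i is read as `free` ternary digits, one for each column outside the origin.
    choice : Vec ℕ k → ℕ
    choice y with y ∈? ys
    ... | yes y∈ = toℕ (finToFun {3} {free} i (Any.index y∈))
    ... | no  _  = 0

    choice≤2 : ∀ y → choice y ≤ 2
    choice≤2 y with y ∈? ys
    ... | yes y∈ = ℕ.≤-pred (Fin.toℕ<n (finToFun {3} {free} i (Any.index y∈)))
    ... | no  _  = z≤n

    choice-outside : ∀ y → y ∉ ys → choice y ≡ 0
    choice-outside y y∉ with y ∈? ys
    ... | yes y∈ = contradiction y∈ y∉
    ... | no  _  = refl

    choice-lookup : ∀ t → choice (List.lookup ys t) ≡ toℕ (finToFun {3} {free} i t)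
    choice-lookup t with List.lookup ys t ∈? ys
    ... | yes y∈ = cong (λ s → toℕ (finToFun {3} {free} i s)) (sym (lookup-injective sym ys! (Any.lookup-index y∈)))
    ... | no  y∉ = contradiction (∈-lookup t) y∉

    g : Vec ℕ k → ℕ
    g y = 2 * (m ∸ norm y) + choice y

    total : ℕ
    total = sum (map g ys)

    f : Vec ℕ k → ℕ
    f y with Vec.≡-dec _≟_ y 𝟎
    ... | yes _ = n ∸ total
    ... | no  _ = g y

    f-𝟎 : f 𝟎 ≡ n ∸ total
    f-𝟎 with Vec.≡-dec _≟_ 𝟎 𝟎
    ... | yes _ = refl
    ... | no 𝟎≢ = contradiction refl 𝟎≢

    f-other : ∀ {y} → y ≢ 𝟎 → f y ≡ g y
    f-other {y} y≢ with Vec.≡-dec _≟_ y 𝟎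
    ... | yes y≡ = contradiction y≡ y≢
    ... | no  _  = refl

    -- 2(m - |y|) + c(y) ≤ 2(m + 1 - |y|), and the right-hand sides sum to 2 · pascal m (k + 1).
    total+2m≤n : 2 * m + total ≤ n
    total+2m≤n = begin
      2 * m + total                                               ≤⟨ +-mono-≤ (≤-trans (*-monoʳ-≤ 2 (ℕ.n≤1+n m)) (≤-reflexive (cong (λ s → 2 * (suc m ∸ s)) (sym (norm-zeros k))))) (sum-map-mono ys bound) ⟩
      sum (map (λ y → 2 * (suc m ∸ norm y)) (𝟎 ∷ ys))           ≡⟨ cong (λ zs → sum (map (λ y → 2 * (suc m ∸ norm y)) zs)) (sym simplex≡) ⟩
      sum (map (λ y → 2 * (suc m ∸ norm y)) (simplex k (suc m))) ≡⟨ sum-map-* 2 (simplex k (suc m)) (λ y → suc m ∸ norm y) ⟩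
      2 * sum (map (λ y → suc m ∸ norm y) (simplex k (suc m)))  ≡⟨ cong (2 *_) (sum-gaps k m) ⟩
      2 * pascal m (suc k)                                        ≤⟨ fits ⟩
      n ∎
      where
      open ℕ.≤-Reasoning
      bound : ∀ {y} → y ∈ ys → g y ≤ 2 * (suc m ∸ norm y)
      bound {y} y∈ = ≤-trans (+-monoʳ-≤ (2 * (m ∸ norm y)) (choice≤2 y))
        (≤-reflexive (trans (ring (m ∸ norm y)) (cong (2 *_) (sym (ℕ.+-∸-assoc 1 (norm-ys y∈))))))
        where
        ring : ∀ a → 2 * a + 2 ≡ 2 * (1 + a)
        ring = solve-∀

    g-above : ∀ {y} → m < norm y → g y ≡ 0
    g-above {y} m< = cong₂ (λ a b → 2 * a + b) (ℕ.m≤n⇒m∸n≡0 (ℕ.<⇒≤ m<)) (choice-outside y λ y∈ → ℕ.<⇒≱ m< (norm-ys y∈))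

    -- Raising the norm by 1 lowers 2 (m - |y|) by 2, the full spread of the choices. So columns
    -- with different norms are ordered whatever is chosen.
    g-drop : ∀ {y w} → w < norm y → g y ≤ 2 * (m ∸ w)
    g-drop {y} {w} w< with norm y ≤? m
    ... | no  ≰m = ≤-trans (≤-reflexive (g-above (ℕ.≰⇒> ≰m))) z≤n
    ... | yes ≤m = begin
      2 * (m ∸ norm y) + choice y   ≤⟨ +-monoʳ-≤ (2 * (m ∸ norm y)) (choice≤2 y) ⟩
      2 * (m ∸ norm y) + 2          ≡⟨ ring (m ∸ norm y) ⟩
      2 * suc (m ∸ norm y)          ≤⟨ *-monoʳ-≤ 2 (ℕ.∸-monoʳ-< w< ≤m) ⟩
      2 * (m ∸ w) ∎
      where
      open ℕ.≤-Reasoning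
      ring : ∀ a → 2 * a + 2 ≡ 2 * suc a
      ring = solve-∀

    0<norm : ∀ {y} → y ≢ 𝟎 → 0 < norm y
    0<norm {y} y≢ = ℕ.n≢0⇒n>0 λ e → y≢ (norm-0 y e)

    antitone : ∀ y y′ → (∀ i → Vec.lookup y i ≤ Vec.lookup y′ i) → f y′ ≤ f y
    antitone y y′ y≤y′ = cases (Vec.≡-dec _≟_ y 𝟎) (Vec.≡-dec _≟_ y′ 𝟎) (norm y ≟ norm y′)
      where
      cases : Dec (y ≡ 𝟎) → Dec (y′ ≡ 𝟎) → Dec (norm y ≡ norm y′) → f y′ ≤ f y
      -- Comparable vectors with the same norm coincide.
      cases _ _ (yes e) = ≤-reflexive (cong f (sym (norm-strict y y′ y≤y′ e)))
      cases (yes refl) (yes refl) _ = ≤-refl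
      cases (no y≢) (yes refl) _ = contradiction (norm-0 y (ℕ.n≤0⇒n≡0 (≤-trans (norm-mono y y′ y≤y′) (≤-reflexive (norm-zeros k))))) y≢
      -- The remainder left for the column over 0 is at least 2 m, and no other column is higher
      -- than that.
      cases (yes refl) (no y′≢) _ = ≤-trans (≤-reflexive (f-other y′≢)) (≤-trans (g-drop {y′} (0<norm y′≢))
        (≤-trans (ℕ.m+n≤o⇒m≤o∸n (2 * m) total+2m≤n) (≤-reflexive (sym f-𝟎))))
      cases (no y≢) (no y′≢) (no w≢) = ≤-trans (≤-reflexive (f-other y′≢))
        (≤-trans (g-drop {y′} (ℕ.≤∧≢⇒< (norm-mono y y′ y≤y′) w≢)) (≤-trans (m≤m+n _ (choice y)) (≤-reflexive (sym (f-other y≢)))))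

    support : ∀ y → 0 < f y → y ∈ 𝟎 ∷ ys
    support y 0<f with Vec.≡-dec _≟_ y 𝟎
    ... | yes y≡ = here y≡
    ... | no  y≢ with norm y ≤? m
    ...   | yes ≤m = there (∈-ys y≢ ≤m)
    ...   | no  ≰m = contradiction (subst (0 <_) (g-above (ℕ.≰⇒> ≰m)) 0<f) λ ()

    sum≡n : sum (map f (𝟎 ∷ ys)) ≡ n
    sum≡n = trans (cong₂ _+_ f-𝟎 (cong sum (map-cong-local {f = f} {g = g} {xs = ys} (All.tabulate λ {y} y∈ → f-other λ { refl → 𝟎∉ys y∈ }))))
      (ℕ.m∸n+n≡m (≤-trans (m≤n+m total (2 * m)) total+2m≤n))

    member : LowerSet (suc k) n
    member = subst (LowerSet (suc k)) sum≡n (Hypograph.hypograph f (𝟎 ∷ ys) all! antitone support)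

    -- `member` is a transport along `sum≡n`; for a variable right-hand side the equation can be
    -- matched with `refl`.
    points-member : LowerSet.points member ≐ λ x → Vec.head x < f (Vec.tail x)
    points-member = subst-points sum≡n
      where
      subst-points : ∀ {n} (eq : sum (map f (𝟎 ∷ ys)) ≡ n) →
        LowerSet.points (subst (LowerSet (suc k)) eq (Hypograph.hypograph f (𝟎 ∷ ys) all! antitone support)) ≐ λ x → Vec.head x < f (Vec.tail x)
      subst-points refl = (λ h → h) , (λ h → h)

  open Member using (member; points-member; f; f-other; g; choice; choice-lookup)

  -- If the column of i over y were higher, the point at height `f j y` over y would lie in the
  -- first set and not in the second.
  member-⊆ : ∀ i j → (∀ {x} → LowerSet.points (member i) x → LowerSet.points (member j) x) → ∀ y → f i y ≤ f j y
  member-⊆ i j S⊆T y = ℕ.≮⇒≥ λ fj<fi → ℕ.<-irrefl refl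
    (proj₁ (points-member j) {f j y ∷ y} (S⊆T (proj₂ (points-member i) {f j y ∷ y} fj<fi)))

  member-injective : ∀ i j → LowerSet.points (member i) ≐ LowerSet.points (member j) → i ≡ j
  member-injective i j (S⊆T , T⊆S) = finToFun-injective {free} {3} λ t → Fin.toℕ-injective (trans (sym (choice-lookup i t)) (trans
    (ℕ.+-cancelˡ-≡ (2 * (m ∸ norm (List.lookup ys t))) _ _ (trans (sym (f-other i (y≢ t))) (trans
      (ℕ.≤-antisym (member-⊆ i j S⊆T (List.lookup ys t)) (member-⊆ j i T⊆S (List.lookup ys t))) (f-other j (y≢ t))))) (choice-lookup j t)))
    where
    y≢ : ∀ t → List.lookup ys t ≢ 𝟎
    y≢ t eq = 𝟎∉ys (subst (_∈ ys) eq (∈-lookup t))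

  3^free≤p : 3 ^ free ≤ p (suc k) n
  3^free≤p = Fin.injective⇒≤ {f = position} λ {i} {j} eq → member-injective i j
    (≐-trans (≐-sym (found i)) (≐-trans (Bijection.cong (p-counts (suc k) n) eq) (found j)))
    where
    position : Fin (3 ^ free) → Fin (p (suc k) n)
    position i = proj₁ (Bijection.surjective (p-counts (suc k) n) (member i))
    found : ∀ i → LowerSet.points (Bijection.to (p-counts (suc k) n) (position i)) ≐ LowerSet.points (member i)
    found i = proj₂ (Bijection.surjective (p-counts (suc k) n) (member i)) refl

-- With log 3 > 21/20 this makes ((log 3) d)ᵈ > d! 2ᵈ⁻¹ with room to spare.
factorial-bound : ∀ j → 100 * (20 ^ (2 + j) * (2 ^ suc j * (2 + j) !)) ≤ 99 * (21 ^ (2 + j) * (2 + j) ^ (2 + j))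
factorial-bound zero    = toWitness {a? = 160000 ≤? 174636} _
factorial-bound (suc j) = begin
  100 * (20 * A * (2 * B * (suc d * D)))   ≡⟨ ring₁ 100 20 2 A B D (suc d) ⟩
  20 * (2 * suc d) * (100 * (A * (B * D))) ≤⟨ *-mono-≤ (*-monoˡ-≤ (2 * suc d) (ℕ.n≤1+n 20)) (factorial-bound j) ⟩
  21 * (2 * suc d) * (99 * (21 ^ d * d ^ d)) ≡⟨ ring₂ 21 2 (suc d) 99 (21 ^ d) (d ^ d) ⟩
  99 * (21 * 21 ^ d * (suc d * (2 * d ^ d))) ≤⟨ *-monoʳ-≤ 99 (*-monoʳ-≤ (21 * 21 ^ d) (*-monoʳ-≤ (suc d) double)) ⟩
  99 * (21 ^ suc d * suc d ^ suc d) ∎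
  where
  open ℕ.≤-Reasoning
  d = 2 + j
  A = 20 ^ d
  B = 2 ^ suc j
  D = d !
  ring₁ : ∀ h t w A B D s → h * (t * A * (w * B * (s * D))) ≡ t * (w * s) * (h * (A * (B * D)))
  ring₁ = solve-∀
  ring₂ : ∀ a w s h x y → a * (w * s) * (h * (x * y)) ≡ h * (a * x * (s * (w * y)))
  ring₂ = solve-∀
  double : 2 * d ^ d ≤ suc d ^ d
  double = ≤-trans (≤-reflexive (ring d (d ^ suc j))) (≤-trans (bernoulli-lower d 1 (suc j)) (≤-reflexive (cong (_^ d) (ℕ.+-comm d 1))))
    where
    ring : ∀ d x → 2 * (d * x) ≡ d * x + d * (1 * x)
    ring = solve-∀

-- Eliminating x from the two estimates, with d! = d (d - 1)!, leaves n^(d-1) ≤ (100/99) 2^(d-1) (d!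
-- / d^d) P^d. Here 100/99 is the price of replacing x + d by x in the power d (d - 1), and
-- `factorial-bound` bounds the whole constant by (21/20)^d. The factor 99 (d! (d - 1)!)^d keeps the
-- computation in ℕ.
root-bound : ∀ j n x P → n * (2 + j) ! ≤ 2 * (x + (2 + j)) ^ (2 + j) → x ^ suc j ≤ suc j ! * P →
             100 * ((2 + j) * ((2 + j) * suc j)) ≤ x + (2 + j) → 20 ^ (2 + j) * n ^ suc j ≤ (21 * P) ^ (2 + j)
root-bound j n x P above below large = ℕ.*-cancelˡ-≤ (99 * (D ^ d * f ^ d)) {{>-nonZero 0<c}} (begin
  99 * (D ^ d * f ^ d) * (20 ^ d * n ^ k)         ≡⟨ ring₁ 99 D (D ^ k) (f ^ d) (20 ^ d) (n ^ k) ⟩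
  99 * (20 ^ d * (D * f ^ d)) * (n ^ k * D ^ k)   ≡⟨ cong (99 * (20 ^ d * (D * f ^ d)) *_) (sym (^-distrib-* n D k)) ⟩
  99 * (20 ^ d * (D * f ^ d)) * (n * D) ^ k       ≤⟨ *-monoʳ-≤ (99 * (20 ^ d * (D * f ^ d))) (^-monoˡ-≤ k above) ⟩
  99 * (20 ^ d * (D * f ^ d)) * (2 * X ^ d) ^ k   ≡⟨ cong (99 * (20 ^ d * (D * f ^ d)) *_) (trans (^-distrib-* 2 (X ^ d) k) (cong (2 ^ k *_) (ℕ.^-*-assoc X d k))) ⟩
  99 * (20 ^ d * (D * f ^ d)) * (2 ^ k * X ^ (d * k)) ≡⟨ ring₂ 99 (20 ^ d) D (f ^ d) (2 ^ k) (X ^ (d * k)) ⟩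
  20 ^ d * (2 ^ k * D) * f ^ d * (99 * X ^ (d * k)) ≤⟨ *-monoʳ-≤ (20 ^ d * (2 ^ k * D) * f ^ d) (bernoulli-ratio 99 x d (d * k) (≤-trans (s≤s z≤n) (m≤n+m d x)) large) ⟩
  20 ^ d * (2 ^ k * D) * f ^ d * (100 * x ^ (d * k)) ≡⟨ ring₃ (20 ^ d * (2 ^ k * D)) (f ^ d) 100 (x ^ (d * k)) ⟩
  100 * (20 ^ d * (2 ^ k * D)) * (f ^ d * x ^ (d * k)) ≤⟨ *-monoˡ-≤ (f ^ d * x ^ (d * k)) (factorial-bound j) ⟩
  99 * (21 ^ d * d ^ d) * (f ^ d * x ^ (d * k))   ≡⟨ ring₄ 99 (21 ^ d) (d ^ d) (f ^ d) (x ^ (d * k)) ⟩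
  99 * ((d ^ d * f ^ d) * (21 ^ d * x ^ (d * k))) ≡⟨ cong₂ (λ a b → 99 * (a * (21 ^ d * b))) (sym (^-distrib-* d f d)) (trans (cong (x ^_) (ℕ.*-comm d k)) (sym (ℕ.^-*-assoc x k d))) ⟩
  99 * (D ^ d * (21 ^ d * (x ^ k) ^ d))           ≤⟨ *-monoʳ-≤ 99 (*-monoʳ-≤ (D ^ d) (*-monoʳ-≤ (21 ^ d) (^-monoˡ-≤ d below))) ⟩
  99 * (D ^ d * (21 ^ d * (f * P) ^ d))           ≡⟨ cong (λ a → 99 * (D ^ d * (21 ^ d * a))) (^-distrib-* f P d) ⟩
  99 * (D ^ d * (21 ^ d * (f ^ d * P ^ d)))       ≡⟨ ring₅ 99 (D ^ d) (21 ^ d) (f ^ d) (P ^ d) ⟩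
  99 * (D ^ d * f ^ d) * (21 ^ d * P ^ d)         ≡⟨ cong (99 * (D ^ d * f ^ d) *_) (sym (^-distrib-* 21 P d)) ⟩
  99 * (D ^ d * f ^ d) * (21 * P) ^ d ∎)
  where
  open ℕ.≤-Reasoning
  d = 2 + j
  k = suc j
  f = k !
  D = d !
  X = x + d
  0<c : 0 < 99 * (D ^ d * f ^ d)
  0<c = *-mono-≤ (s≤s (z≤n {98})) (*-mono-≤ (ℕ.m^n>0 D {{ℕ._!≢0 d}} d) (ℕ.m^n>0 f {{ℕ._!≢0 k}} d))
  ring₁ : ∀ c D x f t n → c * (D * x * f) * (t * n) ≡ c * (t * (D * f)) * (n * x)
  ring₁ = solve-∀
  ring₂ : ∀ c t D f w X → c * (t * (D * f)) * (w * X) ≡ t * (w * D) * f * (c * X)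
  ring₂ = solve-∀
  ring₃ : ∀ a f c x → a * f * (c * x) ≡ c * a * (f * x)
  ring₃ = solve-∀
  ring₄ : ∀ c t d f x → c * (t * d) * (f * x) ≡ c * ((d * f) * (t * x))
  ring₄ = solve-∀
  ring₅ : ∀ c D t f P → c * (D * (t * (f * P))) ≡ c * (D * f) * (t * P)
  ring₅ = solve-∀

lower : ∀ j n → (30 * (2 + j)) ^ (2 * (2 + j) ^ 2) ≤ n → (0<y : fromℕ 0 <ʳ n ^[ suc j / 2 + j ]) →
        fromℕ 1 <ʳ log (p (2 + j) n) ÷ n ^[ suc j / 2 + j ] ⟨ 0<y ⟩
lower j n large 0<y = ratio-> n k d (p d n) 0<y {free} {t} 3^free≤p n^k≤t^d t-small
  where
  d k : ℕ
  d = 2 + j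
  k = suc j
  2≤d : 2 ≤ d
  2≤d = s≤s (s≤s z≤n)
  2≤n : 2 ≤ n
  2≤n = ≤-trans (≤-trans (toWitness {a? = 2 ≤? 60} _) (≤-trans (*-monoʳ-≤ 30 2≤d) (≤-trans (≤-reflexive (sym (ℕ.*-identityʳ (30 * d))))
    (^-monoʳ-≤ (30 * d) (≤-trans (s≤s z≤n) (*-monoʳ-≤ 2 (ℕ.m^n>0 d 2))))))) large
  -- For this m the family fits into n points, while 2 C(m + 1 + d, d) already exceeds n; the latter
  -- bounds n in terms of the number of columns.
  br = bracket (λ m → 2 * pascal m d) 2≤n n (≤-trans (suc≤pascal n (suc j)) (m≤m+n _ _))
  m = proj₁ br
  open ℕ.≤-Reasoning

  x P : ℕ
  x = suc m
  P = pascal m k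

  above : n * d ! ≤ 2 * (x + d) ^ d
  above = begin
    n * d !                   ≤⟨ *-monoˡ-≤ (d !) (ℕ.<⇒≤ (proj₂ (proj₂ br))) ⟩
    2 * pascal x d * d !      ≡⟨ trans (ℕ.*-assoc 2 (pascal x d) (d !)) (cong (2 *_) (ℕ.*-comm (pascal x d) (d !))) ⟩
    2 * (d ! * pascal x d)    ≤⟨ *-monoʳ-≤ 2 (pascal-≤ x d) ⟩
    2 * (x + d) ^ d ∎

  n≤X^d : n ≤ (x + d) ^ d
  n≤X^d = ℕ.*-cancelˡ-≤ 2 (≤-trans (≤-trans (≤-reflexive (ℕ.*-comm 2 n)) (*-monoʳ-≤ n (*-mono-≤ 2≤d (ℕ.1≤n! k)))) above)

  x⁴ : (30 * d) ^ 4 ≤ x + d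
  x⁴ = fourth-power {d} 2≤d (root-large {d} large (≤-trans (s≤s n≤X^d) (ℕ.^-monoˡ-< d (ℕ.n<1+n (x + d)))))

  cube : 30 * (30 * 30) * (d * (d * d)) ≤ x + d
  cube = ≤-trans (≤-reflexive (ring 30 d)) (≤-trans (^-monoʳ-≤ (30 * d) (ℕ.n≤1+n 3)) x⁴)
    where
    ring : ∀ c d → c * (c * c) * (d * (d * d)) ≡ c * d * (c * d * (c * d * 1))
    ring = solve-∀

  x-large : 100 * (d * (d * k)) ≤ x + d
  x-large = ≤-trans (*-mono-≤ (toWitness {a? = 100 ≤? 30 * (30 * 30)} _) (*-monoʳ-≤ d (*-monoʳ-≤ d (ℕ.n≤1+n k)))) cube

  500≤x : 500 ≤ x
  500≤x = ℕ.+-cancelʳ-≤ d 500 x (≤-trans (+-monoˡ-≤ d (*-monoʳ-≤ 500 (s≤s (z≤n {k})))) (≤-trans (≤-reflexive (ring 500 d))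
    (≤-trans (*-mono-≤ (toWitness {a? = 501 ≤? 30 * (30 * 30)} _) (≤-trans (≤-reflexive (sym (ℕ.*-identityʳ d))) (*-monoʳ-≤ d (*-mono-≤ (s≤s (z≤n {k})) (s≤s (z≤n {k})))))) cube)))
    where
    ring : ∀ c d → c * d + d ≡ suc c * d
    ring = solve-∀

  open Family k m n (proj₁ (proj₂ br)) using (free; free≡; 3^free≤p)

  t : ℕ
  t = suc (21 * P / 20)

  21P≤20t : 21 * P ≤ 20 * t
  21P≤20t = begin
    21 * P                                   ≡⟨ m≡m%n+[m/n]*n (21 * P) 20 ⟩
    21 * P % 20 + 21 * P / 20 * 20           ≤⟨ +-monoˡ-≤ (21 * P / 20 * 20) (ℕ.<⇒≤ (m%n<n (21 * P) 20)) ⟩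
    20 + 21 * P / 20 * 20                    ≡⟨ ℕ.*-comm t 20 ⟩
    20 * t ∎

  n^k≤t^d : n ^ k ≤ t ^ d
  n^k≤t^d = ℕ.*-cancelˡ-≤ (20 ^ d) {{ℕ.m^n≢0 20 d}} (begin
    20 ^ d * n ^ k    ≤⟨ root-bound j n x P above (pascal-≥ m k) x-large ⟩
    (21 * P) ^ d      ≤⟨ ^-monoˡ-≤ d 21P≤20t ⟩
    (20 * t) ^ d      ≡⟨ ^-distrib-* 20 t d ⟩
    20 ^ d * t ^ d ∎)

  -- The margin between log 3 > 53/50 and 21/20 is 1/100 per column. It has to cover the rounding in
  -- t, the summand 2 and the column over 0, which amounts to 405 < `free`.
  t-small : 50 * (2 + t) < 53 * free
  t-small = ℕ.*-cancelˡ-< 2 (50 * (2 + t)) (53 * free) (begin-strict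
    2 * (50 * (2 + t))               ≡⟨ ring₁ (21 * P / 20) ⟩
    300 + 5 * (21 * P / 20 * 20)     ≤⟨ +-monoʳ-≤ 300 (*-monoʳ-≤ 5 (m/n*n≤m (21 * P) 20)) ⟩
    300 + 5 * (21 * P)               ≡⟨ cong (λ a → 300 + 5 * (21 * a)) (sym free≡) ⟩
    300 + 5 * (21 * suc free)        ≡⟨ ring₂ free ⟩
    405 + 105 * free                 <⟨ +-monoˡ-≤ (105 * free) 405<free ⟩
    free + 105 * free                ≡⟨ ℕ.*-assoc 2 53 free ⟩
    2 * (53 * free) ∎)
    where
    ring₁ : ∀ y → 2 * (50 * (2 + suc y)) ≡ 300 + 5 * (y * 20)
    ring₁ = solve-∀
    ring₂ : ∀ y → 300 + 5 * (21 * suc y) ≡ 405 + 105 * y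
    ring₂ = solve-∀
    405<free : 405 < free
    405<free = ℕ.≤-pred (≤-trans (toWitness {a? = 407 ≤? 500} _) (≤-trans 500≤x (≤-trans (suc≤pascal m j) (≤-reflexive (sym free≡)))))

upper : ∀ j n → (30 * (2 + j)) ^ (2 * (2 + j) ^ 2) ≤ n → (0<y : fromℕ 0 <ʳ n ^[ suc j / 2 + j ]) →
        log (p (2 + j) n) ÷ n ^[ suc j / 2 + j ] ⟨ 0<y ⟩ <ʳ fromℕ 7200
upper j n large 0<y = ratio-< n k d (p d n) 0<y (p≤2^ d 2≤d r-large (proj₂ (proj₂ root))) r^k^d≤n^k 0<t bits
  where
  open ℕ.≤-Reasoning
  d = 2 + j
  k = suc j
  2≤d : 2 ≤ d
  2≤d = s≤s (s≤s z≤n)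
  root = floor-root d n
  r = proj₁ root
  r-large : (30 * d) ^ (2 * d) ≤ r
  r-large = root-large {d} large (proj₂ (proj₂ root))
  2≤r^k : 2 ≤ r ^ k
  2≤r^k = ≤-trans (≤-trans (toWitness {a? = 2 ≤? 12960000} _) (≤-trans (60⁴≤ 2≤d) (fourth-power {d} 2≤d r-large)))
    (ℕ.m≤m*n r (r ^ j) {{ℕ.m^n≢0 r j {{>-nonZero (≤-trans (s≤s z≤n) (≤-trans (60⁴≤ 2≤d) (fourth-power {d} 2≤d r-large)))}}}})
  -- `ratio-<` asks for an integer strictly below the power n^(k/d), and r^k itself may be equal to
  -- it.
  t = r ^ k ∸ 1
  1+t≡ : suc t ≡ r ^ k
  1+t≡ = ℕ.m+[n∸m]≡n (≤-trans (s≤s z≤n) 2≤r^k)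
  0<t : 0 < t
  0<t = ℕ.≤-pred (≤-trans 2≤r^k (≤-reflexive (sym 1+t≡)))
  r^k^d≤n^k : suc t ^ d ≤ n ^ k
  r^k^d≤n^k = begin
    suc t ^ d      ≡⟨ cong (_^ d) 1+t≡ ⟩
    (r ^ k) ^ d    ≡⟨ trans (ℕ.^-*-assoc r k d) (trans (cong (r ^_) (ℕ.*-comm k d)) (sym (ℕ.^-*-assoc r d k))) ⟩
    (r ^ d) ^ k    ≤⟨ ^-monoˡ-≤ k (proj₁ (proj₂ root)) ⟩
    n ^ k ∎
  bits : suc (657 * r ^ k) ≤ 7000 * t
  bits = begin
    suc (657 * r ^ k)      ≡⟨ cong (λ a → suc (657 * a)) (sym 1+t≡) ⟩
    suc (657 * suc t)      ≡⟨ cong suc (ℕ.*-suc 657 t) ⟩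
    658 + 657 * t          ≤⟨ +-monoˡ-≤ (657 * t) (≤-trans (toWitness {a? = 658 ≤? 6343} _) (≤-trans (≤-reflexive (sym (ℕ.*-identityʳ 6343))) (*-monoʳ-≤ 6343 0<t))) ⟩
    6343 * t + 657 * t     ≡⟨ sym (ℕ.*-distribʳ-+ t 6343 657) ⟩
    7000 * t ∎

theorem1 : ∀ (d n : ℕ) .{{_ : NonZero d}} .{{_ : NonZero n}} →
    d ≥ 2 → n ≥ (30 * d) ^ (2 * d ^ 2) →
    let ratio = log (p d n) ÷ (n ^[ d ∸ 1 / d ]) ⟨ ^[/]-positive n (d ∸ 1) d ⟩ in
    (fromℕ 1 <ʳ ratio) × (ratio <ʳ fromℕ 7200)
theorem1 (suc (suc j)) n d≥2 large =
  lower j n large (^[/]-positive n (suc j) (2 + j)) , upper j n large (^[/]-positive n (suc j) (2 + j))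
theorem1 (suc zero) n (s≤s ())
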